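{- Let $F$ be a non-bipartite graph and $r$ a positive integer. Then for every $n$ there is an $n$-vertex complete $(\chi(F)-1)$-partite graph $T$ such that \[\mathrm{ex}_r(n,F)=e_r(T)+\Theta\big(\mathrm{biex}(n,F)\,n^{r-1}\big)\] as $n\to\infty$.
   Context: For a graph $G$ with degree sequence $d_1,\dots,d_n$, $e_r(G)=\sum_i d_i^r$; $\mathrm{ex}_r(n,F)$ is the maximum of $e_r(G)$ over $n$-vertex $F$-free graphs $G$. For a graph $F$ with $\chi(F)=k+1$, its decomposition family $\mathcal{D}(F)$ is the family of bipartite graphs obtained as the subgraph of $F$ induced by the union of two color classes of some proper $(k+1)$-coloring of $F$. $\mathrm{biex}(n,F)=\mathrm{ex}(n,\mathcal{D}(F))$, the maximum number of edges of an $n$-vertex graph containing no member of $\mathcal{D}(F)$. -}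

module Defs where

open import Data.Nat using (ℕ; zero; suc; _+_; _*_; _^_; _≤_; _<_)
open import Data.Fin using (Fin; toℕ)
open import Data.Bool using (Bool; true; false)
open import Data.List using (List; map; filter; length)
open import Data.Nat.ListAction using (sum)
open import Data.List using () renaming (allFin to allFinL)
open import Data.Fin using () renaming (_<?_ to _<ᶠ?_)
open import Data.Product using (Σ; ∃; _×_; _,_)
open import Relation.Binary.PropositionalEquality using (_≡_; _≢_)
open import Relation.Nullary using (¬_)
open import Relation.Nullary.Decidable using (⌊_⌋)
open import Data.Bool using (T)

record Graph (n : ℕ) : Set where
  field
    adj    : Fin n → Fin n → Bool
    sym    : ∀ u v → adj u v ≡ adj v u
    irrefl : ∀ u → adj u u ≡ false
open Graph public

Adj : ∀ {n} → Graph n → Fin n → Fin n → Set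
Adj G u v = adj G u v ≡ true

degree : ∀ {n} → Graph n → Fin n → ℕ
degree {n} G u = length (filter (λ v → T? (adj G u v)) (allFinL n))
  where
  open import Data.Bool.Properties using (T?)

eR : ℕ → ∀ {n} → Graph n → ℕ
eR r {n} G = sum (map (λ u → degree G u ^ r) (allFinL n))

edges : ∀ {n} → Graph n → ℕ
edges {n} G = sum (map (λ u → length (filter (λ v → T? (adj G u v))
                                        (filter (λ v → u <ᶠ? v) (allFinL n))))
                       (allFinL n))
  where
  open import Data.Bool.Properties using (T?)

Contains : ∀ {n m} → Graph n → Graph m → Set
Contains {n} {m} G F =
  Σ (Fin m → Fin n) λ f →
    (∀ u v → f u ≡ f v → u ≡ v) × (∀ u v → Adj F u v → Adj G (f u) (f v))

Free : ∀ {n m} → Graph n → Graph m → Set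
Free G F = ¬ Contains G F

ProperColouring : ∀ {m} → Graph m → (k : ℕ) → (Fin m → Fin k) → Set
ProperColouring F k c = ∀ u v → Adj F u v → c u ≢ c v

Colourable : ∀ {m} → Graph m → ℕ → Set
Colourable F k = Σ (_ → Fin k) (ProperColouring F k)

ChromaticNumber : ∀ {m} → Graph m → ℕ → Set
ChromaticNumber F k = Colourable F k × (∀ j → j < k → ¬ Colourable F j)

Bipartite : ∀ {m} → Graph m → Set
Bipartite F = Colourable F 2

-- Decomposition family.  For χ(F) = k+1, a member of D(F) is given by a
-- proper (k+1)-colouring c and two distinct colours i ≠ j; the member is
-- the subgraph F[c⁻¹{i,j}] induced by those two colour classes.
-- G contains this member iff there is a map f : V(F) → V(G) which is
-- injective and edge-preserving on the vertex set c⁻¹{i,j}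
-- (the values of f outside c⁻¹{i,j} are irrelevant).

InClasses : ∀ {m k} → (Fin m → Fin k) → Fin k → Fin k → Fin m → Set
InClasses c i j u = (c u ≡ i) Data.Sum.⊎ (c u ≡ j)
  where import Data.Sum

ContainsMember : ∀ {n m} → Graph n → Graph m → (k : ℕ) →
                 (c : Fin m → Fin k) → Fin k → Fin k → Set
ContainsMember {n} {m} G F k c i j =
  Σ (Fin m → Fin n) λ f →
    (∀ u v → InClasses c i j u → InClasses c i j v → f u ≡ f v → u ≡ v) ×
    (∀ u v → InClasses c i j u → InClasses c i j v →
             Adj F u v → Adj G (f u) (f v))

DFree : ∀ {n m} → Graph n → Graph m → (k : ℕ) → Set
DFree G F k =
  ∀ (c : _ → Fin (suc k)) → ProperColouring F (suc k) c →
  ∀ i j → i ≢ j → ¬ ContainsMember G F (suc k) c i j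

IsExR : ℕ → (n : ℕ) → ∀ {m} → Graph m → ℕ → Set
IsExR r n F M =
  (Σ (Graph n) λ G → Free G F × eR r G ≡ M) ×
  (∀ (G : Graph n) → Free G F → eR r G ≤ M)

IsBiex : (n : ℕ) → ∀ {m} → Graph m → (k : ℕ) → ℕ → Set
IsBiex n F k B =
  (Σ (Graph n) λ G → DFree G F k × edges G ≡ B) ×
  (∀ (G : Graph n) → DFree G F k → edges G ≤ B)

CompleteMultipartite : ∀ {n} → ℕ → Graph n → Set
CompleteMultipartite {n} k G =
  Σ (Fin n → Fin k) λ p →
    (∀ (a : Fin k) → Σ (Fin n) λ u → p u ≡ a) ×
    (∀ u v → (Adj G u v → p u ≢ p v) × (p u ≢ p v → Adj G u v))

module Submission where

-- For the lower bound, a D(F)-free graph with biex(n, F) edges is made bipartite, restricted to a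
-- dense vertex set of the size of a class, and put inside that class of T: a copy of F in the result
-- would be (k + 1)-coloured with two of the colours inside the class.
--
-- For the upper bound let G be extremal.  Since G has few copies of K_{k+1} (Erdős' theorem on
-- blow-ups), Erdős' degree majorisation and Füredi's stability argument give a partition with o(n²)
-- inner edges; made locally optimal, it has linear classes and few missing crossing pairs.  In units
-- of n^(r-1), passing from T to G gains at most a constant per inner edge and loses at least a
-- constant per missing pair.  Typical vertices of one class span a D(F)-free graph.  Any other vertex
-- misses many more pairs than it has inner edges, unless its inner degree is linear; there are
-- boundedly many vertices of the last kind, and if there is one, stars are D(F)-free, so that
-- biex(n, F) is at least n - 1.

open import Defs
open import Data.Bool.Base using (Bool; true; false; not; _∧_; _∨_; if_then_else_)
open import Data.Bool.Properties as Bool using (T?; ∧-comm; ∧-assoc; ∧-identityʳ; ∧-zeroʳ; not-involutive)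
open import Data.Empty using (⊥; ⊥-elim)
open import Data.Fin.Base as F using (Fin; zero; suc; punchIn; punchOut)
open import Data.Fin.Permutation using (Permutation′; _⟨$⟩ʳ_; _⟨$⟩ˡ_; inverseˡ; _∘ₚ_; lift₀; transpose)
  renaming (id to idₚ)
open import Data.Fin.Properties as Fin using (_≟_; any?; punchInᵢ≢i; punchOut-injective)
open import Data.List.Base using ([]; _∷_; map; filter; length; tabulate)
import Data.Nat.ListAction as ListAction
open import Data.Nat.Base using (ℕ; zero; suc; _+_; _*_; _^_; _∸_; _≤_; _<_; z≤n; s≤s; NonZero; >-nonZero; ⌊_/2⌋)
open import Data.Nat.Properties hiding (_≟_)
open import Data.Nat.Tactic.RingSolver using (solve-∀)
open import Data.Product.Base using (Σ; ∃; _×_; _,_; proj₁; proj₂)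
open import Data.Sum.Base using (_⊎_; inj₁; inj₂; [_,_]′)
open import Data.Vec.Base using (Vec; []; _∷_)
open import Function.Base using (_∘_; id; case_of_)
open import Relation.Binary.Definitions using (tri<; tri≈; tri>)
open import Relation.Binary.PropositionalEquality as ≡
  using (_≡_; _≢_; _≗_; refl; cong; cong₂; subst; subst₂; trans)
open import Relation.Nullary using (¬_; Dec; yes; no; does)
open import Relation.Nullary.Decidable using (dec-true; dec-false; _×-dec_; _⊎-dec_)
open import Relation.Nullary.Negation using (contradiction)
open import Algebra.Properties.Semiring.Sum +-*-semiring
  using (sum; sum-remove; ∑-distrib-+; ∑-comm; sum-permute; *-distribˡ-sum; *-distribʳ-sum)
  renaming (sum-cong-≗ to sum-cong)

-- For r > 1 the best complete k-partite graph need not be balanced, and its class sizes are never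
-- computed: `T` is read off from the extremal graph. All that is used of optimality is
-- `Dominating`: complete k-partite graphs are F-free, so none of them has a larger degree power sum
-- than G. This already forces linear classes, since otherwise half of the largest class could be
-- moved into a tiny one. The lower bound only permutes the vertices of the partition found for the
-- upper bound, so both bounds speak of the same number e_r(T). With r = s + 1, a class ratio `c`
-- turns a power `D ^ s` of a crossing degree into `n ^ s` at the price `c ^ s`; this is the origin
-- of that factor throughout. Gains and losses are added on opposite sides of inequalities because
-- subtraction in ℕ truncates. The constants are chosen in a fixed order: `c` depends on k and s
-- only; then come `γ` and `β`, the densities `κ` of missing pairs that the embeddings tolerate, the
-- stability parameter `δ` that guarantees them, and finally the clique threshold `a`.

private variable
  n m k : ℕ

-- Reduces a linear inequality to an identity for the ring solver: s is the slack left over when the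
-- hypotheses, added up to a ≤ b, are subtracted from x ≤ y.
lincomb : ∀ {a b x y} → a ≤ b → ∀ s → x + b + s ≡ y + a → x ≤ y
lincomb {a} {b} {x} {y} a≤b s eq = +-cancelʳ-≤ a x y (begin
  x + a      ≤⟨ +-monoʳ-≤ x a≤b ⟩
  x + b      ≤⟨ m≤m+n (x + b) s ⟩
  x + b + s  ≡⟨ eq ⟩
  y + a      ∎)
  where open ≤-Reasoning

does-true : ∀ {a} {A : Set a} (a? : Dec A) → does a? ≡ true → A
does-true (yes a) _ = a

does-false : ∀ {a} {A : Set a} (a? : Dec A) → does a? ≡ false → ¬ A
does-false (no ¬a) _ = ¬a

does-sym : (x y : Fin k) → does (x ≟ y) ≡ does (y ≟ x)
does-sym x y with y ≟ x
... | yes p = dec-true (x ≟ y) (≡.sym p)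
... | no ¬p = dec-false (x ≟ y) (¬p ∘ ≡.sym)

true≢false : ∀ {b} → b ≡ true → b ≢ false
true≢false refl ()

¬true⇒false : ∀ {b} → b ≢ true → b ≡ false
¬true⇒false {false} _ = refl
¬true⇒false {true}  h = contradiction refl h

∧-true : ∀ {a b} → a ∧ b ≡ true → a ≡ true × b ≡ true
∧-true {true} {true} _ = refl , refl

∧-right : ∀ a {b} → a ∧ b ≡ true → b ≡ true
∧-right true h = h

true-∧ : ∀ {a b} → a ≡ true → b ≡ true → a ∧ b ≡ true
true-∧ refl refl = refl

not-true : ∀ {a} → not a ≡ true → a ≡ false
not-true {false} _ = refl

true-not : ∀ {a} → a ≡ false → not a ≡ true
true-not refl = refl

-- Finite sums and counting

-- Opacity keeps the head symbol rigid, so that summands can be inferred.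
opaque
  ∑ : (Fin n → ℕ) → ℕ
  ∑ = sum

  ∑-empty : (f : Fin 0 → ℕ) → ∑ f ≡ 0
  ∑-empty f = refl

  ∑-suc : (f : Fin (suc n) → ℕ) → ∑ f ≡ f zero + ∑ (f ∘ suc)
  ∑-suc f = refl

  ∑-cong : {f g : Fin n → ℕ} → f ≗ g → ∑ f ≡ ∑ g
  ∑-cong = sum-cong

  ∑-mono : {f g : Fin n → ℕ} → (∀ i → f i ≤ g i) → ∑ f ≤ ∑ g
  ∑-mono {zero}  h = z≤n
  ∑-mono {suc n} h = +-mono-≤ (h zero) (∑-mono (h ∘ suc))

  ∑-const : ∀ n c → ∑ {n} (λ _ → c) ≡ n * c
  ∑-const zero    c = refl
  ∑-const (suc n) c = cong (c +_) (∑-const n c)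

  ∑-*ˡ : ∀ c (f : Fin n → ℕ) → ∑ (λ i → c * f i) ≡ c * ∑ f
  ∑-*ˡ c f = ≡.sym (*-distribˡ-sum c f)

  ∑-*ʳ : ∀ c (f : Fin n → ℕ) → ∑ (λ i → f i * c) ≡ ∑ f * c
  ∑-*ʳ c f = ≡.sym (*-distribʳ-sum c f)

  ∑-+ : (f g : Fin n → ℕ) → ∑ (λ i → f i + g i) ≡ ∑ f + ∑ g
  ∑-+ = ∑-distrib-+

  ∑-swap : (f : Fin n → Fin m → ℕ) → ∑ (λ i → ∑ (f i)) ≡ ∑ (λ j → ∑ (λ i → f i j))
  ∑-swap = ∑-comm

  ∑-remove : ∀ (v : Fin (suc n)) (f : Fin (suc n) → ℕ) → ∑ f ≡ f v + ∑ (f ∘ punchIn v)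
  ∑-remove v f = sum-remove {i = v} f

  ∑-permute : (f : Fin n → ℕ) (π : Permutation′ n) → ∑ f ≡ ∑ (λ x → f (π ⟨$⟩ʳ x))
  ∑-permute = sum-permute

  term≤∑ : ∀ (f : Fin n → ℕ) i → f i ≤ ∑ f
  term≤∑ f zero    = m≤m+n (f zero) _
  term≤∑ f (suc i) = ≤-trans (term≤∑ (f ∘ suc) i) (m≤n+m _ (f zero))

∑-zero : ∑ {n} (λ _ → 0) ≡ 0
∑-zero {n} = trans (∑-const n 0) (*-zeroʳ n)

∑-bound : ∀ {f : Fin n → ℕ} c → (∀ i → f i ≤ c) → ∑ f ≤ n * c
∑-bound {n} c h = ≤-trans (∑-mono h) (≤-reflexive (∑-const n c))

𝟙 : Bool → ℕ
𝟙 true  = 1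
𝟙 false = 0

𝟙≤1 : ∀ b → 𝟙 b ≤ 1
𝟙≤1 true  = ≤-refl
𝟙≤1 false = z≤n

𝟙-mono : ∀ {a b} → (a ≡ true → b ≡ true) → 𝟙 a ≤ 𝟙 b
𝟙-mono {false} h = z≤n
𝟙-mono {true}  h = ≤-reflexive (cong 𝟙 (≡.sym (h refl)))

𝟙-∧ : ∀ a b → 𝟙 (a ∧ b) ≡ 𝟙 a * 𝟙 b
𝟙-∧ true  b = ≡.sym (+-identityʳ (𝟙 b))
𝟙-∧ false b = refl

count : (Fin n → Bool) → ℕ
count P = ∑ (λ x → 𝟙 (P x))

count-cong : {P Q : Fin n → Bool} → P ≗ Q → count P ≡ count Q
count-cong h = ∑-cong (λ x → cong 𝟙 (h x))

count≤n : (P : Fin n → Bool) → count P ≤ n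
count≤n {n} P = ≤-trans (∑-bound 1 (λ x → 𝟙≤1 (P x))) (≤-reflexive (*-identityʳ n))

count-mono : {P Q : Fin n → Bool} → (∀ x → P x ≡ true → Q x ≡ true) → count P ≤ count Q
count-mono h = ∑-mono (λ x → 𝟙-mono (h x))

count-∪ : {P Q R : Fin n → Bool} → (∀ x → P x ≡ true → Q x ≡ true ⊎ R x ≡ true) →
          count P ≤ count Q + count R
count-∪ {P = P} {Q} {R} h =
  ≤-trans (∑-mono λ x → aux x (P x) (h x)) (≤-reflexive (∑-+ (𝟙 ∘ Q) (𝟙 ∘ R)))
  where
  aux : ∀ x b → (b ≡ true → Q x ≡ true ⊎ R x ≡ true) → 𝟙 b ≤ 𝟙 (Q x) + 𝟙 (R x)
  aux x false _ = z≤n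
  aux x true  h with h refl
  ... | inj₁ q = ≤-trans (≤-reflexive (cong 𝟙 (≡.sym q))) (m≤m+n _ _)
  ... | inj₂ r = ≤-trans (≤-reflexive (cong 𝟙 (≡.sym r))) (m≤n+m _ _)

count-split : (P Q : Fin n → Bool) →
              count P ≡ count (λ x → P x ∧ Q x) + count (λ x → P x ∧ not (Q x))
count-split P Q = trans (∑-cong λ x → aux (P x) (Q x)) (∑-+ _ _)
  where
  aux : ∀ a b → 𝟙 a ≡ 𝟙 (a ∧ b) + 𝟙 (a ∧ not b)
  aux false b     = refl
  aux true  true  = refl
  aux true  false = refl

count-true : count {n} (λ _ → true) ≡ n
count-true {n} = trans (∑-const n 1) (*-identityʳ n)

count-single : (v : Fin n) → count (λ x → does (v ≟ x)) ≡ 1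
count-single {suc n} v = trans (∑-remove v _) (cong₂ _+_
  (cong 𝟙 (dec-true (v ≟ v) refl))
  (trans (∑-cong λ x → cong 𝟙 (dec-false (v ≟ punchIn v x) (punchInᵢ≢i v x ∘ ≡.sym))) ∑-zero))

∑-pick : (f : Fin n → ℕ) (v : Fin n) → ∑ (λ x → 𝟙 (does (v ≟ x)) * f x) ≡ f v
∑-pick {suc n} f v = trans (∑-remove v _) (trans (cong₂ _+_
  (trans (cong (λ b → 𝟙 b * f v) (dec-true (v ≟ v) refl)) (*-identityˡ (f v)))
  (trans (∑-cong λ x → cong (λ b → 𝟙 b * f (punchIn v x))
           (dec-false (v ≟ punchIn v x) (punchInᵢ≢i v x ∘ ≡.sym))) ∑-zero))
  (+-identityʳ (f v)))

Injective : ∀ {a} {A : Set a} → (Fin k → A) → Set a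
Injective f = ∀ u v → f u ≡ f v → u ≡ v

count-suc : (P : Fin (suc n) → Bool) → count P ≡ 𝟙 (P zero) + count (P ∘ suc)
count-suc P = ∑-suc (𝟙 ∘ P)

enumerate : ∀ {L} (P : Fin n → Bool) → L ≤ count P →
            Σ (Fin L → Fin n) λ e → Injective e × (∀ i → P (e i) ≡ true)
enumerate {n} {zero} P _ = (λ ()) , (λ ()) , λ ()
enumerate {zero} {suc L} P L≤ with () ← ≤-trans L≤ (≤-reflexive (∑-empty (𝟙 ∘ P)))
enumerate {suc n} {suc L} P L≤ = go (P zero) refl (≤-trans L≤ (≤-reflexive (count-suc P)))
  where
  go : ∀ b → P zero ≡ b → suc L ≤ 𝟙 b + count (P ∘ suc) →
       Σ (Fin (suc L) → Fin (suc n)) λ e → Injective e × (∀ i → P (e i) ≡ true)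
  go false _ L≤ with enumerate (P ∘ suc) L≤
  ... | e , inj , sat = suc ∘ e , (λ u v eq → inj u v (Fin.suc-injective eq)) , sat
  go true P0 (s≤s L≤) with enumerate (P ∘ suc) L≤
  ... | e , inj , sat = e′ , inj′ , sat′
    where
    e′ : Fin (suc L) → Fin (suc n)
    e′ zero    = zero
    e′ (suc i) = suc (e i)
    inj′ : Injective e′
    inj′ zero    zero    _  = refl
    inj′ (suc u) (suc v) eq = cong suc (inj u v (Fin.suc-injective eq))
    sat′ : ∀ i → P (e′ i) ≡ true
    sat′ zero    = P0
    sat′ (suc i) = sat i

witness : (P : Fin n → Bool) → 1 ≤ count P → ∃ λ x → P x ≡ true
witness P h with enumerate P h
... | e , _ , sat = e zero , sat zero

subset-of-size : ∀ y (P : Fin n → Bool) → y ≤ count P →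
                 Σ (Fin n → Bool) λ Q → (∀ x → Q x ≡ true → P x ≡ true) × count Q ≡ y
subset-of-size {n} zero P _ = (λ _ → false) , (λ _ ()) , ∑-zero {n}
subset-of-size {zero} (suc y) P y≤ with () ← ≤-trans y≤ (≤-reflexive (∑-empty (𝟙 ∘ P)))
subset-of-size {suc n} (suc y) P y≤ = go (P zero) refl (≤-trans y≤ (≤-reflexive (count-suc P)))
  where
  extend : Bool → (Fin n → Bool) → Fin (suc n) → Bool
  extend b Q zero    = b
  extend b Q (suc x) = Q x
  go : ∀ b → P zero ≡ b → suc y ≤ 𝟙 b + count (P ∘ suc) →
       Σ (Fin (suc n) → Bool) λ Q → (∀ x → Q x ≡ true → P x ≡ true) × count Q ≡ suc y
  go false _ y≤ with subset-of-size (suc y) (P ∘ suc) y≤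
  ... | Q , Q⊆P , eq = extend false Q , (λ { (suc x) → Q⊆P x }) ,
                       trans (count-suc (extend false Q)) eq
  go true P0 (s≤s y≤) with subset-of-size y (P ∘ suc) y≤
  ... | Q , Q⊆P , eq = extend true Q , (λ { zero _ → P0 ; (suc x) → Q⊆P x }) ,
                       trans (count-suc (extend true Q)) (cong suc eq)

transposeˡ : (i j : Fin n) → transpose i j ⟨$⟩ʳ i ≡ j
transposeˡ i j rewrite dec-true (i ≟ i) refl = refl

-- One transposition makes the heads agree and induction handles the tails; equal counts guarantee a
-- position to swap with. The lower bound uses this to carry a class onto a prescribed vertex set.
matching-permutation : (P S : Fin n → Bool) → count P ≡ count S →
                       Σ (Permutation′ n) λ π → ∀ u → P (π ⟨$⟩ʳ u) ≡ S u
matching-permutation {zero}  P S eq = idₚ , λ ()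
matching-permutation {suc n} P S eq = go (P zero) (S zero) refl refl
  where
  heads : ∀ P → count P ≡ count S → P zero ≡ S zero →
          Σ (Permutation′ (suc n)) λ π → ∀ u → P (π ⟨$⟩ʳ u) ≡ S u
  heads P eq h with matching-permutation (P ∘ suc) (S ∘ suc)
    (+-cancelˡ-≡ (𝟙 (S zero)) _ _ (trans (cong (λ b → 𝟙 b + count (P ∘ suc)) (≡.sym h))
      (trans (≡.sym (count-suc P)) (trans eq (count-suc S)))))
  ... | π , ok = lift₀ π , λ { zero → h ; (suc u) → ok u }

  moved : ∀ a → P a ≡ S zero → Σ (Permutation′ (suc n)) λ π → ∀ u → P (π ⟨$⟩ʳ u) ≡ S u
  moved a Pa with heads (λ u → P (transpose zero a ⟨$⟩ʳ u))
    (trans (≡.sym (∑-permute (𝟙 ∘ P) (transpose zero a))) eq)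
    (trans (cong P (transposeˡ zero a)) Pa)
  ... | π , ok = π ∘ₚ transpose zero a , ok

  ¬false⇒true : ∀ {b} → b ≢ false → b ≡ true
  ¬false⇒true {true}  _ = refl
  ¬false⇒true {false} h = contradiction refl h

  heads-eq : ∀ {b c} → P zero ≡ b → S zero ≡ c →
             𝟙 b + count (P ∘ suc) ≡ 𝟙 c + count (S ∘ suc)
  heads-eq refl refl = trans (≡.sym (count-suc P)) (trans eq (count-suc S))

  go : ∀ b c → P zero ≡ b → S zero ≡ c →
       Σ (Permutation′ (suc n)) λ π → ∀ u → P (π ⟨$⟩ʳ u) ≡ S u
  go true  true  P0 S0 = heads P eq (trans P0 (≡.sym S0))
  go false false P0 S0 = heads P eq (trans P0 (≡.sym S0))
  go false true  P0 S0 =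
    let (a , Pa) = witness (P ∘ suc) (≤-trans (s≤s z≤n) (≤-reflexive (≡.sym (heads-eq P0 S0))))
    in moved (suc a) (trans Pa (≡.sym S0))
  -- If every later entry of `P` were `true`, then `P` would have more true entries than `S` can
  -- have.
  go true  false P0 S0 with any? (λ a → P (suc a) Bool.≟ false)
  ... | yes (a , Pa) = moved (suc a) (trans Pa (≡.sym S0))
  ... | no ¬a = ⊥-elim (<-irrefl refl (begin-strict
    n                      ≡⟨ count-true {n} ⟨
    count {n} (λ _ → true) ≤⟨ count-mono (λ x _ → ¬false⇒true (λ e → ¬a (x , e))) ⟩
    count (P ∘ suc)        <⟨ ≤-refl ⟩
    suc (count (P ∘ suc))  ≡⟨ heads-eq P0 S0 ⟩
    count (S ∘ suc)        ≤⟨ count≤n (S ∘ suc) ⟩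
    n                      ∎))
    where open ≤-Reasoning

∑∑-remove : ∀ (v : Fin (suc n)) (f : Fin (suc n) → Fin (suc n) → ℕ) →
  ∑ (λ u → ∑ (f u)) ≡ ∑ (f v) +
    (∑ (λ u → f (punchIn v u) v) + ∑ λ u → ∑ λ w → f (punchIn v u) (punchIn v w))
∑∑-remove v f = trans (∑-remove v _) (cong (∑ (f v) +_)
  (trans (∑-cong λ u → ∑-remove v (f (punchIn v u))) (∑-+ _ _)))

-- Degrees and edge counts as sums

deg : Graph n → Fin n → ℕ
deg G u = count (adj G u)

length-filter : ∀ {a} {A : Set a} (P : A → Bool) (g : Fin n → A) →
                length (filter (λ x → T? (P x)) (tabulate g)) ≡ count (P ∘ g)
length-filter {zero}  P g = ≡.sym (∑-empty _)
length-filter {suc n} P g with P (g zero) in eq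
... | true  = trans (cong suc (length-filter P (g ∘ suc)))
                (≡.sym (trans (count-suc (P ∘ g)) (cong (λ b → 𝟙 b + count (P ∘ g ∘ suc)) eq)))
... | false = trans (length-filter P (g ∘ suc))
                (≡.sym (trans (count-suc (P ∘ g)) (cong (λ b → 𝟙 b + count (P ∘ g ∘ suc)) eq)))

listSum-tabulate : ∀ {a} {A : Set a} (f : A → ℕ) (g : Fin n → A) →
                   ListAction.sum (map f (tabulate g)) ≡ ∑ (f ∘ g)
listSum-tabulate {zero}  f g = ≡.sym (∑-empty _)
listSum-tabulate {suc n} f g =
  trans (cong (f (g zero) +_) (listSum-tabulate f (g ∘ suc))) (≡.sym (∑-suc (f ∘ g)))

eR≡ : ∀ r (G : Graph n) → eR r G ≡ ∑ (λ u → deg G u ^ r)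
eR≡ r G = trans (listSum-tabulate _ id)
                (∑-cong λ u → cong (_^ r) (length-filter (adj G u) id))

length-filter₂ : ∀ {a} {A : Set a} (P : A → Bool) {B : A → Set} (B? : ∀ x → Dec (B x))
                 (g : Fin n → A) →
                 length (filter (λ x → T? (P x)) (filter B? (tabulate g))) ≡
                 count (λ i → does (B? (g i)) ∧ P (g i))
length-filter₂ {zero}  P B? g = ≡.sym (∑-empty _)
length-filter₂ {suc n} P B? g with does (B? (g zero)) in eq
... | false = trans (length-filter₂ P B? (g ∘ suc))
                (≡.sym (trans (count-suc _) (cong₂ _+_ (cong (λ b → 𝟙 (b ∧ P (g zero))) eq) refl)))
... | true with P (g zero) in eq′
...   | true  = trans (cong suc (length-filter₂ P B? (g ∘ suc)))
                  (≡.sym (trans (count-suc _) (cong₂ _+_ (cong₂ (λ b c → 𝟙 (b ∧ c)) eq eq′) refl)))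
...   | false = trans (length-filter₂ P B? (g ∘ suc))
                  (≡.sym (trans (count-suc _) (cong₂ _+_ (cong₂ (λ b c → 𝟙 (b ∧ c)) eq eq′) refl)))

handshake : (G : Graph n) → edges G + edges G ≡ ∑ (deg G)
handshake {n} G = begin
  edges G + edges G
    ≡⟨ cong₂ _+_ edges≡ (trans edges≡ (∑-swap _)) ⟩
  (∑ λ u → ∑ λ v → up u v) + (∑ λ v → ∑ λ u → up u v)
    ≡⟨ ∑-+ _ _ ⟨
  (∑ λ u → (∑ λ v → up u v) + (∑ λ v → up v u))
    ≡⟨ ∑-cong (λ u → ≡.sym (∑-+ _ _)) ⟩
  (∑ λ u → ∑ λ v → up u v + up v u)
    ≡⟨ ∑-cong (λ u → ∑-cong (both u)) ⟩
  ∑ (deg G) ∎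
  where
  open ≡.≡-Reasoning
  up : Fin n → Fin n → ℕ
  up u v = 𝟙 (does (u Fin.<? v) ∧ adj G u v)
  edges≡ : edges G ≡ ∑ λ u → ∑ λ v → up u v
  edges≡ = trans (listSum-tabulate _ id)
                 (∑-cong λ u → length-filter₂ (adj G u) (λ v → u Fin.<? v) id)
  up-< : ∀ u v → u F.< v → up u v ≡ 𝟙 (adj G u v)
  up-< u v u<v = cong (λ b → 𝟙 (b ∧ adj G u v)) (dec-true (u Fin.<? v) u<v)
  up-≮ : ∀ u v → ¬ u F.< v → up u v ≡ 0
  up-≮ u v u≮v = cong (λ b → 𝟙 (b ∧ adj G u v)) (dec-false (u Fin.<? v) u≮v)
  both : ∀ u v → up u v + up v u ≡ 𝟙 (adj G u v)
  both u v with Fin.<-cmp u v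
  ... | tri< u<v _ v≮u = trans (cong₂ _+_ (up-< u v u<v) (up-≮ v u v≮u)) (+-identityʳ _)
  ... | tri> u≮v _ v<u = trans (cong₂ _+_ (up-≮ u v u≮v) (up-< v u v<u)) (cong 𝟙 (sym G v u))
  ... | tri≈ u≮u refl _ = trans (cong₂ _+_ (up-≮ u u u≮u) (up-≮ u u u≮u))
                            (cong 𝟙 (≡.sym (irrefl G u)))

-- Partitions

nb : Graph n → (Fin n → Fin k) → Fin n → Fin k → ℕ
nb G p v l = count (λ w → adj G v w ∧ does (p w ≟ l))

inner : Graph n → (Fin n → Fin k) → Fin n → ℕ
inner G p v = nb G p v (p v)

crossing : (Fin n → Fin k) → Fin n → ℕ
crossing p v = count (λ w → not (does (p w ≟ p v)))

missing : Graph n → (Fin n → Fin k) → Fin n → Fin n → Bool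
missing G p v w = not (adj G v w) ∧ not (does (p w ≟ p v))

miss : Graph n → (Fin n → Fin k) → Fin n → ℕ
miss G p v = count (missing G p v)

size : (Fin n → Fin k) → Fin k → ℕ
size p l = count (λ w → does (p w ≟ l))

multipartite : (Fin n → Fin k) → Graph n
multipartite p .adj u v  = not (does (p v ≟ p u))
multipartite p .sym u v  = cong not (does-sym (p v) (p u))
multipartite p .irrefl u = cong not (dec-true (p u ≟ p u) refl)

-- `crossing p v` is the degree of `v` in the complete multipartite graph of `p`. Passing to `G`
-- adds the inner edges and removes the missing pairs.
deg-balance : ∀ (G : Graph n) (p : Fin n → Fin k) v →
              deg G v + miss G p v ≡ crossing p v + inner G p v
deg-balance G p v = trans (≡.sym (∑-+ _ _))
  (trans (∑-cong λ w → pointwise (adj G v w) (does (p w ≟ p v))) (∑-+ _ _))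
  where
  pointwise : ∀ a s → 𝟙 a + 𝟙 (not a ∧ not s) ≡ 𝟙 (not s) + 𝟙 (a ∧ s)
  pointwise true  true  = refl
  pointwise true  false = refl
  pointwise false true  = refl
  pointwise false false = refl

count-not : (P : Fin n → Bool) → count P + count (not ∘ P) ≡ n
count-not P = trans (≡.sym (∑-+ _ _)) (trans (∑-cong λ w → pointwise (P w)) count-true)
  where
  pointwise : ∀ a → 𝟙 a + 𝟙 (not a) ≡ 1
  pointwise true  = refl
  pointwise false = refl

size+crossing : ∀ (p : Fin n → Fin k) v → size p (p v) + crossing p v ≡ n
size+crossing p v = count-not (λ w → does (p w ≟ p v))

∑-size : (p : Fin n → Fin k) → ∑ (size p) ≡ n
∑-size {n} p = trans (∑-swap _) (trans (∑-cong λ w → count-single (p w)) count-true)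

size≤crossing : ∀ (p : Fin n → Fin k) v l → l ≢ p v → size p l ≤ crossing p v
size≤crossing p v l l≢ = count-mono λ w pw → true-not (dec-false (p w ≟ p v)
  λ e → l≢ (trans (≡.sym (does-true (p w ≟ l) pw)) e))

multipartite-colourable : (p : Fin n → Fin k) → ProperColouring (multipartite p) k p
multipartite-colourable p u v uv e =
  true≢false uv (cong not (dec-true (p v ≟ p u) (≡.sym e)))

colourable-free : ∀ {F : Graph m} (G : Graph n) → ¬ Colourable F k → Colourable G k → Free G F
colourable-free G ¬col (c , proper) (f , _ , hom) =
  ¬col (c ∘ f , λ u v uv → proper (f u) (f v) (hom u v uv))

-- Moving `v` changes its row and, by symmetry, its column of the double sum, hence the factor 2;
-- the entry common to both vanishes as there are no loops.
inner-recolour : ∀ (G : Graph n) (p : Fin n → Fin k) v l →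
  ∑ (inner G (λ u → if does (v ≟ u) then l else p u)) + 2 * inner G p v
  ≡ ∑ (inner G p) + 2 * nb G p v l
inner-recolour {n = suc n} G p v l = begin
  ∑ (inner G q) + 2 * inner G p v
    ≡⟨ cong (_+ 2 * inner G p v) (expand q) ⟩
  inner G q v + (inner G q v + rest q) + 2 * inner G p v
    ≡⟨ cong₂ (λ a b → a + (a + b) + 2 * inner G p v) row-q rest-q ⟩
  nb G p v l + (nb G p v l + rest p) + 2 * inner G p v
    ≡⟨ rearrange (nb G p v l) (rest p) (inner G p v) ⟩
  inner G p v + (inner G p v + rest p) + 2 * nb G p v l
    ≡⟨ cong (_+ 2 * nb G p v l) (expand p) ⟨
  ∑ (inner G p) + 2 * nb G p v l ∎
  where
  open ≡.≡-Reasoning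
  q : Fin (suc n) → Fin _
  q u = if does (v ≟ u) then l else p u
  rest : (Fin (suc n) → Fin _) → ℕ
  rest p = ∑ λ u → ∑ λ w →
    𝟙 (adj G (punchIn v u) (punchIn v w) ∧ does (p (punchIn v w) ≟ p (punchIn v u)))
  rearrange : ∀ a r i → a + (a + r) + 2 * i ≡ i + (i + r) + 2 * a
  rearrange = solve-∀
  expand : ∀ p → ∑ (inner G p) ≡ inner G p v + (inner G p v + rest p)
  expand p = trans (∑∑-remove v _) (cong (λ x → inner G p v + (x + rest p))
    (trans (∑-cong λ u → cong 𝟙 (cong₂ _∧_ (sym G (punchIn v u) v) (does-sym (p v) (p (punchIn v u)))))
      (≡.sym (trans (∑-remove v _) (cong₂ _+_ (cong (λ b → 𝟙 (b ∧ does (p v ≟ p v))) (irrefl G v)) refl)))))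
  qv : q v ≡ l
  qv = cong (if_then l else p v) (dec-true (v ≟ v) refl)
  q-punch : ∀ u → q (punchIn v u) ≡ p (punchIn v u)
  q-punch u = cong (if_then l else p (punchIn v u))
                (dec-false (v ≟ punchIn v u) (punchInᵢ≢i v u ∘ ≡.sym))
  rest-q : rest q ≡ rest p
  rest-q = ∑-cong λ u → ∑-cong λ w →
    cong₂ (λ a b → 𝟙 (adj G (punchIn v u) (punchIn v w) ∧ does (a ≟ b))) (q-punch w) (q-punch u)
  row-q : inner G q v ≡ nb G p v l
  row-q = begin
    inner G q v
      ≡⟨ ∑-remove v _ ⟩
    𝟙 (adj G v v ∧ does (q v ≟ q v)) + (∑ λ w → 𝟙 (adj G v (punchIn v w) ∧ does (q (punchIn v w) ≟ q v)))
      ≡⟨ cong₂ _+_ (cong (λ b → 𝟙 (b ∧ does (q v ≟ q v))) (irrefl G v))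
           (∑-cong λ w → cong₂ (λ a b → 𝟙 (adj G v (punchIn v w) ∧ does (a ≟ b))) (q-punch w) qv) ⟩
    (∑ λ w → 𝟙 (adj G v (punchIn v w) ∧ does (p (punchIn v w) ≟ l)))
      ≡⟨ cong₂ _+_ (cong (λ b → 𝟙 (b ∧ does (p v ≟ l))) (irrefl G v)) refl ⟨
    𝟙 (adj G v v ∧ does (p v ≟ l)) + (∑ λ w → 𝟙 (adj G v (punchIn v w) ∧ does (p (punchIn v w) ≟ l)))
      ≡⟨ ∑-remove v _ ⟨
    nb G p v l ∎

-- In such a partition a vertex of linear inner degree has linearly many neighbours in every class.
-- With two classes it is a locally maximal cut.
LocallyOptimal : Graph n → (Fin n → Fin k) → Set
LocallyOptimal G p = ∀ v l → inner G p v ≤ nb G p v l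

-- Moving a vertex to a class where it has fewer neighbours lowers the sum of inner degrees, so that
-- sum bounds the number of moves.
local-optimum : ∀ (G : Graph n) (p : Fin n → Fin k) →
  Σ (Fin n → Fin k) λ q → ∑ (inner G q) ≤ ∑ (inner G p) × LocallyOptimal G q
local-optimum {n} {k} G p = descend (suc (∑ (inner G p))) p ≤-refl
  where
  descend : ∀ fuel (p : Fin n → Fin k) → ∑ (inner G p) < fuel →
    Σ (Fin n → Fin k) λ q → ∑ (inner G q) ≤ ∑ (inner G p) × LocallyOptimal G q
  descend (suc fuel) p (s≤s bound) with any? (λ v → any? (λ l → nb G p v l <? inner G p v))
  ... | no none = p , ≤-refl , λ v l → ≮⇒≥ λ lt → none (v , l , lt)
  ... | yes (v , l , lt) =
    let less = decrease (inner-recolour G p v l) lt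
        (q , q≤ , opt) = descend fuel (λ u → if does (v ≟ u) then l else p u) (≤-trans less bound)
    in q , ≤-trans q≤ (<⇒≤ less) , opt
    where
    decrease : ∀ {a b x y} → a + 2 * x ≡ b + 2 * y → y < x → a < b
    decrease {a} {b} {x} {y} eq y<x = +-cancelʳ-< (2 * x) a b
      (subst (_< b + 2 * x) (≡.sym eq) (+-monoʳ-< b (*-monoʳ-< 2 y<x)))

-- Powers

^-distrib-* : ∀ a b s → (a * b) ^ s ≡ a ^ s * b ^ s
^-distrib-* a b zero    = refl
^-distrib-* a b (suc s) = trans (cong (a * b *_) (^-distrib-* a b s)) (aux a b (a ^ s) (b ^ s))
  where
  aux : ∀ a b p q → a * b * (p * q) ≡ a * p * (b * q)
  aux = solve-∀

-- The power of the larger base is kept on purpose: when `d + x` is a crossing degree it is linear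
-- in n, while a degree `d` below it may be small.
pow-below : ∀ s d x → d ^ suc s + x * (d + x) ^ s ≤ (d + x) ^ suc s
pow-below s d x = begin
  d * d ^ s + x * (d + x) ^ s        ≤⟨ +-monoˡ-≤ _ (*-monoʳ-≤ d (^-monoˡ-≤ s (m≤m+n d x))) ⟩
  d * (d + x) ^ s + x * (d + x) ^ s  ≡⟨ *-distribʳ-+ ((d + x) ^ s) d x ⟨
  (d + x) * (d + x) ^ s              ∎
  where open ≤-Reasoning

pow-increment : ∀ s d x → d ^ suc s + x * d ^ s ≤ (d + x) ^ suc s
pow-increment s d x = ≤-trans
  (+-monoʳ-≤ (d ^ suc s) (*-monoʳ-≤ x (^-monoˡ-≤ s (m≤m+n d x)))) (pow-below s d x)

-- The mean value bound for the power s + 1, by induction on `s`.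
pow-above : ∀ s d x → (d + x) ^ suc s ≤ d ^ suc s + suc s * x * (d + x) ^ s
pow-above zero    d x = ≤-reflexive (aux d x)
  where
  aux : ∀ d x → (d + x) * 1 ≡ d * 1 + 1 * x * 1
  aux = solve-∀
pow-above (suc s) d x = begin
  (d + x) * e                           ≡⟨ *-distribʳ-+ e d x ⟩
  d * e + x * e                         ≤⟨ +-monoˡ-≤ (x * e) (*-monoʳ-≤ d (pow-above s d x)) ⟩
  d * (d ^ suc s + suc s * x * f) + x * e ≡⟨ aux₁ d (d ^ suc s) (suc s) x f e ⟩
  d ^ suc (suc s) + (suc s * x * (d * f) + x * e)
    ≤⟨ +-monoʳ-≤ (d ^ suc (suc s)) (+-monoˡ-≤ (x * e)
         (*-monoʳ-≤ (suc s * x) (*-monoˡ-≤ f (m≤m+n d x)))) ⟩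
  d ^ suc (suc s) + (suc s * x * e + x * e) ≡⟨ aux₂ (d ^ suc (suc s)) s x e ⟩
  d ^ suc (suc s) + suc (suc s) * x * e ∎
  where
  open ≤-Reasoning
  e = (d + x) ^ suc s
  f = (d + x) ^ s
  aux₁ : ∀ d p a x f e → d * (p + a * x * f) + x * e ≡ d * p + (a * x * (d * f) + x * e)
  aux₁ = solve-∀
  aux₂ : ∀ p s x e → p + ((1 + s) * x * e + x * e) ≡ p + (2 + s) * x * e
  aux₂ = solve-∀

data Compare (d D : ℕ) : Set where
  below : ∀ x → D ≡ d + x → Compare d D
  above : ∀ x → d ≡ D + x → Compare d D

compare : ∀ d D → Compare d D
compare d D with ≤-total d D
... | inj₁ d≤D = below (D ∸ d) (≡.sym (m+[n∸m]≡n d≤D))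
... | inj₂ D≤d = above (d ∸ D) (≡.sym (m+[n∸m]≡n D≤d))

-- Only the difference of `miss` and `inn` moves the degree. If the degree drops, the drop is paid
-- at the rate `D ^ s`, which `c ^ s` lifts to `n ^ s`; if it rises, the rise costs at most
-- `suc s * n ^ s` per unit. The part of `miss` that cancels against `inn` is charged to `inn`.
vertex-bound : ∀ s {N n c d D miss inn} → 1 ≤ c → d ≤ n → n ≤ c * D →
  d + miss ≡ D + inn → N ≡ n ^ s →
  c ^ s * d ^ suc s + miss * N ≤ c ^ s * D ^ suc s + c ^ s * (suc s * inn * N)
vertex-bound s {N} {n} {c} {d} {D} {miss} {inn} 1≤c d≤n n≤cD bal refl with compare d D
... | below x refl = lincomb (+-mono-≤ (+-mono-≤ (*-monoʳ-≤ w (pow-below s d x)) (*-monoʳ-≤ x N≤))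
                       (*-monoˡ-≤ (inn * N) 1≤w)) (w * (s * inn * N))
                       (trans (cong (λ y → w * d ^ suc s + y * N +
                          (w * (d + x) ^ suc s + x * (w * (d + x) ^ s) + w * (inn * N)) + w * (s * inn * N)) miss≡)
                       (aux w (d ^ suc s) x inn N ((d + x) ^ suc s) ((d + x) ^ s) s))
  where
  w = c ^ s
  1≤w : 1 ≤ w
  1≤w = ≤-trans (≤-reflexive (≡.sym (^-zeroˡ s))) (^-monoˡ-≤ s 1≤c)
  N≤ : n ^ s ≤ w * (d + x) ^ s
  N≤ = ≤-trans (^-monoˡ-≤ s n≤cD) (≤-reflexive (^-distrib-* c (d + x) s))
  miss≡ : miss ≡ x + inn
  miss≡ = +-cancelˡ-≡ d _ _ (trans bal (+-assoc d x inn))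
  aux : ∀ w p x i N q f s →
    w * p + (x + i) * N + (w * q + x * (w * f) + w * (i * N)) + w * (s * i * N)
    ≡ w * q + w * ((1 + s) * i * N) + (w * (p + x * f) + x * N + 1 * (i * N))
  aux = solve-∀
... | above x refl = lincomb (+-mono-≤ (*-monoʳ-≤ w (≤-trans (pow-above s D x)
                         (+-monoʳ-≤ (D ^ suc s) (*-monoʳ-≤ (suc s * x) (^-monoˡ-≤ s d≤n)))))
                       (*-monoˡ-≤ (miss * N) 1≤w)) (w * (s * miss * N))
                       (trans (aux w ((D + x) ^ suc s) miss N (D ^ suc s) s x)
                       (cong (λ i → w * D ^ suc s + w * (suc s * i * N) + (w * (D + x) ^ suc s + 1 * (miss * N))) (≡.sym inn≡)))
  where
  w = c ^ s
  1≤w : 1 ≤ w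
  1≤w = ≤-trans (≤-reflexive (≡.sym (^-zeroˡ s))) (^-monoˡ-≤ s 1≤c)
  inn≡ : inn ≡ x + miss
  inn≡ = +-cancelˡ-≡ D _ _ (trans (≡.sym bal) (+-assoc D x miss))
  aux : ∀ w p m N q s x →
    w * p + m * N + (w * (q + (1 + s) * x * N) + w * (m * N)) + w * (s * m * N)
    ≡ w * q + w * ((1 + s) * (x + m) * N) + (w * p + 1 * (m * N))
  aux = solve-∀

-- One of the truncated differences vanishes, so a single inequality covers both signs and can be
-- summed over all vertices.
excess-bound : ∀ s {n} d D → d ≤ n →
  d ^ suc s + (D ∸ d) * D ^ s ≤ D ^ suc s + suc s * (d ∸ D) * n ^ s
excess-bound s {n} d D d≤n with compare d D
... | below x refl = ≤-trans (≤-reflexive (cong (λ y → d ^ suc s + y * (d + x) ^ s) (m+n∸m≡n d x)))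
                       (≤-trans (pow-below s d x) (m≤m+n _ _))
... | above x refl = ≤-trans (≤-reflexive (trans (cong (λ y → (D + x) ^ suc s + y * D ^ s) (m≤n⇒m∸n≡0 (m≤m+n D x)))
                         (+-identityʳ _)))
                       (≤-trans (pow-above s D x) (+-monoʳ-≤ (D ^ suc s)
                         (*-mono-≤ (≤-reflexive (cong (suc s *_) (≡.sym (m+n∸m≡n D x)))) (^-monoˡ-≤ s d≤n))))

-- Blow-ups of complete graphs from many cliques

cnt : ∀ j → (Vec (Fin n) j → Bool) → ℕ
cnt zero    R = 𝟙 (R [])
cnt (suc j) R = ∑ λ x → cnt j (λ xs → R (x ∷ xs))

cnt-mono : ∀ j {R S : Vec (Fin n) j → Bool} → (∀ x → R x ≡ true → S x ≡ true) → cnt j R ≤ cnt j S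
cnt-mono zero    h = 𝟙-mono (h [])
cnt-mono (suc j) h = ∑-mono λ x → cnt-mono j λ xs → h (x ∷ xs)

cnt-split : ∀ j (R S : Vec (Fin n) j → Bool) →
            cnt j R ≡ cnt j (λ x → R x ∧ S x) + cnt j (λ x → R x ∧ not (S x))
cnt-split zero    R S with R [] | S []
... | false | _     = refl
... | true  | true  = refl
... | true  | false = refl
cnt-split (suc j) R S = trans (∑-cong λ x → cnt-split j (R ∘ (x ∷_)) (S ∘ (x ∷_))) (∑-+ _ _)

cnt-true : ∀ j → cnt {n} j (λ _ → true) ≡ n ^ j
cnt-true zero        = refl
cnt-true {n} (suc j) = trans (∑-cong λ x → cnt-true j) (∑-const n (n ^ j))

cnt-false : ∀ j → cnt {n} j (λ _ → false) ≡ 0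
cnt-false zero    = refl
cnt-false (suc j) = trans (∑-cong λ x → cnt-false j) ∑-zero

cnt≤ : ∀ j (R : Vec (Fin n) j → Bool) → cnt j R ≤ n ^ j
cnt≤ j R = ≤-trans (cnt-mono j (λ _ _ → refl)) (≤-reflexive (cnt-true j))

1+m≤2^m : ∀ m → suc m ≤ 2 ^ m
1+m≤2^m zero    = ≤-refl
1+m≤2^m (suc m) = begin
  1 + suc m          ≤⟨ +-mono-≤ (m^n>0 2 m) (1+m≤2^m m) ⟩
  2 ^ m + 2 ^ m      ≡⟨ cong (2 ^ m +_) (+-identityʳ (2 ^ m)) ⟨
  2 ^ suc m          ∎
  where open ≤-Reasoning

-- If the sets P i ∩ Q cover Q at least t - 1 times on average with W to spare, then some t of the
-- P i have a large common intersection.  Splitting Q along P 0 keeps the surplus up to a factor 2.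
common-intersection : ∀ {L} j (P : Fin L → Vec (Fin n) j → Bool) t λ′ {W} (Q : Vec (Fin n) j → Bool) →
  1 ≤ W →
  W + λ′ * (t * cnt j Q) ≤ λ′ * (∑ (λ i → cnt j (λ x → Q x ∧ P i x)) + cnt j Q) →
  Σ (Fin t → Fin L) λ ι → Injective ι × Σ (Vec (Fin n) j → Bool) λ R →
    (∀ x → R x ≡ true → Q x ≡ true × (∀ a → P (ι a) x ≡ true)) × W ≤ λ′ * 2 ^ L * cnt j R
common-intersection {L = L} j P zero λ′ {W} Q _ h = (λ ()) , (λ ()) , Q , (λ x q → q , λ ()) , (begin
  W                    ≤⟨ m+n≤o⇒m≤o W h ⟩
  λ′ * (∑ (λ i → cnt j (λ x → Q x ∧ P i x)) + q)
    ≤⟨ *-monoʳ-≤ λ′ (+-monoˡ-≤ q (∑-bound q λ i → cnt-mono j λ x → proj₁ ∘ ∧-true)) ⟩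
  λ′ * (L * q + q)     ≡⟨ cong (λ′ *_) (+-comm (L * q) q) ⟩
  λ′ * (suc L * q)     ≤⟨ *-monoʳ-≤ λ′ (*-monoˡ-≤ q (1+m≤2^m L)) ⟩
  λ′ * (2 ^ L * q)     ≡⟨ *-assoc λ′ (2 ^ L) q ⟨
  λ′ * 2 ^ L * q       ∎)
  where
  open ≤-Reasoning
  q = cnt j Q
common-intersection {L = zero} j P (suc t) λ′ {W} Q 1≤W h = ⊥-elim (1+n≰n (≤-trans 1≤W
  (lincomb (≤-trans h (≤-reflexive (cong (λ z → λ′ * (z + cnt j Q)) (∑-empty _)))) (λ′ * (t * cnt j Q))
    (aux W λ′ (cnt j Q) t))))
  where
  aux : ∀ W l q t → W + l * q + l * (t * q) ≡ W + l * ((1 + t) * q)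
  aux = solve-∀
common-intersection {n = n} {L = suc L} j P (suc t) λ′ {W} Q 1≤W h = go
  where
  Q₁ Q₀ : Vec (Fin n) j → Bool
  Q₁ x = Q x ∧ P zero x
  Q₀ x = Q x ∧ not (P zero x)
  q₁ = cnt j Q₁
  q₀ = cnt j Q₀
  S₁ = ∑ λ i → cnt j (λ x → Q₁ x ∧ P (suc i) x)
  S₀ = ∑ λ i → cnt j (λ x → Q₀ x ∧ P (suc i) x)

  rest≡ : ∑ (λ i → cnt j (λ x → Q x ∧ P (suc i) x)) ≡ S₁ + S₀
  rest≡ = trans (∑-cong λ i → trans (cnt-split j _ (P zero)) (cong₂ _+_
      (cnt-cong λ x → swap-∧ (Q x) (P (suc i) x) (P zero x))
      (cnt-cong λ x → swap-∧ (Q x) (P (suc i) x) (not (P zero x))))) (∑-+ _ _)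
    where
    swap-∧ : ∀ a b c → (a ∧ b) ∧ c ≡ (a ∧ c) ∧ b
    swap-∧ a b c = trans (∧-assoc a b c) (trans (cong (a ∧_) (∧-comm b c)) (≡.sym (∧-assoc a c b)))
    cnt-cong : ∀ {R S : Vec (Fin n) j → Bool} → (∀ x → R x ≡ S x) → cnt j R ≡ cnt j S
    cnt-cong e = ≤-antisym (cnt-mono j λ x → trans (≡.sym (e x))) (cnt-mono j λ x → trans (e x))

  h′ : W + λ′ * (suc t * (q₁ + q₀)) ≤ λ′ * (q₁ + (S₁ + S₀) + (q₁ + q₀))
  h′ = subst₂ (λ q s → W + λ′ * (suc t * q) ≤ λ′ * (s + q)) (cnt-split j Q (P zero))
         (trans (∑-suc _) (cong (q₁ +_) rest≡)) h

  double : ∀ {x} → W ≤ 2 * λ′ * 2 ^ L * x → W ≤ λ′ * 2 ^ suc L * x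
  double {x} = subst (W ≤_) (aux λ′ (2 ^ L) x)
    where
    aux : ∀ l p x → 2 * l * p * x ≡ l * (2 * p) * x
    aux = solve-∀

  inside : W + 2 * λ′ * (t * q₁) ≤ 2 * λ′ * (S₁ + q₁) → _
  inside h₁ with common-intersection j (P ∘ suc) t (2 * λ′) Q₁ 1≤W h₁
  ... | ι , inj , R , R⊆ , bound = ι′ , inj′ , R ,
    (λ x r → proj₁ (∧-true (proj₁ (R⊆ x r))) , λ { zero → proj₂ (∧-true (proj₁ (R⊆ x r)))
                                                 ; (suc a) → proj₂ (R⊆ x r) a }) , double bound
    where
    ι′ : Fin (suc t) → Fin (suc L)
    ι′ zero    = zero
    ι′ (suc a) = suc (ι a)
    inj′ : Injective ι′
    inj′ zero    zero    _ = refl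
    inj′ (suc a) (suc b) e = cong suc (inj a b (Fin.suc-injective e))

  outside : W + 2 * λ′ * (suc t * q₀) ≤ 2 * λ′ * (S₀ + q₀) → _
  outside h₀ with common-intersection j (P ∘ suc) (suc t) (2 * λ′) Q₀ 1≤W h₀
  ... | ι , inj , R , R⊆ , bound = suc ∘ ι , (λ a b e → inj a b (Fin.suc-injective e)) , R ,
    (λ x r → proj₁ (∧-true (proj₁ (R⊆ x r))) , proj₂ (R⊆ x r)) , double bound

  go : Σ (Fin (suc t) → Fin (suc L)) λ ι → Injective ι × Σ (Vec (Fin n) j → Bool) λ R →
    (∀ x → R x ≡ true → Q x ≡ true × (∀ a → P (ι a) x ≡ true)) × W ≤ λ′ * 2 ^ suc L * cnt j R
  go with ≤-total (W + 2 * λ′ * (t * q₁)) (2 * λ′ * (S₁ + q₁))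
  ... | inj₁ h₁ = inside h₁
  -- The conditions inside and outside `P zero` add up to twice the hypothesis, so when the first
  -- fails the second holds.
  ... | inj₂ h₁ = outside (lincomb (+-mono-≤ h₁ (*-monoʳ-≤ 2 h′)) 0 (aux W λ′ t q₁ q₀ S₁ S₀))
    where
    aux : ∀ W l t q₁ q₀ S₁ S₀ →
      W + 2 * l * ((1 + t) * q₀) + (W + 2 * l * (t * q₁) + 2 * (l * (q₁ + (S₁ + S₀) + (q₁ + q₀)))) + 0
      ≡ 2 * l * (S₀ + q₀) + (2 * l * (S₁ + q₁) + 2 * (W + l * ((1 + t) * (q₁ + q₀))))
    aux = solve-∀

-- Reading a tuple from the left, each vertex shrinks the remaining candidate sets to its
-- neighbours. Hence the number of cliques unfolds by definition into a sum, over the first vertex,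
-- of clique counts in its link; all inductions on `j` rest on this.
isClique : Graph n → ∀ {j} → (Fin j → Fin n → Bool) → Vec (Fin n) j → Bool
isClique G W []       = true
isClique G W (x ∷ xs) = W zero x ∧ isClique G (λ l y → W (suc l) y ∧ adj G x y) xs

-- The family is nonempty so that the adjacency inside the tuple can be read off from one of its
-- members.
isClique-⋂ : ∀ (G : Graph n) {j t} {V : Fin (suc t) → Fin j → Fin n → Bool} {W} →
  (∀ l y → (∀ s → V s l y ≡ true) → W l y ≡ true) →
  ∀ xs → (∀ s → isClique G (V s) xs ≡ true) → isClique G W xs ≡ true
isClique-⋂ G V⊆W []       h = refl
isClique-⋂ G V⊆W (x ∷ xs) h = true-∧ (V⊆W zero x λ s → proj₁ (∧-true (h s)))
  (isClique-⋂ G (λ l y v → true-∧ (V⊆W (suc l) y λ s → proj₁ (∧-true (v s)))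
                             (proj₂ (∧-true (v zero))))
    xs (λ s → proj₂ (∧-true (h s))))

opaque
  allᵇ : (Fin k → Bool) → Bool
  allᵇ f = does (Fin.all? λ s → f s Bool.≟ true)

  allᵇ-intro : (f : Fin k → Bool) → (∀ s → f s ≡ true) → allᵇ f ≡ true
  allᵇ-intro f = dec-true (Fin.all? λ s → f s Bool.≟ true)

  allᵇ-elim : (f : Fin k → Bool) → allᵇ f ≡ true → ∀ s → f s ≡ true
  allᵇ-elim f = does-true (Fin.all? λ s → f s Bool.≟ true)

-- A complete j-partite subgraph with `t` vertices per part, part `l` inside `W l`. Different parts
-- are disjoint because joined vertices differ.
Blowup : ∀ {j} → Graph n → (Fin j → Fin n → Bool) → ℕ → Set
Blowup {n} {j} G W t = Σ (Fin j → Fin t → Fin n) λ g → (∀ l → Injective (g l)) ×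
  (∀ l s → W l (g l s) ≡ true) × (∀ l l′ → l ≢ l′ → ∀ s s′ → Adj G (g l s) (g l′ s′))

-- Erdős' theorem at clique density 1/a. The candidate sets `W` carry the induction on `j`, in which
-- the remaining parts are sought in a common neighbourhood.
CliquesForceBlowup : (j t a N : ℕ) → Set
CliquesForceBlowup j t a N = ∀ {n} → N ≤ n → (G : Graph n) (W : Fin j → Fin n → Bool) →
  n ^ j ≤ a * cnt j (isClique G W) → Blowup G W (suc t)

CommonLink : Graph n → ∀ {j L} → (Fin L → Fin n) → (Fin j → Fin n → Bool) → ℕ → Set
CommonLink G {L = L} v W t = Σ (Fin t → Fin L) λ ι → Injective ι ×
  Blowup G (λ l y → W l y ∧ allᵇ (λ s → adj G (v (ι s)) y)) t

extend-blowup : ∀ (G : Graph n) {j L t} (W : Fin (suc j) → Fin n → Bool) (v : Fin L → Fin n) →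
  Injective v → (∀ i → W zero (v i) ≡ true) → CommonLink G v (W ∘ suc) t → Blowup G W t
extend-blowup {n} G {j} {t = t} W v v-inj v∈W (ι , ι-inj , h , h-inj , h-sat , h-joined) =
  g , inj , sat , joined
  where
  g : Fin (suc j) → Fin t → Fin n
  g zero    = v ∘ ι
  g (suc l) = h l
  inj : ∀ l → Injective (g l)
  inj zero    s s′ e = ι-inj s s′ (v-inj _ _ e)
  inj (suc l) = h-inj l
  sat : ∀ l s → W l (g l s) ≡ true
  sat zero    s = v∈W (ι s)
  sat (suc l) s = proj₁ (∧-true (h-sat l s))
  linked : ∀ l s s′ → Adj G (v (ι s)) (h l s′)
  linked l s s′ = allᵇ-elim _ (∧-right (W (suc l) (h l s′)) (h-sat l s′)) s
  joined : ∀ l l′ → l ≢ l′ → ∀ s s′ → Adj G (g l s) (g l′ s′)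
  joined zero    zero     l≢ = contradiction refl l≢
  joined zero    (suc l′) l≢ s s′ = linked l′ s s′
  joined (suc l) zero     l≢ s s′ = trans (sym G _ _) (linked l s′ s)
  joined (suc l) (suc l′) l≢ = h-joined l l′ (l≢ ∘ cong suc)

RichLinksMeet : (j t a L N : ℕ) → Set
RichLinksMeet j t a L N = ∀ {n} → N ≤ n →
  (G : Graph n) (W : Fin j → Fin n → Bool) (v : Fin L → Fin n) →
  (∀ i → n ^ j ≤ a * cnt j (isClique G (λ l y → W l y ∧ adj G (v i) y))) → CommonLink G v W (suc t)

-- By `common-intersection`, `t + 1` of the links share cliques of density at least 2^-L. These live
-- in the common neighbourhood, where the hypothesis on `j` finds a blow-up.
common-link : ∀ j → (∀ t a → ∃ (CliquesForceBlowup j t a)) →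
  ∀ t a → Σ ℕ λ L → Σ ℕ λ N → RichLinksMeet j t a L N
common-link j blowup t a = L , suc N , λ {n} N<n G W v rich →
  let P : Fin L → Vec (Fin n) j → Bool
      P i = isClique G (λ l y → W l y ∧ adj G (v i) y)
      T   = suc t
      instance n≢0 : NonZero n
               n≢0 = >-nonZero (≤-trans (s≤s z≤n) N<n)
      covered : T * n ^ j ≤ ∑ (λ i → cnt j (P i))
      covered = *-cancelˡ-≤ (suc a) (begin
        suc a * (T * n ^ j)                 ≡⟨ *-assoc (suc a) T (n ^ j) ⟨
        L * n ^ j                           ≡⟨ ∑-const L (n ^ j) ⟨
        ∑ {L} (λ _ → n ^ j)                 ≤⟨ ∑-mono (λ i → ≤-trans (rich i) (*-monoˡ-≤ _ (n≤1+n a))) ⟩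
        ∑ (λ i → suc a * cnt j (P i))       ≡⟨ ∑-*ˡ (suc a) _ ⟩
        suc a * ∑ (λ i → cnt j (P i))       ∎)
      surplus : n ^ j + 1 * (T * cnt j (λ _ → true)) ≤
                1 * (∑ (λ i → cnt j (P i)) + cnt j (λ _ → true))
      surplus = subst (λ q → n ^ j + 1 * (T * q) ≤ 1 * (∑ (λ i → cnt j (P i)) + q))
                  (≡.sym (cnt-true j)) (lincomb covered 0 (aux (n ^ j) T (∑ λ i → cnt j (P i))))
      (ι , inj , R , R⊆ , bound) = common-intersection j P T 1 (λ _ → true) (m^n>0 n j) surplus
      Wι : Fin j → Fin n → Bool
      Wι l y = W l y ∧ allᵇ (λ s → adj G (v (ι s)) y)
      in ι , inj , proj₂ (blowup t (1 * 2 ^ L)) (≤-trans (n≤1+n N) N<n) G Wι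
           (≤-trans bound (*-monoʳ-≤ (1 * 2 ^ L) (cnt-mono j λ x r →
             isClique-⋂ G (λ l y h → true-∧ (proj₁ (∧-true (h zero)))
                (allᵇ-intro _ λ s → ∧-right (W l y) (h s))) x (proj₂ (R⊆ x r)))))
  where
  open ≤-Reasoning
  -- So many links of density at least 1/(a + 1) cover the tuples `t + 1` times on average;
  -- `common-intersection` asks for `t`, which leaves the surplus `n ^ j`.
  L = suc a * suc t
  N = proj₁ (blowup t (1 * 2 ^ L))
  aux : ∀ p T S → p + 1 * (T * p) + S + 0 ≡ 1 * (S + p) + T * p
  aux = solve-∀

-- Averaging yields linearly many first vertices with rich links. Any `L` of them contain the first
-- part, and the other `j` parts lie in the link that its vertices share.
cliques-force-blowup : ∀ j t a → ∃ (CliquesForceBlowup j t a)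
cliques-force-blowup zero    t a = 0 , λ _ G W _ → (λ ()) , (λ ()) , (λ ()) , λ ()
cliques-force-blowup (suc j) t a with common-link j (cliques-force-blowup j) t (2 * suc a)
... | L , N , link = suc (N + 2 * suc a * L) , blowup
  where
  -- First vertices with link density below 1/b account for less than half of the cliques.
  b = 2 * suc a
  blowup : ∀ {n} → suc (N + b * L) ≤ n → (G : Graph n) (W : Fin (suc j) → Fin n → Bool) →
    n ^ suc j ≤ a * cnt (suc j) (isClique G W) → Blowup G W (suc t)
  blowup {n} N<n G W h = extend-blowup G W v (proj₁ (proj₂ xs))
      (λ i → proj₁ (∧-true (proj₂ (proj₂ xs) i))) common
    where
    open ≤-Reasoning
    instance
      n≢0 : NonZero n
      n≢0 = >-nonZero (≤-trans (s≤s z≤n) N<n)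
      n^j≢0 : NonZero (n ^ j)
      n^j≢0 = >-nonZero (m^n>0 n j)
    W′ : Fin n → Fin j → Fin n → Bool
    W′ x l y = W (suc l) y ∧ adj G x y
    linkCount : Fin n → ℕ
    linkCount x = cnt j (isClique G (W′ x))
    X : Fin n → Bool
    X x = W zero x ∧ does (n ^ j ≤? b * linkCount x)
    term : ∀ x → b * cnt j (λ xs → W zero x ∧ isClique G (W′ x) xs) ≤ b * n ^ j * 𝟙 (X x) + n ^ j
    term x with W zero x
    ... | false = ≤-trans (≤-reflexive (trans (cong (b *_) (cnt-false j)) (*-zeroʳ b))) z≤n
    ... | true  = aux (n ^ j ≤? b * linkCount x)
      where
      aux : (d : Dec (n ^ j ≤ b * linkCount x)) → b * linkCount x ≤ b * n ^ j * 𝟙 (does d) + n ^ j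
      aux (yes _) = ≤-trans (*-monoʳ-≤ b (cnt≤ j _))
                      (≤-trans (≤-reflexive (≡.sym (*-identityʳ (b * n ^ j)))) (m≤m+n _ _))
      aux (no ¬p) = ≤-trans (<⇒≤ (≰⇒> ¬p)) (m≤n+m _ _)
    total : b * cnt (suc j) (isClique G W) ≤ b * n ^ j * count X + n * n ^ j
    total = begin
      b * cnt (suc j) (isClique G W)   ≡⟨ ∑-*ˡ b _ ⟨
      _                                ≤⟨ ∑-mono term ⟩
      _                                ≡⟨ ∑-+ _ _ ⟩
      ∑ (λ x → b * n ^ j * 𝟙 (X x)) + ∑ {n} (λ _ → n ^ j)
        ≡⟨ cong₂ _+_ (∑-*ˡ (b * n ^ j) _) (∑-const n (n ^ j)) ⟩
      b * n ^ j * count X + n * n ^ j  ∎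
    n≤ : n ≤ b * count X
    n≤ = *-cancelʳ-≤ n (b * count X) (n ^ j) (lincomb (+-mono-≤ (*-monoʳ-≤ 2 h) total)
      (2 * cnt (suc j) (isClique G W)) (aux (n ^ suc j) a (cnt (suc j) (isClique G W)) b (n ^ j) (count X)))
      where
      aux : ∀ p a c b q x → p + (2 * (a * c) + (b * q * x + p)) + 2 * c
            ≡ b * x * q + (2 * p + 2 * (1 + a) * c)
      aux = solve-∀
    L≤ : L ≤ count X
    L≤ = *-cancelˡ-≤ b (≤-trans (≤-trans (m≤n+m (b * L) (suc N)) N<n) n≤)
    xs = enumerate X L≤
    v  = proj₁ xs
    common = link (≤-trans (≤-trans (m≤m+n N (b * L)) (n≤1+n _)) N<n) G (W ∘ suc) v
      (λ i → does-true (n ^ j ≤? b * linkCount (v i)) (proj₂ (∧-true (proj₂ (proj₂ xs) i))))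

-- Degree majorisation

argmax : ∀ (P : Fin n → Bool) (g : Fin n → ℕ) {x} → P x ≡ true →
         ∃ λ y → P y ≡ true × (∀ z → P z ≡ true → g z ≤ g y)
argmax {n} P g {x} Px = climb (suc (∑ g)) x Px (m≤n⇒m≤n+o (g x) (n≤1+n (∑ g)))
  where
  climb : ∀ fuel x → P x ≡ true → ∑ g ≤ fuel + g x →
          ∃ λ y → P y ≡ true × (∀ z → P z ≡ true → g z ≤ g y)
  climb fuel x Px bound with any? (λ z → (P z Bool.≟ true) ×-dec (g x <? g z))
  ... | no none = x , Px , λ z Pz → ≮⇒≥ λ lt → none (z , Pz , lt)
  climb zero x Px bound | yes (z , _ , lt) =
    ⊥-elim (<-irrefl refl (<-≤-trans lt (≤-trans (term≤∑ g z) bound)))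
  climb (suc fuel) x Px bound | yes (z , Pz , lt) = climb fuel z Pz
    (≤-trans bound (≤-trans (≤-reflexive (≡.sym (+-suc fuel (g x)))) (+-monoʳ-≤ fuel lt)))

∑-on : (Fin n → Bool) → (Fin n → ℕ) → ℕ
∑-on A f = ∑ λ v → 𝟙 (A v) * f v

∑-on-mono : ∀ (A : Fin n → Bool) {f g : Fin n → ℕ} →
            (∀ v → A v ≡ true → f v ≤ g v) → ∑-on A f ≤ ∑-on A g
∑-on-mono A h = ∑-mono λ v → aux (A v) (h v)
  where
  aux : ∀ b {x y} → (b ≡ true → x ≤ y) → 𝟙 b * x ≤ 𝟙 b * y
  aux true  h = +-monoˡ-≤ 0 (h refl)
  aux false h = z≤n

∑-on-+ : ∀ (A : Fin n → Bool) (f g : Fin n → ℕ) →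
         ∑-on A (λ v → f v + g v) ≡ ∑-on A f + ∑-on A g
∑-on-+ A f g = trans (∑-cong λ v → *-distribˡ-+ (𝟙 (A v)) (f v) (g v)) (∑-+ _ _)

∑-on-const : ∀ (A : Fin n → Bool) c → ∑-on A (λ _ → c) ≡ count A * c
∑-on-const A c = ∑-*ʳ c (𝟙 ∘ A)

∑-on-split : ∀ (A B : Fin n → Bool) (f : Fin n → ℕ) →
  ∑-on A f ≡ ∑-on (λ v → A v ∧ B v) f + ∑-on (λ v → A v ∧ not (B v)) f
∑-on-split A B f = trans (∑-cong λ v → aux (A v) (B v) (f v)) (∑-+ _ _)
  where
  aux : ∀ a b x → 𝟙 a * x ≡ 𝟙 (a ∧ b) * x + 𝟙 (a ∧ not b) * x
  aux false b     x = refl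
  aux true  true  x = ≡.sym (+-identityʳ _)
  aux true  false x = refl

count-on-split : ∀ (A B Q : Fin n → Bool) → count (λ v → A v ∧ Q v) ≡
  count (λ v → (A v ∧ B v) ∧ Q v) + count (λ v → (A v ∧ not (B v)) ∧ Q v)
count-on-split A B Q = trans (∑-cong λ v → aux (A v) (B v) (Q v)) (∑-+ _ _)
  where
  aux : ∀ a b c → 𝟙 (a ∧ c) ≡ 𝟙 ((a ∧ b) ∧ c) + 𝟙 ((a ∧ not b) ∧ c)
  aux false b     c = refl
  aux true  true  c = ≡.sym (+-identityʳ _)
  aux true  false c = refl

degreeWithin : Graph n → (Fin n → Bool) → Fin n → ℕ
degreeWithin G A v = count λ u → A u ∧ adj G v u

module Majorisation {n} (G : Graph n) (a : ℕ) (1≤a : 1 ≤ a) where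

  degIn : (Fin n → Bool) → Fin n → ℕ
  degIn = degreeWithin G

  crossIn innerIn : ∀ {j} → (Fin n → Bool) → (Fin n → Fin j) → Fin n → ℕ
  crossIn A c v = count λ u → A u ∧ not (does (c u ≟ c v))
  innerIn A c v = count λ u → A u ∧ (adj G v u ∧ does (c u ≟ c v))

  -- The threshold a^-j leaves one factor `a` for each level of the recursion: with `n / a` vertices
  -- whose neighbourhoods are rich, the set itself is rich one level higher.
  Rich : ℕ → (Fin n → Bool) → Set
  Rich j A = n ^ j ≤ a ^ j * cnt j (isClique G (λ (_ : Fin j) → A))

  -- The first bound is Erdős' degree majorisation, the second one Füredi's stability inequality,
  -- both with an error of order n² / a.
  Majorised : ℕ → (Fin n → Bool) → Set
  Majorised j A = Σ (Fin n → Fin j) λ c →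
    a * ∑-on A (λ v → degIn A v ∸ crossIn A c v) ≤ j * (n * n) ×
    a * (∑-on A (degIn A) + ∑-on A (innerIn A c)) ≤ a * ∑-on A (crossIn A c) + 2 * j * (n * n)

  innerIn≤degIn : ∀ {j} A (c : Fin n → Fin j) v → innerIn A c v ≤ degIn A v
  innerIn≤degIn A c v = count-mono λ u h →
    true-∧ {A u} {adj G v u} (proj₁ (∧-true h)) (proj₁ (∧-true (∧-right (A u) h)))

  degIn-symmetric : ∀ A B → ∑-on A (degIn B) ≡ ∑-on B (degIn A)
  degIn-symmetric A B = begin
    (∑ λ v → 𝟙 (A v) * degIn B v)                  ≡⟨ ∑-cong (λ v → ∑-*ˡ (𝟙 (A v)) _) ⟨
    (∑ λ v → ∑ λ u → 𝟙 (A v) * 𝟙 (B u ∧ adj G v u)) ≡⟨ ∑-swap _ ⟩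
    (∑ λ u → ∑ λ v → 𝟙 (A v) * 𝟙 (B u ∧ adj G v u)) ≡⟨ ∑-cong (λ u → ∑-cong λ v → exchange u v) ⟩
    (∑ λ u → ∑ λ v → 𝟙 (B u) * 𝟙 (A v ∧ adj G u v)) ≡⟨ ∑-cong (λ u → ∑-*ˡ (𝟙 (B u)) _) ⟩
    (∑ λ u → 𝟙 (B u) * degIn A u)                  ∎
    where
    open ≡.≡-Reasoning
    aux : ∀ x y z → x * (y * z) ≡ y * (x * z)
    aux = solve-∀
    exchange : ∀ u v → 𝟙 (A v) * 𝟙 (B u ∧ adj G v u) ≡ 𝟙 (B u) * 𝟙 (A v ∧ adj G u v)
    exchange u v = begin
      𝟙 (A v) * 𝟙 (B u ∧ adj G v u)       ≡⟨ cong (𝟙 (A v) *_) (𝟙-∧ (B u) (adj G v u)) ⟩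
      𝟙 (A v) * (𝟙 (B u) * 𝟙 (adj G v u)) ≡⟨ aux (𝟙 (A v)) (𝟙 (B u)) (𝟙 (adj G v u)) ⟩
      𝟙 (B u) * (𝟙 (A v) * 𝟙 (adj G v u)) ≡⟨ cong (λ b → 𝟙 (B u) * (𝟙 (A v) * 𝟙 b)) (sym G v u) ⟩
      𝟙 (B u) * (𝟙 (A v) * 𝟙 (adj G u v)) ≡⟨ cong (𝟙 (B u) *_) (𝟙-∧ (A v) (adj G u v)) ⟨
      𝟙 (B u) * 𝟙 (A v ∧ adj G u v)       ∎

  -- With so few edges a single colour will do, as all degrees together stay within the error.
  sparse-majorised : ∀ j A → a * ∑-on A (degIn A) ≤ n * n → Majorised (suc j) A
  sparse-majorised j A h = c₀ ,
    ≤-trans (*-monoʳ-≤ a (∑-on-mono A λ v _ → m∸n≤m (degIn A v) (crossIn A c₀ v)))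
      (≤-trans h (m≤m+n (n * n) (j * (n * n)))) ,
    lincomb (+-mono-≤ h (≤-trans (*-monoʳ-≤ a (∑-on-mono A λ v _ → innerIn≤degIn A c₀ v)) h))
      (a * TD + 2 * j * (n * n))
      (aux a SD IN (n * n) TD j)
    where
    c₀ : Fin n → Fin (suc j)
    c₀ _ = zero
    SD = ∑-on A (degIn A)
    IN = ∑-on A (innerIn A c₀)
    TD = ∑-on A (crossIn A c₀)
    aux : ∀ a S I q T j → a * (S + I) + (q + q) + (a * T + 2 * j * q)
          ≡ a * T + 2 * (1 + j) * q + (a * S + a * I)
    aux = solve-∀

  -- The induction step of Erdős and Füredi: `x` has maximum degree, its neighbourhood `A₂` is
  -- already partitioned by `c₂`, and its non-neighbours `V₁` form the new class. Vertices in `R`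
  -- are exempt from maximality and cost at most `n` each.
  module Step {j} (A : Fin n → Bool) (x : Fin n) (c₂ : Fin n → Fin (suc j)) (R : Fin n → Bool)
              (maximal : ∀ v → A v ≡ true → R v ≡ false → degIn A v ≤ degIn A x) where

    A₂ V₁ : Fin n → Bool
    A₂ v = A v ∧ adj G x v
    V₁ v = A v ∧ not (adj G x v)

    c : Fin n → Fin (suc (suc j))
    c v = if adj G x v then suc (c₂ v) else zero

    cross₁ : ∀ v → V₁ v ≡ true → crossIn A c v ≡ count A₂
    cross₁ v v∈ = count-cong λ u → trans (cong (λ b → A u ∧ not (does (c u ≟ (if b then suc (c₂ v) else zero))))
        (not-true (∧-right (A v) v∈))) (cong (A u ∧_) (aux (adj G x u) (c₂ u)))
      where
      aux : ∀ b (s : Fin (suc j)) → not (does ((if b then suc s else zero) ≟ zero)) ≡ b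
      aux true  s = refl
      aux false s = refl

    cross₂ : ∀ v → A₂ v ≡ true → crossIn A c v ≡ crossIn A₂ c₂ v + count V₁
    cross₂ v v∈ = trans (count-on-split A (adj G x) _)
      (cong₂ _+_ (count-cong λ u → trans (colour-v u _) (aux₂ (A u) (adj G x u) (c₂ u) (c₂ v)))
                 (count-cong λ u → trans (colour-v u _) (aux₁ (A u) (adj G x u) (c₂ u) (c₂ v))))
      where
      colour-v : ∀ u b → b ∧ not (does (c u ≟ c v)) ≡ b ∧ not (does (c u ≟ suc (c₂ v)))
      colour-v u b = cong (λ z → b ∧ not (does (c u ≟ (if z then suc (c₂ v) else zero)))) (∧-right (A v) v∈)
      aux₂ : ∀ a b (s t : Fin (suc j)) →
        (a ∧ b) ∧ not (does ((if b then suc s else zero) ≟ suc t)) ≡ (a ∧ b) ∧ not (does (s ≟ t))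
      aux₂ false b     s t = refl
      aux₂ true  false s t = refl
      aux₂ true  true  s t = refl
      aux₁ : ∀ a b (s t : Fin (suc j)) →
        (a ∧ not b) ∧ not (does ((if b then suc s else zero) ≟ suc t)) ≡ a ∧ not b
      aux₁ false b     s t = refl
      aux₁ true  false s t = refl
      aux₁ true  true  s t = refl

    inner₁ : ∀ v → V₁ v ≡ true → innerIn A c v ≡ degIn V₁ v
    inner₁ v v∈ = count-cong λ u →
      trans (cong (λ b → A u ∧ (adj G v u ∧ does (c u ≟ (if b then suc (c₂ v) else zero))))
              (not-true (∧-right (A v) v∈)))
            (aux (A u) (adj G x u) (adj G v u) (c₂ u))
      where
      aux : ∀ a b e (s : Fin (suc j)) →
        a ∧ (e ∧ does ((if b then suc s else zero) ≟ zero)) ≡ (a ∧ not b) ∧ e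
      aux false b     e     s = refl
      aux true  true  true  s = refl
      aux true  true  false s = refl
      aux true  false true  s = refl
      aux true  false false s = refl

    inner₂ : ∀ v → A₂ v ≡ true → innerIn A c v ≡ innerIn A₂ c₂ v
    inner₂ v v∈ = count-cong λ u →
      trans (cong (λ b → A u ∧ (adj G v u ∧ does (c u ≟ (if b then suc (c₂ v) else zero))))
              (∧-right (A v) v∈))
            (aux (A u) (adj G x u) (adj G v u) (c₂ u) (c₂ v))
      where
      aux : ∀ a b e (s t : Fin (suc j)) →
        a ∧ (e ∧ does ((if b then suc s else zero) ≟ suc t)) ≡ (a ∧ b) ∧ (e ∧ does (s ≟ t))
      aux false b     e     s t = refl
      aux true  true  e     s t = refl
      aux true  false true  s t = refl
      aux true  false false s t = refl

    degIn≤ : ∀ v → A v ≡ true → degIn A v ≤ count A₂ + n * 𝟙 (R v)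
    degIn≤ v v∈ with R v in Rv
    ... | false = ≤-trans (maximal v v∈ Rv) (m≤m+n _ _)
    ... | true  = ≤-trans (count≤n _) (≤-trans (≤-reflexive (≡.sym (*-identityʳ n))) (m≤n+m _ _))

    -- For a vertex of `A₂`, adding `V₁` raises the crossing degree by exactly `count V₁` and the
    -- degree by at most as much. A vertex of `V₁` has crossing degree `count A₂`, which is the
    -- degree of `x`; only vertices in `R` can exceed it.
    excess-step : ∑-on A (λ v → degIn A v ∸ crossIn A c v) ≤
                  ∑-on A₂ (λ v → degIn A₂ v ∸ crossIn A₂ c₂ v) + n * count R
    excess-step = begin
      ∑-on A excess
        ≡⟨ ∑-on-split A (adj G x) excess ⟩
      ∑-on A₂ excess + ∑-on V₁ excess
        ≤⟨ +-mono-≤ (∑-on-mono A₂ in-A₂) (≤-trans (∑-on-mono V₁ in-V₁) (∑-mono λ v → dropped (V₁ v) _)) ⟩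
      ∑-on A₂ (λ v → degIn A₂ v ∸ crossIn A₂ c₂ v) + ∑ (λ v → n * 𝟙 (R v))
        ≡⟨ cong (∑-on A₂ (λ v → degIn A₂ v ∸ crossIn A₂ c₂ v) +_) (∑-*ˡ n _) ⟩
      ∑-on A₂ (λ v → degIn A₂ v ∸ crossIn A₂ c₂ v) + n * count R ∎
      where
      open ≤-Reasoning
      excess : Fin n → ℕ
      excess v = degIn A v ∸ crossIn A c v
      in-A₂ : ∀ v → A₂ v ≡ true → excess v ≤ degIn A₂ v ∸ crossIn A₂ c₂ v
      in-A₂ v v∈ = begin
        degIn A v ∸ crossIn A c v
          ≡⟨ cong₂ _∸_ (count-on-split A (adj G x) _) (cross₂ v v∈) ⟩
        (degIn A₂ v + degIn V₁ v) ∸ (crossIn A₂ c₂ v + count V₁)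
          ≤⟨ ∸-monoˡ-≤ (crossIn A₂ c₂ v + count V₁)
               (+-monoʳ-≤ (degIn A₂ v) (count-mono λ u → proj₁ ∘ ∧-true)) ⟩
        (degIn A₂ v + count V₁) ∸ (crossIn A₂ c₂ v + count V₁)
          ≡⟨ cong₂ _∸_ (+-comm (degIn A₂ v) _) (+-comm (crossIn A₂ c₂ v) _) ⟩
        (count V₁ + degIn A₂ v) ∸ (count V₁ + crossIn A₂ c₂ v)
          ≡⟨ [m+n]∸[m+o]≡n∸o (count V₁) (degIn A₂ v) (crossIn A₂ c₂ v) ⟩
        degIn A₂ v ∸ crossIn A₂ c₂ v ∎
      in-V₁ : ∀ v → V₁ v ≡ true → excess v ≤ n * 𝟙 (R v)
      in-V₁ v v∈ = begin
        degIn A v ∸ crossIn A c v               ≡⟨ cong (degIn A v ∸_) (cross₁ v v∈) ⟩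
        degIn A v ∸ count A₂                    ≤⟨ ∸-monoˡ-≤ (count A₂) (degIn≤ v (proj₁ (∧-true v∈))) ⟩
        (count A₂ + n * 𝟙 (R v)) ∸ count A₂     ≡⟨ m+n∸m≡n (count A₂) _ ⟩
        n * 𝟙 (R v)                             ∎
      dropped : ∀ b y → 𝟙 b * y ≤ y
      dropped true  y = ≤-reflexive (+-identityʳ y)
      dropped false y = z≤n

    -- Füredi's observation: twice the degree sum over `V₁` counts every edge inside `V₁` four
    -- times. The degree sum of `A` accounts for two of these, the inner degrees for the other two.
    sum-degrees : ∑-on A (degIn A) + ∑-on A (innerIn A c) ≡
      2 * ∑-on V₁ (degIn A) + (∑-on A₂ (degIn A₂) + ∑-on A₂ (innerIn A₂ c₂))
    sum-degrees = begin
      ∑-on A (degIn A) + ∑-on A (innerIn A c)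
        ≡⟨ cong₂ _+_ (trans (∑-on-split A (adj G x) _) (cong (_+ X) splitA₂))
             (trans (∑-on-split A (adj G x) _) (cong₂ _+_ (∑-on-cong inner₂) (∑-on-cong inner₁))) ⟩
      (S₂ + ∑-on A₂ (degIn V₁) + X) + (I₂ + ∑-on V₁ (degIn V₁))
        ≡⟨ aux S₂ (∑-on A₂ (degIn V₁)) X I₂ (∑-on V₁ (degIn V₁)) ⟩
      X + (∑-on A₂ (degIn V₁) + ∑-on V₁ (degIn V₁)) + (S₂ + I₂)
        ≡⟨ cong (λ z → X + z + (S₂ + I₂)) (trans (cong (_+ ∑-on V₁ (degIn V₁)) (degIn-symmetric A₂ V₁))
             (≡.sym splitV₁)) ⟩
      X + X + (S₂ + I₂)
        ≡⟨ cong (λ z → X + z + (S₂ + I₂)) (+-identityʳ X) ⟨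
      2 * X + (S₂ + I₂) ∎
      where
      open ≡.≡-Reasoning
      X  = ∑-on V₁ (degIn A)
      S₂ = ∑-on A₂ (degIn A₂)
      I₂ = ∑-on A₂ (innerIn A₂ c₂)
      ∑-on-cong : ∀ {B : Fin n → Bool} {f g : Fin n → ℕ} →
                  (∀ v → B v ≡ true → f v ≡ g v) → ∑-on B f ≡ ∑-on B g
      ∑-on-cong {B} h = ≤-antisym (∑-on-mono B λ v b → ≤-reflexive (h v b))
                              (∑-on-mono B λ v b → ≤-reflexive (≡.sym (h v b)))
      splitB : ∀ B → ∑-on B (degIn A) ≡ ∑-on B (degIn A₂) + ∑-on B (degIn V₁)
      splitB B = trans (∑-cong λ v → cong (𝟙 (B v) *_) (count-on-split A (adj G x) (adj G v)))
                       (∑-on-+ B (degIn A₂) (degIn V₁))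
      splitA₂ = splitB A₂
      splitV₁ = splitB V₁
      aux : ∀ s e x i f → (s + e + x) + (i + f) ≡ x + (e + f) + (s + i)
      aux = solve-∀

    sum-crossing : 2 * (count V₁ * count A₂) + ∑-on A₂ (crossIn A₂ c₂) ≤ ∑-on A (crossIn A c)
    sum-crossing = begin
      2 * (count V₁ * count A₂) + T₂
        ≡⟨ aux (count V₁) (count A₂) T₂ ⟩
      T₂ + count A₂ * count V₁ + count V₁ * count A₂
        ≡⟨ cong₂ (λ p q → T₂ + p + q) (∑-on-const A₂ _) (∑-on-const V₁ _) ⟨
      T₂ + ∑-on A₂ (λ _ → count V₁) + ∑-on V₁ (λ _ → count A₂)
        ≡⟨ cong (_+ ∑-on V₁ (λ _ → count A₂)) (∑-on-+ A₂ _ _) ⟨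
      ∑-on A₂ (λ v → crossIn A₂ c₂ v + count V₁) + ∑-on V₁ (λ _ → count A₂)
        ≤⟨ +-mono-≤ (∑-on-mono A₂ λ v v∈ → ≤-reflexive (≡.sym (cross₂ v v∈)))
                    (∑-on-mono V₁ λ v v∈ → ≤-reflexive (≡.sym (cross₁ v v∈))) ⟩
      ∑-on A₂ (crossIn A c) + ∑-on V₁ (crossIn A c)
        ≡⟨ ∑-on-split A (adj G x) _ ⟨
      ∑-on A (crossIn A c) ∎
      where
      open ≤-Reasoning
      T₂ = ∑-on A₂ (crossIn A₂ c₂)
      aux : ∀ s t T → 2 * (s * t) + T ≡ T + t * s + s * t
      aux = solve-∀

    sum-V₁ : ∑-on V₁ (degIn A) ≤ count V₁ * count A₂ + n * count R
    sum-V₁ = begin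
      ∑-on V₁ (degIn A)
        ≤⟨ ∑-on-mono V₁ (λ v v∈ → degIn≤ v (proj₁ (∧-true v∈))) ⟩
      ∑-on V₁ (λ v → count A₂ + n * 𝟙 (R v))
        ≡⟨ ∑-on-+ V₁ _ _ ⟩
      ∑-on V₁ (λ _ → count A₂) + ∑-on V₁ (λ v → n * 𝟙 (R v))
        ≤⟨ +-mono-≤ (≤-reflexive (∑-on-const V₁ _)) (∑-mono λ v → dropped (V₁ v) _) ⟩
      count V₁ * count A₂ + ∑ (λ v → n * 𝟙 (R v))
        ≡⟨ cong (count V₁ * count A₂ +_) (∑-*ˡ n _) ⟩
      count V₁ * count A₂ + n * count R ∎
      where
      open ≤-Reasoning
      dropped : ∀ b y → 𝟙 b * y ≤ y
      dropped true  y = ≤-reflexive (+-identityʳ y)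
      dropped false y = z≤n

  -- `R` consists of the vertices with rich neighbourhood. If it has `n / a` elements, `A` is rich.
  -- Otherwise a vertex of maximum degree outside `R` has a majorised neighbourhood by induction,
  -- and `R` adds only `n * n / a` to the error.
  rich-or-majorised : ∀ j A → Rich (suc (suc j)) A ⊎ Majorised (suc j) A
  rich-or-majorised zero A with n * (n * 1) ≤? a * (a * 1) * cnt 2 (isClique G (λ (_ : Fin 2) → A))
  ... | yes rich = inj₁ rich
  ... | no poor = inj₂ (sparse-majorised 0 A (begin
      a * SD                ≡⟨ cong (_* SD) (*-identityʳ a) ⟨
      a * 1 * SD            ≤⟨ *-monoˡ-≤ SD (*-monoʳ-≤ a (≤-trans 1≤a (≤-reflexive (≡.sym (*-identityʳ a))))) ⟩
      a * (a * 1) * SD      ≡⟨ cong (a * (a * 1) *_) SD≡ ⟩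
      a * (a * 1) * cnt 2 (isClique G (λ (_ : Fin 2) → A)) ≤⟨ <⇒≤ (≰⇒> poor) ⟩
      n * (n * 1)           ≡⟨ cong (n *_) (*-identityʳ n) ⟩
      n * n                 ∎))
    where
    open ≤-Reasoning
    SD = ∑-on A (degIn A)
    SD≡ : SD ≡ cnt 2 (isClique G (λ (_ : Fin 2) → A))
    SD≡ = ∑-cong λ v → trans (≡.sym (∑-*ˡ (𝟙 (A v)) _)) (∑-cong λ u → trans (≡.sym (𝟙-∧ (A v) _))
            (cong (λ b → 𝟙 (A v ∧ b)) (≡.sym (∧-identityʳ _))))
  rich-or-majorised (suc j) A = result
    where
    open ≤-Reasoning
    J = suc (suc j)
    A∩N : Fin n → Fin n → Bool
    A∩N x v = A v ∧ adj G x v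
    sub : ∀ x → Rich J (A∩N x) ⊎ Majorised (suc j) (A∩N x)
    sub x = rich-or-majorised j (A∩N x)
    isRich : ∀ {x} → Rich J (A∩N x) ⊎ Majorised (suc j) (A∩N x) → Bool
    isRich (inj₁ _) = true
    isRich (inj₂ _) = false
    R : Fin n → Bool
    R x = A x ∧ isRich (sub x)
    C = cnt (suc J) (isClique G (λ (_ : Fin (suc J)) → A))
    term : ∀ x → 𝟙 (R x) * n ^ J ≤ a ^ J * cnt J (λ xs → A x ∧ isClique G (λ (_ : Fin J) → A∩N x) xs)
    term x with A x | sub x
    ... | false | _         = z≤n
    ... | true  | inj₁ rich = ≤-trans (≤-reflexive (+-identityʳ (n ^ J))) rich
    ... | true  | inj₂ _    = z≤n
    count-R : count R * n ^ J ≤ a ^ J * C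
    count-R = ≤-trans (≤-reflexive (≡.sym (∑-*ʳ (n ^ J) _))) (≤-trans (∑-mono term) (≤-reflexive (∑-*ˡ (a ^ J) _)))
    many : n ≤ a * count R → Rich (suc J) A
    many h = begin
      n * n ^ J            ≤⟨ *-monoˡ-≤ (n ^ J) h ⟩
      a * count R * n ^ J  ≡⟨ *-assoc a (count R) (n ^ J) ⟩
      a * (count R * n ^ J) ≤⟨ *-monoʳ-≤ a count-R ⟩
      a * (a ^ J * C)      ≡⟨ *-assoc a (a ^ J) C ⟨
      a * a ^ J * C        ∎
    -- Here no vertex of `A` is left outside `R`, so `A` is small itself.
    few-poor : a * count R ≤ n → (∀ x → A x ≡ true → R x ≡ true) → Majorised J A
    few-poor h A⊆R = sparse-majorised (suc j) A (begin
      a * ∑-on A (degIn A)       ≤⟨ *-monoʳ-≤ a (∑-on-mono A λ v _ → count≤n (λ u → A u ∧ adj G v u)) ⟩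
      a * ∑-on A (λ _ → n)       ≡⟨ cong (a *_) (∑-on-const A n) ⟩
      a * (count A * n)          ≤⟨ *-monoʳ-≤ a (*-monoˡ-≤ n (count-mono A⊆R)) ⟩
      a * (count R * n)          ≡⟨ *-assoc a (count R) n ⟨
      a * count R * n            ≤⟨ *-monoˡ-≤ n h ⟩
      n * n                      ∎)
    step : a * count R ≤ n → ∀ x → Majorised (suc j) (A∩N x) →
           (∀ v → A v ≡ true → R v ≡ false → degIn A v ≤ degIn A x) → Majorised J A
    step h x (c₂ , excess , stable) maximal = S.c ,
      lincomb (+-mono-≤ (*-monoʳ-≤ a S.excess-step) (+-mono-≤ excess (*-monoʳ-≤ n h))) 0
        (aux₁ a (∑-on A (λ v → degIn A v ∸ crossIn A S.c v))
                (∑-on (A∩N x) (λ v → degIn (A∩N x) v ∸ crossIn (A∩N x) c₂ v)) n (count R) j) ,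
      lincomb (+-mono-≤ (*-monoʳ-≤ (2 * a) S.sum-V₁) (+-mono-≤ stable
                (+-mono-≤ (*-monoʳ-≤ a S.sum-crossing) (*-monoʳ-≤ (2 * n) h)))) 0
        (trans (cong (λ z → a * z + B + 0) S.sum-degrees)
          (aux₂ a (∑-on S.V₁ (degIn A)) (∑-on S.A₂ (degIn S.A₂)) (∑-on S.A₂ (innerIn S.A₂ c₂))
            (count S.V₁ * count S.A₂) n (count R) (∑-on S.A₂ (crossIn S.A₂ c₂))
            (∑-on A (crossIn A S.c)) j))
      where
      module S = Step A x c₂ R maximal
      B = 2 * a * (count S.V₁ * count S.A₂ + n * count R) +
          ((a * ∑-on S.A₂ (crossIn S.A₂ c₂) + 2 * (1 + j) * (n * n)) +
           (a * ∑-on A (crossIn A S.c) + 2 * n * n))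
      aux₁ : ∀ a E E₂ n r j → a * E + (a * (E₂ + n * r) + ((1 + j) * (n * n) + n * n)) + 0
             ≡ (2 + j) * (n * n) + (a * E + (a * E₂ + n * (a * r)))
      aux₁ = solve-∀
      aux₂ : ∀ a X S I p n r T₂ T j →
        a * (2 * X + (S + I)) + (2 * a * (p + n * r) + ((a * T₂ + 2 * (1 + j) * (n * n)) + (a * T + 2 * n * n))) + 0
        ≡ a * T + 2 * (2 + j) * (n * n) + (2 * a * X + (a * (S + I) + (a * (2 * p + T₂) + 2 * n * (a * r))))
      aux₂ = solve-∀
    result : Rich (suc J) A ⊎ Majorised J A
    result with n ≤? a * count R
    ... | yes h = inj₁ (many h)
    ... | no ¬h with any? (λ x → (A x ∧ not (isRich (sub x))) Bool.≟ true)
    ...   | no none = inj₂ (few-poor (<⇒≤ (≰⇒> ¬h)) λ x Ax →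
              true-∧ Ax (trans (≡.sym (not-involutive _)) (true-not
                (¬true⇒false λ e → none (x , true-∧ Ax e)))))
    ...   | yes (x₀ , Px₀) with argmax (λ x → A x ∧ not (isRich (sub x))) (degIn A) Px₀
    ...     | x , Px , max with sub x in eq
    ...       | inj₁ _   = contradiction (∧-right (A x) Px) λ ()
    ...       | inj₂ maj = inj₂ (step (<⇒≤ (≰⇒> ¬h)) x maj λ v Av Rv →
                  max v (true-∧ Av (true-not (aux {A v} {isRich (sub v)} Av Rv))))
      where
      aux : ∀ {a b} → a ≡ true → a ∧ b ≡ false → b ≡ false
      aux refl h = h

-- A vertex of `F` takes its own position in the part of its colour: this gives injectivity within a
-- part, and adjacency gives it across parts.
blowup-contains : ∀ {F : Graph m} (G : Graph n) {j} {W : Fin j → Fin n → Bool} →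
                  Colourable F j → Blowup G W (suc m) → Contains G F
blowup-contains {F = F} G (c , proper) (g , inj , _ , joined) = f , f-inj , λ u v uv →
  joined (c u) (c v) (proper u v uv) (suc u) (suc v)
  where
  f : Fin _ → Fin _
  f u = g (c u) (suc u)
  f-inj : ∀ u v → f u ≡ f v → u ≡ v
  f-inj u v e with c u ≟ c v
  ... | yes cu≡cv = Fin.suc-injective (inj (c v) (suc u) (suc v)
                      (subst (λ l → g l (suc u) ≡ f v) cu≡cv e))
  ... | no cu≢cv = contradiction (irrefl G (f v))
                     (true≢false (subst (λ x → Adj G x (f v)) e (joined (c u) (c v) cu≢cv (suc u) (suc v))))

-- From majorisation to a partition with few inner edges

deg≤n : ∀ (G : Graph n) v → deg G v ≤ n
deg≤n G v = count≤n (adj G v)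

crossing≤n : ∀ (p : Fin n → Fin k) v → crossing p v ≤ n
crossing≤n p v = count≤n (λ w → not (does (p w ≟ p v)))

power-sum : ℕ → (Fin n → ℕ) → ℕ
power-sum r f = ∑ λ v → f v ^ r

-- An extremal graph has this property when χ(F) = k + 1, since every complete k-partite graph,
-- possibly with empty classes, is F-free.
Dominating : ℕ → ℕ → Graph n → Set
Dominating {n} k r G = (p : Fin n → Fin k) → power-sum r (crossing p) ≤ power-sum r (deg G)

NearPartite : (j s δ a : ℕ) → 1 ≤ a → Set
NearPartite j s δ a 1≤a = ∀ {n} → 1 ≤ n → (G : Graph n) →
  Dominating (suc j) (suc s) G → ¬ Majorisation.Rich G a 1≤a (suc (suc j)) (λ _ → true) →
  Σ (Fin n → Fin (suc j)) λ p → suc δ * ∑ (inner G p) ≤ n * n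

-- Stability bounds the inner degrees by the deficit `∑ D` minus `∑ d`, but domination compares
-- powers. Majorisation makes the total excess `E` small, and domination then bounds the deficit
-- weighted by `D ^ s`. Where `D` is at least `n / b` the weight is removed at the price `b ^ s`;
-- elsewhere the deficit is at most `n / b`.
near-partite : ∀ j s δ → Σ ℕ λ a → Σ (1 ≤ a) (NearPartite j s δ a)
near-partite j s δ = a , 1≤a , λ {n} 1≤n G dom poor →
  case Majorisation.rich-or-majorised G a 1≤a j (λ _ → true) of λ where
    (inj₁ rich) → contradiction rich poor
    (inj₂ maj)  → partition 1≤n G dom maj
  where
  κ = suc j
  -- `combined` bounds `b * I` by `2 * (n * n)`: vertices of small crossing degree use one `n * n`,
  -- and `a` is chosen so that the two majorisation errors use exactly the other.
  b = 2 * suc δ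
  a = b ^ suc s * suc s * κ + 2 * κ * b
  1≤a : 1 ≤ a
  1≤a = ≤-trans (s≤s z≤n) (m≤n+m _ (b ^ suc s * suc s * κ))
  instance
    a≢0 : NonZero a
    a≢0 = >-nonZero 1≤a
  partition : ∀ {n} → 1 ≤ n → (G : Graph n) → Dominating (suc j) (suc s) G →
    Majorisation.Majorised G a 1≤a (suc j) (λ _ → true) →
    Σ (Fin n → Fin (suc j)) λ p → suc δ * ∑ (inner G p) ≤ n * n
  partition {n} 1≤n G dom (p , excess , stable) = p , *-cancelˡ-≤ 2 (*-cancelˡ-≤ a (begin
      a * (2 * (suc δ * I))    ≡⟨ cong (a *_) (*-assoc 2 (suc δ) I) ⟨
      a * (b * I)              ≤⟨ combined ⟩
      a * (2 * (n * n))        ∎))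
    where
    open ≤-Reasoning
    instance
      n≢0 : NonZero n
      n≢0 = >-nonZero 1≤n
      n^s≢0 : NonZero (n ^ s)
      n^s≢0 = >-nonZero (m^n>0 n s)
    D d : Fin n → ℕ
    D = crossing p
    d = deg G
    I = ∑ (inner G p)
    E = ∑ λ v → d v ∸ D v
    P = ∑ λ v → D v ∸ d v
    Z = ∑ λ v → (D v ∸ d v) * D v ^ s
    drop-1 : (f : Fin n → ℕ) → ∑-on (λ _ → true) f ≡ ∑ f
    drop-1 f = ∑-cong λ v → +-identityʳ (f v)
    excess′ : a * E ≤ κ * (n * n)
    excess′ = subst (λ z → a * z ≤ κ * (n * n)) (drop-1 _) excess
    stable′ : a * (∑ d + I) ≤ a * ∑ D + 2 * κ * (n * n)
    stable′ = subst₂ (λ x y → a * x ≤ a * y + 2 * κ * (n * n))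
                (cong₂ _+_ (drop-1 d) (drop-1 (inner G p))) (drop-1 D) stable
    ∑D≤ : ∑ D ≤ ∑ d + P
    ∑D≤ = ≤-trans (∑-mono λ v → m≤n+m∸n (D v) (d v)) (≤-reflexive (∑-+ d _))
    Z≤ : Z ≤ suc s * E * n ^ s
    Z≤ = lincomb {a = power-sum (suc s) D + (power-sum (suc s) d + Z)} (+-mono-≤ (dom p) (begin
        power-sum (suc s) d + Z ≡⟨ ∑-+ _ _ ⟨
        _                       ≤⟨ ∑-mono (λ v → excess-bound s (d v) (D v) (deg≤n G v)) ⟩
        _                       ≡⟨ ∑-+ _ _ ⟩
        power-sum (suc s) D + ∑ (λ v → suc s * (d v ∸ D v) * n ^ s)
          ≡⟨ cong (power-sum (suc s) D +_) (trans (∑-*ʳ (n ^ s) _) (cong (_* n ^ s) (∑-*ˡ (suc s) _))) ⟩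
        power-sum (suc s) D + suc s * E * n ^ s ∎)) 0
      (aux Z (power-sum (suc s) d) (power-sum (suc s) D) (suc s * E * n ^ s))
      where
      aux : ∀ Z x y e → Z + (x + (y + e)) + 0 ≡ e + (y + (x + Z))
      aux = solve-∀
    term : ∀ v → b * (n ^ s * (D v ∸ d v)) ≤ b ^ suc s * ((D v ∸ d v) * D v ^ s) + n ^ s * n
    term v with ≤-total n (b * D v)
    ... | inj₁ n≤bD = ≤-trans (begin
            b * (n ^ s * x)          ≤⟨ *-monoʳ-≤ b (*-monoˡ-≤ x (^-monoˡ-≤ s n≤bD)) ⟩
            b * ((b * D v) ^ s * x)  ≡⟨ cong (λ z → b * (z * x)) (^-distrib-* b (D v) s) ⟩
            b * (b ^ s * D v ^ s * x) ≡⟨ aux b (b ^ s) (D v ^ s) x ⟩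
            b ^ suc s * (x * D v ^ s) ∎) (m≤m+n _ _)
      where
      x = D v ∸ d v
      aux : ∀ b p q x → b * (p * q * x) ≡ b * p * (x * q)
      aux = solve-∀
    ... | inj₂ bD≤n = ≤-trans (begin
            b * (n ^ s * (D v ∸ d v)) ≡⟨ aux b (n ^ s) (D v ∸ d v) ⟩
            n ^ s * (b * (D v ∸ d v)) ≤⟨ *-monoʳ-≤ (n ^ s) (≤-trans (*-monoʳ-≤ b (m∸n≤m (D v) (d v))) bD≤n) ⟩
            n ^ s * n                ∎) (m≤n+m _ _)
      where
      aux : ∀ b p x → b * (p * x) ≡ p * (b * x)
      aux = solve-∀
    bP≤ : b * P ≤ b ^ suc s * (suc s * E) + n * n
    bP≤ = *-cancelˡ-≤ (n ^ s) (begin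
        n ^ s * (b * P)
          ≡⟨ aux₁ (n ^ s) b P ⟩
        b * (n ^ s * P)
          ≡⟨ trans (∑-*ˡ b _) (cong (b *_) (∑-*ˡ (n ^ s) _)) ⟨
        _ ≤⟨ ∑-mono term ⟩
        _ ≡⟨ ∑-+ _ _ ⟩
        ∑ (λ v → b ^ suc s * ((D v ∸ d v) * D v ^ s)) + ∑ {n} (λ _ → n ^ s * n)
          ≡⟨ cong₂ _+_ (∑-*ˡ (b ^ suc s) _) (∑-const n _) ⟩
        b ^ suc s * Z + n * (n ^ s * n)
          ≤⟨ +-monoˡ-≤ _ (*-monoʳ-≤ (b ^ suc s) Z≤) ⟩
        b ^ suc s * (suc s * E * n ^ s) + n * (n ^ s * n)
          ≡⟨ aux₂ (b ^ suc s) (suc s * E) (n ^ s) n ⟩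
        n ^ s * (b ^ suc s * (suc s * E) + n * n) ∎)
      where
      aux₁ : ∀ q b P → q * (b * P) ≡ b * (q * P)
      aux₁ = solve-∀
      aux₂ : ∀ p e q n → p * (e * q) + n * (q * n) ≡ q * (p * e + n * n)
      aux₂ = solve-∀
    combined : a * (b * I) ≤ a * (2 * (n * n))
    combined = lincomb (+-mono-≤ (*-monoʳ-≤ b stable′) (+-mono-≤ (*-monoʳ-≤ (a * b) ∑D≤)
        (+-mono-≤ (*-monoʳ-≤ a bP≤) (*-monoʳ-≤ (b ^ suc s * suc s) excess′)))) 0
      (aux a b I (∑ d) (∑ D) κ (n * n) P (b ^ suc s) (suc s) E refl)
      where
      aux : ∀ a b I d D k q P p r E → a ≡ p * r * k + 2 * k * b →
        a * (b * I) + (b * (a * D + 2 * k * q) + (a * b * (d + P) + (a * (p * (r * E) + q) + p * r * (k * q)))) + 0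
        ≡ a * (2 * q) + (b * (a * (d + I)) + (a * b * D + (a * (b * P) + p * r * (a * E))))
      aux _ b I d D k q P p r E refl = aux′ b I d D k q P p r E
        where
        aux′ : ∀ b I d D k q P p r E →
          (p * r * k + 2 * k * b) * (b * I) + (b * ((p * r * k + 2 * k * b) * D + 2 * k * q) + ((p * r * k + 2 * k * b) * b * (d + P) + ((p * r * k + 2 * k * b) * (p * (r * E) + q) + p * r * (k * q)))) + 0
          ≡ (p * r * k + 2 * k * b) * (2 * q) + (b * ((p * r * k + 2 * k * b) * (d + I)) + ((p * r * k + 2 * k * b) * b * D + ((p * r * k + 2 * k * b) * (b * P) + p * r * ((p * r * k + 2 * k * b) * E))))
        aux′ = solve-∀

-- The class sizes of a near-optimal partition

-- The set `Y` moves from the large class `j₀` to `i₀`. By `fits` the enlarged `i₀` does not exceed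
-- the old `j₀`, so crossing degrees can drop only on the old class `i₀`, while each vertex left in
-- `j₀` gains `count Y`.
module Rebalance {n k} (p : Fin n → Fin k) (s : ℕ) (i₀ j₀ : Fin k) (i₀≢j₀ : i₀ ≢ j₀)
                 (Y : Fin n → Bool) (Y⊆ : ∀ u → Y u ≡ true → p u ≡ j₀)
                 (fits : size p i₀ + count Y ≤ size p j₀) where

  q : Fin n → Fin k
  q u = if Y u then i₀ else p u

  V : Fin n → Bool
  V u = does (p u ≟ j₀) ∧ not (Y u)

  crossing-grows : ∀ u e → size q (q u) + e ≤ size p (p u) → crossing p u + e ≤ crossing q u
  crossing-grows u e h = lincomb h 0
    (trans (aux (crossing p u) e (size p (p u)) )
      (trans (cong (_+ e) (trans (size+crossing p u) (≡.sym (size+crossing q u))))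
        (aux′ (size q (q u)) (crossing q u) e)))
    where
    aux : ∀ c e z → c + e + z + 0 ≡ z + c + e
    aux = solve-∀
    aux′ : ∀ z c e → z + c + e ≡ c + (z + e)
    aux′ = solve-∀

  size-i₀ : size q i₀ ≤ size p i₀ + count Y
  size-i₀ = count-∪ λ w → aux w (Y w) refl
    where
    aux : ∀ w b → Y w ≡ b → does ((if b then i₀ else p w) ≟ i₀) ≡ true →
          does (p w ≟ i₀) ≡ true ⊎ Y w ≡ true
    aux w true  Yw _ = inj₂ Yw
    aux w false _  h = inj₁ h

  size-V : size p j₀ ≡ count Y + count V
  size-V = trans (count-split (λ w → does (p w ≟ j₀)) Y) (cong (_+ count V)
    (count-cong λ w → aux w (Y w) refl))
    where
    aux : ∀ w b → Y w ≡ b → does (p w ≟ j₀) ∧ b ≡ b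
    aux w true  Yw = true-∧ (dec-true (p w ≟ j₀) (Y⊆ w Yw)) refl
    aux w false _  with does (p w ≟ j₀)
    ... | true  = refl
    ... | false = refl

  size-j₀ : size q j₀ + count Y ≤ size p j₀
  size-j₀ = ≤-trans (+-monoˡ-≤ (count Y) (count-mono λ w → aux w (Y w)))
    (≤-reflexive (trans (+-comm (count V) (count Y)) (≡.sym size-V)))
    where
    aux : ∀ w b → does ((if b then i₀ else p w) ≟ j₀) ≡ true → does (p w ≟ j₀) ∧ not b ≡ true
    aux w true  h = contradiction (does-true (i₀ ≟ j₀) h) i₀≢j₀
    aux w false h = true-∧ h refl

  size-other : ∀ l → l ≢ i₀ → size q l ≤ size p l
  size-other l l≢i₀ = count-mono λ w → aux w (Y w)
    where
    aux : ∀ w b → does ((if b then i₀ else p w) ≟ l) ≡ true → does (p w ≟ l) ≡ true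
    aux w true  h = contradiction (≡.sym (does-true (i₀ ≟ l) h)) l≢i₀
    aux w false h = h

  term : ∀ u → crossing p u ^ suc s + count Y ^ suc s * 𝟙 (V u) ≤
               crossing q u ^ suc s + n ^ suc s * 𝟙 (does (p u ≟ i₀))
  term u = go (p u ≟ i₀) (p u ≟ j₀) (Y u) refl
    where
    P = crossing p u ^ suc s
    qu : ∀ {b} → Y u ≡ b → q u ≡ (if b then i₀ else p u)
    qu = cong (if_then i₀ else p u)
    superadditive : ∀ x y → x ^ suc s + y ^ suc s ≤ (x + y) ^ suc s
    superadditive x y =
      ≤-trans (+-monoʳ-≤ (x ^ suc s) (*-monoʳ-≤ y (^-monoˡ-≤ s (m≤n+m y x)))) (pow-below s x y)
    no-gain : size q (q u) ≤ size p (p u) →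
      P + count Y ^ suc s * 0 ≤ crossing q u ^ suc s + n ^ suc s * 0
    no-gain h = +-mono-≤
      (^-monoˡ-≤ (suc s) (≤-trans (≤-reflexive (≡.sym (+-identityʳ _)))
        (crossing-grows u 0 (≤-trans (≤-reflexive (+-identityʳ _)) h))))
      (≤-reflexive (trans (*-zeroʳ (count Y ^ suc s)) (≡.sym (*-zeroʳ (n ^ suc s)))))
    go : (di : Dec (p u ≡ i₀)) (dj : Dec (p u ≡ j₀)) → ∀ b → Y u ≡ b →
      P + count Y ^ suc s * 𝟙 (does dj ∧ not b) ≤ crossing q u ^ suc s + n ^ suc s * 𝟙 (does di)
    go (yes pi) (yes pj) _     _  = contradiction (trans (≡.sym pi) pj) i₀≢j₀
    go (yes pi) (no _)   _     _  = begin
      P + count Y ^ suc s * 0                ≡⟨ cong (P +_) (*-zeroʳ (count Y ^ suc s)) ⟩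
      P + 0                                  ≡⟨ +-identityʳ P ⟩
      P                                      ≤⟨ ^-monoˡ-≤ (suc s) (crossing≤n p u) ⟩
      n ^ suc s                              ≡⟨ *-identityʳ (n ^ suc s) ⟨
      n ^ suc s * 1                          ≤⟨ m≤n+m _ (crossing q u ^ suc s) ⟩
      crossing q u ^ suc s + n ^ suc s * 1   ∎
      where open ≤-Reasoning
    go (no _)   (no ¬pj) true  Yu = contradiction (Y⊆ u Yu) ¬pj
    go (no ¬pi) (no _)   false Yu = no-gain
      (subst (λ l → size q l ≤ size p (p u)) (≡.sym (qu Yu)) (size-other (p u) ¬pi))
    go (no _)   (yes pj) true  Yu = no-gain
      (subst₂ (λ l l′ → size q l ≤ size p l′) (≡.sym (qu Yu)) (≡.sym pj) (≤-trans size-i₀ fits))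
    go (no _)   (yes pj) false Yu = begin
      P + count Y ^ suc s * 1                ≡⟨ cong (P +_) (*-identityʳ (count Y ^ suc s)) ⟩
      P + count Y ^ suc s                    ≤⟨ superadditive (crossing p u) (count Y) ⟩
      (crossing p u + count Y) ^ suc s       ≤⟨ ^-monoˡ-≤ (suc s) (crossing-grows u (count Y)
        (subst₂ (λ l l′ → size q l + count Y ≤ size p l′) (≡.sym (trans (qu Yu) pj)) (≡.sym pj) size-j₀)) ⟩
      crossing q u ^ suc s                   ≤⟨ m≤m+n _ _ ⟩
      crossing q u ^ suc s + n ^ suc s * 0   ∎
      where open ≤-Reasoning

  gain : power-sum (suc s) (crossing p) + count Y ^ suc s * count V ≤
         power-sum (suc s) (crossing q) + n ^ suc s * size p i₀
  gain = begin
    power-sum (suc s) (crossing p) + count Y ^ suc s * count V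
      ≡⟨ cong (power-sum (suc s) (crossing p) +_) (∑-*ˡ (count Y ^ suc s) _) ⟨
    _ ≡⟨ ∑-+ _ _ ⟨
    _ ≤⟨ ∑-mono term ⟩
    _ ≡⟨ ∑-+ _ _ ⟩
    _ ≡⟨ cong (power-sum (suc s) (crossing q) +_) (∑-*ˡ (n ^ suc s) _) ⟩
    power-sum (suc s) (crossing q) + n ^ suc s * size p i₀ ∎
    where open ≤-Reasoning

-- The degree exceeds the crossing degree by at most the inner degree. Nothing is assumed of the
-- class sizes, which are yet to be bounded.
power-sum-deg≤ : ∀ (G : Graph n) (p : Fin n → Fin k) s →
  power-sum (suc s) (deg G) ≤ power-sum (suc s) (crossing p) + suc s * ∑ (inner G p) * n ^ s
power-sum-deg≤ {n} G p s = begin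
  power-sum (suc s) (deg G)   ≤⟨ ∑-mono term ⟩
  _                           ≡⟨ ∑-+ _ _ ⟩
  _                           ≡⟨ cong (power-sum (suc s) (crossing p) +_)
                                   (trans (∑-*ʳ (n ^ s) _) (cong (_* n ^ s) (∑-*ˡ (suc s) _))) ⟩
  power-sum (suc s) (crossing p) + suc s * ∑ (inner G p) * n ^ s ∎
  where
  open ≤-Reasoning
  term : ∀ v → deg G v ^ suc s ≤ crossing p v ^ suc s + suc s * inner G p v * n ^ s
  term v = ≤-trans (m+n≤o⇒m≤o _ (excess-bound s (deg G v) (crossing p v) (deg≤n G v)))
    (+-monoʳ-≤ (crossing p v ^ suc s) (*-monoˡ-≤ (n ^ s) (*-monoʳ-≤ (suc s)
      (≤-trans (∸-monoˡ-≤ (crossing p v) (m+n≤o⇒m≤o (deg G v) (≤-reflexive (deg-balance G p v))))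
        (≤-reflexive (m+n∸m≡n (crossing p v) _))))))

LargeParts : (k s c δ N : ℕ) → Set
LargeParts k s c δ N = ∀ {n} → N ≤ n →
  (G : Graph n) (p : Fin n → Fin (suc k)) → Dominating (suc k) (suc s) G →
  δ * ∑ (inner G p) ≤ n * n → ∀ l → n ≤ c * size p l

-- If the class `i₀` were tiny, moving half of the largest class into it would raise the power sum
-- by the order of n^(s + 2), more than domination and few inner edges allow.
large-parts : ∀ k s → Σ ℕ λ c → 1 ≤ c × Σ ℕ λ δ → Σ ℕ λ N → LargeParts k s c δ N
large-parts k s = 2 * K , 1≤c , 2 * K * suc s , 2 * suc k , large
  where
  -- With `y` half of the largest class, `n ≤ 3 * suc k * y`; the 3 covers the rounding. The factor
  -- 2 in the other constants splits the contradiction evenly between the tiny class and the inner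
  -- edges.
  K = (3 * suc k) ^ suc (suc s)
  1≤K : 1 ≤ K
  1≤K = m^n>0 (3 * suc k) (suc (suc s))
  1≤c : 1 ≤ 2 * K
  1≤c = ≤-trans 1≤K (m≤m+n K _)
  large : ∀ {n} → 2 * suc k ≤ n → (G : Graph n) (p : Fin n → Fin (suc k)) →
    Dominating (suc k) (suc s) G → 2 * K * suc s * ∑ (inner G p) ≤ n * n → ∀ l → n ≤ 2 * K * size p l
  large {n} N≤n G p dom few i₀ with n ≤? 2 * K * size p i₀
  ... | yes h = h
  ... | no  h = ⊥-elim (<-irrefl refl (begin-strict
      2 * n ^ suc (suc s)
        ≤⟨ *-monoʳ-≤ 2 (≤-trans (^-monoˡ-≤ (suc (suc s)) n≤3ky)
             (≤-reflexive (^-distrib-* (3 * suc k) y (suc (suc s))))) ⟩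
      2 * (K * y ^ suc (suc s))
        ≤⟨ *-monoʳ-≤ 2 (*-monoʳ-≤ K y≤) ⟩
      2 * (K * (n ^ suc s * z + suc s * I * n ^ s))
        ≡⟨ aux₁ K (n ^ s) n z (suc s) I ⟩
      2 * K * z * (n * n ^ s) + 2 * K * suc s * I * n ^ s
        <⟨ +-mono-<-≤ (*-monoˡ-< (n ^ suc s) small) (*-monoˡ-≤ (n ^ s) few) ⟩
      n * n ^ suc s + n * n * n ^ s
        ≡⟨ aux₂ n (n ^ s) ⟩
      2 * n ^ suc (suc s) ∎))
    where
    open ≤-Reasoning
    1≤n : 1 ≤ n
    1≤n = ≤-trans (s≤s z≤n) N≤n
    instance
      n≢0 : NonZero n
      n≢0 = >-nonZero 1≤n
      n^r≢0 : NonZero (n ^ suc s)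
      n^r≢0 = >-nonZero (m^n>0 n (suc s))
    I = ∑ (inner G p)
    z = size p i₀
    small : 2 * K * z < n
    small = ≰⇒> h
    largest : ∃ λ l → n ≤ suc k * size p l
    largest with any? (λ l → n ≤? suc k * size p l)
    ... | yes l = l
    ... | no none = ⊥-elim (<-irrefl refl (begin-strict
        suc k * n                      ≡⟨ cong (suc k *_) (∑-size p) ⟨
        suc k * ∑ (size p)             ≡⟨ ∑-*ˡ (suc k) _ ⟨
        ∑ (λ l → suc k * size p l)     <⟨ ∑-mono-< (λ l → ≰⇒> λ le → none (l , le)) ⟩
        ∑ {suc k} (λ _ → n)            ≡⟨ ∑-const (suc k) n ⟩
        suc k * n                      ∎))
      where
      ∑-mono-< : ∀ {k} {f g : Fin (suc k) → ℕ} → (∀ l → f l < g l) → ∑ f < ∑ g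
      ∑-mono-< {f = f} {g} lt = subst₂ _<_ (≡.sym (∑-suc f)) (≡.sym (∑-suc g))
        (+-mono-<-≤ (lt zero) (∑-mono λ l → <⇒≤ (lt (suc l))))
    j₀ = proj₁ largest
    x = size p j₀
    y = ⌊ x /2⌋
    2≤x : 2 ≤ x
    2≤x = *-cancelˡ-≤ (suc k) (≤-trans (≤-trans (≤-reflexive (*-comm (suc k) 2)) N≤n) (proj₂ largest))
    halves : ∀ x → 2 ≤ x → x ≤ 3 * ⌊ x /2⌋ × ⌊ x /2⌋ + ⌊ x /2⌋ ≤ x
    halves (suc zero) (s≤s ())
    halves (suc (suc zero)) _ = s≤s (s≤s z≤n) , ≤-refl
    halves (suc (suc (suc zero))) _ = s≤s (s≤s (s≤s z≤n)) , s≤s (s≤s z≤n)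
    halves (suc (suc x@(suc (suc _)))) _ =
      let (a , b) = halves x (s≤s (s≤s z≤n)); h = ⌊ x /2⌋ in
      ≤-trans (s≤s (s≤s (≤-trans a (n≤1+n (3 * h))))) (≤-reflexive (aux₁′ h)) ,
      ≤-trans (≤-reflexive (cong suc (+-suc h h))) (s≤s (s≤s b))
      where
      aux₁′ : ∀ h → 3 + 3 * h ≡ 3 * (1 + h)
      aux₁′ = solve-∀
    x≤3y = proj₁ (halves x 2≤x)
    2y≤x = proj₂ (halves x 2≤x)
    n≤3ky : n ≤ 3 * suc k * y
    n≤3ky = begin
      n                    ≤⟨ proj₂ largest ⟩
      suc k * x            ≤⟨ *-monoʳ-≤ (suc k) x≤3y ⟩
      suc k * (3 * y)      ≡⟨ aux (suc k) y ⟩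
      3 * suc k * y        ∎
      where
      aux : ∀ k y → k * (3 * y) ≡ 3 * k * y
      aux = solve-∀
    3k≤2K : 3 * suc k ≤ 2 * K
    3k≤2K = begin
      3 * suc k                          ≡⟨ *-identityʳ (3 * suc k) ⟨
      3 * suc k * 1                      ≤⟨ *-monoʳ-≤ (3 * suc k) (m^n>0 (3 * suc k) (suc s)) ⟩
      K                                  ≤⟨ m≤m+n K _ ⟩
      2 * K                              ∎
    z<y : z < y
    z<y = *-cancelˡ-< (2 * K) z y (<-≤-trans small (≤-trans n≤3ky (*-monoˡ-≤ y 3k≤2K)))
    i₀≢j₀ : i₀ ≢ j₀
    i₀≢j₀ e = <-irrefl refl (<-≤-trans z<y (≤-trans (≤-trans (m≤m+n y y) 2y≤x)
                (≤-reflexive (cong (size p) (≡.sym e)))))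
    chosen = subset-of-size y (λ w → does (p w ≟ j₀)) (≤-trans (m≤m+n y y) 2y≤x)
    Y = proj₁ chosen
    Y≡ : count Y ≡ y
    Y≡ = proj₂ (proj₂ chosen)
    module R = Rebalance p s i₀ j₀ i₀≢j₀ Y (λ u h → does-true (p u ≟ j₀) (proj₁ (proj₂ chosen) u h))
      (≤-trans (+-mono-≤ (<⇒≤ z<y) (≤-reflexive Y≡)) 2y≤x)
    y≤V : y ≤ count R.V
    y≤V = +-cancelˡ-≤ y _ _ (≤-trans 2y≤x (≤-reflexive (trans R.size-V (cong (_+ count R.V) Y≡))))
    y≤ : y ^ suc (suc s) ≤ n ^ suc s * z + suc s * I * n ^ s
    y≤ = lincomb (+-mono-≤ (≤-trans (+-monoʳ-≤ (power-sum (suc s) (crossing p)) (≤-trans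
             (≤-reflexive (*-comm y (y ^ suc s))) (*-mono-≤ (≤-reflexive (cong (_^ suc s) (≡.sym Y≡))) y≤V))) R.gain)
           (+-mono-≤ (dom R.q) (power-sum-deg≤ G p s))) 0
      (aux (y ^ suc (suc s)) (power-sum (suc s) (crossing R.q)) (n ^ suc s * z) (power-sum (suc s) (deg G))
           (power-sum (suc s) (crossing p)) (suc s * I * n ^ s))
      where
      aux : ∀ y q z d p i → y + (q + z + (d + (p + i))) + 0 ≡ z + i + (p + y + (q + d))
      aux = solve-∀
    aux₁ : ∀ K q n z r I → 2 * (K * (n * q * z + r * I * q)) ≡ 2 * K * z * (n * q) + 2 * K * r * I * q
    aux₁ = solve-∀
    aux₂ : ∀ n q → n * (n * q) + n * n * q ≡ 2 * (n * (n * q))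
    aux₂ = solve-∀

-- There are at least two classes, so every vertex has a linear class other than its own and its
-- crossing degree is at least `n / c`, as `vertex-bound` requires.
power-sum-balance : ∀ (G : Graph n) (p : Fin n → Fin (suc (suc k))) s c → 1 ≤ c →
  (∀ l → n ≤ c * size p l) →
  c ^ s * power-sum (suc s) (deg G) + ∑ (miss G p) * n ^ s ≤
  c ^ s * power-sum (suc s) (crossing p) + c ^ s * (suc s * ∑ (inner G p) * n ^ s)
power-sum-balance {n} G p s c 1≤c large = begin
  c ^ s * power-sum (suc s) (deg G) + ∑ (miss G p) * n ^ s
    ≡⟨ cong₂ _+_ (∑-*ˡ (c ^ s) _) (∑-*ʳ (n ^ s) _) ⟨
  _ ≡⟨ ∑-+ _ _ ⟨
  _ ≤⟨ ∑-mono (λ v → vertex-bound s 1≤c (deg≤n G v) (n≤cD v) (deg-balance G p v) refl) ⟩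
  _ ≡⟨ ∑-+ _ _ ⟩
  _ ≡⟨ cong₂ _+_ (∑-*ˡ (c ^ s) _) (trans (∑-*ˡ (c ^ s) _) (cong (c ^ s *_)
         (trans (∑-*ʳ (n ^ s) _) (cong (_* n ^ s) (∑-*ˡ (suc s) _))))) ⟩
  c ^ s * power-sum (suc s) (crossing p) + c ^ s * (suc s * ∑ (inner G p) * n ^ s) ∎
  where
  open ≤-Reasoning
  other : ∀ (x : Fin (suc (suc k))) → ∃ λ l → l ≢ x
  other zero    = suc zero , λ ()
  other (suc x) = zero , λ ()
  n≤cD : ∀ v → n ≤ c * crossing p v
  n≤cD v = let (l , l≢) = other (p v) in ≤-trans (large l) (*-monoʳ-≤ c (size≤crossing p v l l≢))

-- Embedding F into a graph that is nearly complete multipartite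

TransversalCliques : (j β κ C : ℕ) → Set
TransversalCliques j β κ C = ∀ {n} → 1 ≤ n → (G : Graph n)
  (M : Fin n → Fin n → Bool) (W : Fin j → Fin n → Bool) →
  (∀ l l′ → l ≢ l′ → ∀ x y → W l x ≡ true → W l′ y ≡ true → Adj G x y ⊎ M x y ≡ true) →
  (∀ l → n ≤ β * count (W l)) → κ * ∑ (λ x → count (M x)) ≤ n * n →
  n ^ j ≤ C * cnt j (isClique G W)

-- A first vertex that misses at most `n / b` others keeps half of the guaranteed size of every
-- other candidate set, hence `2 * β` in the recursion. The summand `b * b` of the density leaves at
-- most `n / b` atypical vertices, half of what `W zero` must contain.
transversal-cliques : ∀ j β → Σ ℕ λ κ → Σ ℕ λ C → TransversalCliques j β κ C
transversal-cliques zero    β = 0 , 1 , λ _ G M W _ _ _ → s≤s z≤n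
transversal-cliques (suc j) β with transversal-cliques j (2 * β)
... | κ , C , rec = 2 * β * (2 * β) + κ , 2 * β * C , bound
  where
  b = 2 * β
  bound : ∀ {n} → 1 ≤ n → (G : Graph n) (M : Fin n → Fin n → Bool) (W : Fin (suc j) → Fin n → Bool) →
    (∀ l l′ → l ≢ l′ → ∀ x y → W l x ≡ true → W l′ y ≡ true → Adj G x y ⊎ M x y ≡ true) →
    (∀ l → n ≤ β * count (W l)) → (b * b + κ) * ∑ (λ x → count (M x)) ≤ n * n →
    n ^ suc j ≤ b * C * cnt (suc j) (isClique G W)
  bound {n} 1≤n G M W near large sparse = begin
    n * n ^ j                              ≤⟨ *-monoˡ-≤ (n ^ j) n≤X ⟩
    b * count X * n ^ j                    ≡⟨ *-assoc b (count X) (n ^ j) ⟩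
    b * (count X * n ^ j)                  ≤⟨ *-monoʳ-≤ b total ⟩
    b * (C * cnt (suc j) (isClique G W))   ≡⟨ *-assoc b C _ ⟨
    b * C * cnt (suc j) (isClique G W)     ∎
    where
    open ≤-Reasoning
    instance
      n≢0 : NonZero n
      n≢0 = >-nonZero 1≤n
    typical X : Fin n → Bool
    typical x = does (b * count (M x) ≤? n)
    X x = W zero x ∧ typical x
    W′ : Fin n → Fin j → Fin n → Bool
    W′ x l y = W (suc l) y ∧ adj G x y
    atypical-term : ∀ x → n * 𝟙 (not (typical x)) ≤ b * count (M x)
    atypical-term x = aux (b * count (M x) ≤? n)
      where
      aux : (d : Dec (b * count (M x) ≤ n)) → n * 𝟙 (not (does d)) ≤ b * count (M x)
      aux (yes _) = ≤-trans (≤-reflexive (*-zeroʳ n)) z≤n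
      aux (no ¬p) = ≤-trans (≤-reflexive (*-identityʳ n)) (<⇒≤ (≰⇒> ¬p))
    atypical≤ : b * count (not ∘ typical) ≤ n
    atypical≤ = *-cancelˡ-≤ n (begin
      n * (b * count (not ∘ typical))  ≡⟨ aux n b (count (not ∘ typical)) ⟩
      b * (n * count (not ∘ typical))  ≡⟨ cong (b *_) (∑-*ˡ n _) ⟨
      b * ∑ (λ x → n * 𝟙 (not (typical x))) ≤⟨ *-monoʳ-≤ b (∑-mono atypical-term) ⟩
      b * ∑ (λ x → b * count (M x))    ≡⟨ cong (b *_) (∑-*ˡ b _) ⟩
      b * (b * ∑ (λ x → count (M x)))  ≡⟨ *-assoc b b _ ⟨
      b * b * ∑ (λ x → count (M x))    ≤⟨ *-monoˡ-≤ _ (m≤m+n (b * b) κ) ⟩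
      (b * b + κ) * ∑ (λ x → count (M x)) ≤⟨ sparse ⟩
      n * n                            ∎)
      where
      aux : ∀ n b c → n * (b * c) ≡ b * (n * c)
      aux = solve-∀
    n≤X : n ≤ b * count X
    n≤X = lincomb (+-mono-≤ (*-monoʳ-≤ 2 (≤-trans (large zero) (*-monoʳ-≤ β W₀≤))) atypical≤) 0
      (aux n β (count X) (count (not ∘ typical)))
      where
      W₀≤ : count (W zero) ≤ count X + count (not ∘ typical)
      W₀≤ = count-∪ λ x Wx → split x Wx (typical x) refl
        where
        split : ∀ x → W zero x ≡ true → ∀ b → typical x ≡ b → X x ≡ true ⊎ not (typical x) ≡ true
        split x Wx true  t = inj₁ (true-∧ Wx t)
        split x Wx false t = inj₂ (true-not t)
      aux : ∀ n β x y → n + (2 * (β * (x + y)) + n) + 0 ≡ 2 * β * x + (2 * n + 2 * β * y)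
      aux = solve-∀
    term : ∀ x → 𝟙 (X x) * n ^ j ≤ C * cnt j (λ xs → W zero x ∧ isClique G (W′ x) xs)
    term x = go (W zero x) (b * count (M x) ≤? n) refl
      where
      go : ∀ w (d : Dec (b * count (M x) ≤ n)) → W zero x ≡ w →
           𝟙 (w ∧ does d) * n ^ j ≤ C * cnt j (λ xs → w ∧ isClique G (W′ x) xs)
      go false _       _  = z≤n
      go true  (no _)  _  = z≤n
      go true  (yes t) Wx = ≤-trans (≤-reflexive (+-identityʳ (n ^ j)))
        (rec 1≤n G M (W′ x) (λ l l′ l≢ y z Wy Wz → near (suc l) (suc l′) (l≢ ∘ Fin.suc-injective) y z
                                 (proj₁ (∧-true Wy)) (proj₁ (∧-true Wz)))
           large′ (≤-trans (*-monoˡ-≤ _ (m≤n+m κ (b * b))) sparse))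
        where
        large′ : ∀ l → n ≤ b * count (W′ x l)
        large′ l = lincomb (+-mono-≤ (*-monoʳ-≤ 2 (≤-trans (large (suc l)) (*-monoʳ-≤ β W≤))) t) 0
          (aux n β (count (W′ x l)) (count (M x)))
          where
          W≤ : count (W (suc l)) ≤ count (W′ x l) + count (M x)
          W≤ = count-∪ λ y Wy → case near zero (suc l) (λ ()) x y Wx Wy of λ where
            (inj₁ xy) → inj₁ (true-∧ Wy xy)
            (inj₂ m)  → inj₂ m
          aux : ∀ n β x y → n + (2 * (β * (x + y)) + n) + 0 ≡ 2 * β * x + (2 * n + 2 * β * y)
          aux = solve-∀
    total : count X * n ^ j ≤ C * cnt (suc j) (isClique G W)
    total = ≤-trans (≤-reflexive (≡.sym (∑-*ʳ (n ^ j) _)))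
              (≤-trans (∑-mono term) (≤-reflexive (∑-*ˡ C _)))

class : (Fin n → Fin k) → Fin k → Fin n → Bool
class p l x = does (p x ≟ l)

different-classes : ∀ (G : Graph n) (p : Fin n → Fin k) (W : Fin k → Fin n → Bool) →
  (∀ l x → W l x ≡ true → p x ≡ l) →
  ∀ l l′ → l ≢ l′ → ∀ x y → W l x ≡ true → W l′ y ≡ true → Adj G x y ⊎ missing G p x y ≡ true
different-classes G p W W⊆ l l′ l≢ x y Wx Wy with adj G x y
... | true  = inj₁ refl
... | false = inj₂ (true-not (dec-false (p y ≟ p x) λ e →
                l≢ (trans (≡.sym (W⊆ l x Wx)) (trans (≡.sym e) (W⊆ l′ y Wy)))))

ClassBlowup : (k β t κ N : ℕ) → Set
ClassBlowup k β t κ N = ∀ {n} → N ≤ n → (G : Graph n)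
  (p : Fin n → Fin k) (W : Fin k → Fin n → Bool) → (∀ l x → W l x ≡ true → p x ≡ l) →
  (∀ l → n ≤ β * count (W l)) → κ * ∑ (miss G p) ≤ n * n → Blowup G W (suc t)

class-blowup : ∀ k β t → Σ ℕ λ κ → Σ ℕ λ N → ClassBlowup k β t κ N
class-blowup k β t =
  let (κ , C , cliques) = transversal-cliques k β
      (N , blowup)      = cliques-force-blowup k t C
  in κ , suc N , λ N<n G p W W⊆ large sparse → blowup (≤-trans (n≤1+n N) N<n) G W
       (cliques (≤-trans (s≤s z≤n) N<n) G (missing G p) W (different-classes G p W W⊆) large sparse)

-- The vertices of F in B are placed by f, the others in a blow-up.
glue : ∀ {F : Graph m} (G : Graph n) {j} {W : Fin j → Fin n → Bool} (bl : Blowup G W (suc m)) →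
  let g = proj₁ bl in (B : Fin m → Bool) (f : Fin m → Fin n) (τ : Fin m → Fin j) →
  (∀ u v → B u ≡ true → B v ≡ true → f u ≡ f v → u ≡ v) →
  (∀ u v → B u ≡ true → B v ≡ true → Adj F u v → Adj G (f u) (f v)) →
  (∀ u v → B u ≡ true → B v ≡ false → f u ≢ g (τ v) (suc v)) →
  (∀ u v → B u ≡ true → B v ≡ false → Adj F u v → Adj G (f u) (g (τ v) (suc v))) →
  (∀ u v → B u ≡ false → B v ≡ false → Adj F u v → τ u ≢ τ v) →
  Contains G F
glue {m} {n} {F} G (g , inj , _ , joined) B f τ f-inj f-hom avoid attach proper = h ,
  (λ u v → h-inj u v (B u) (B v) refl refl) , (λ u v → h-hom u v (B u) (B v) refl refl)
  where
  h : Fin m → Fin n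
  h u = if B u then f u else g (τ u) (suc u)
  h≡ : ∀ u {b} → B u ≡ b → h u ≡ (if b then f u else g (τ u) (suc u))
  h≡ u = cong (if_then f u else g (τ u) (suc u))
  h-inj : ∀ u v b c → B u ≡ b → B v ≡ c → h u ≡ h v → u ≡ v
  h-inj u v true  true  Bu Bv e = f-inj u v Bu Bv (trans (≡.sym (h≡ u Bu)) (trans e (h≡ v Bv)))
  h-inj u v true  false Bu Bv e =
    contradiction (trans (≡.sym (h≡ u Bu)) (trans e (h≡ v Bv))) (avoid u v Bu Bv)
  h-inj u v false true  Bu Bv e =
    contradiction (trans (≡.sym (h≡ v Bv)) (trans (≡.sym e) (h≡ u Bu))) (avoid v u Bv Bu)
  h-inj u v false false Bu Bv e = same-class (trans (≡.sym (h≡ u Bu)) (trans e (h≡ v Bv)))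
    where
    same-class : g (τ u) (suc u) ≡ g (τ v) (suc v) → u ≡ v
    same-class e with τ u ≟ τ v
    ... | yes τ≡ = Fin.suc-injective (inj (τ v) (suc u) (suc v)
                     (subst (λ l → g l (suc u) ≡ g (τ v) (suc v)) τ≡ e))
    ... | no τ≢  = contradiction (irrefl G _)
                     (true≢false (subst (λ x → Adj G x (g (τ v) (suc v))) e (joined (τ u) (τ v) τ≢ (suc u) (suc v))))
  h-hom : ∀ u v b c → B u ≡ b → B v ≡ c → Adj F u v → Adj G (h u) (h v)
  h-hom u v true  true  Bu Bv uv = subst₂ (Adj G) (≡.sym (h≡ u Bu)) (≡.sym (h≡ v Bv)) (f-hom u v Bu Bv uv)
  h-hom u v true  false Bu Bv uv = subst₂ (Adj G) (≡.sym (h≡ u Bu)) (≡.sym (h≡ v Bv)) (attach u v Bu Bv uv)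
  h-hom u v false true  Bu Bv uv = subst₂ (Adj G) (≡.sym (h≡ u Bu)) (≡.sym (h≡ v Bv))
    (trans (sym G _ _) (attach v u Bv Bu (trans (sym F v u) uv)))
  h-hom u v false false Bu Bv uv = subst₂ (Adj G) (≡.sym (h≡ u Bu)) (≡.sym (h≡ v Bv))
    (joined (τ u) (τ v) (proper u v Bu Bv uv) (suc u) (suc v))

-- The two colours of a member of the decomposition family share the class `i₀`, and the other
-- colours receive the other classes one by one. `punchOut` removes `j`; a transposition then brings
-- `i` to `i₀`.
merge : ∀ (i j : Fin (suc k)) → i ≢ j → (i₀ : Fin k) → Σ (Fin (suc k) → Fin k) λ τ →
  τ i ≡ i₀ × τ j ≡ i₀ × (∀ a b → τ a ≡ τ b → a ≡ b ⊎ ((a ≡ i ⊎ a ≡ j) × (b ≡ i ⊎ b ≡ j)))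
merge {suc k} i j i≢j i₀ = τ , τi , τj , τ-inj
  where
  i′ : Fin (suc k)
  i′ = punchOut (i≢j ∘ ≡.sym)
  π = transpose i′ i₀
  τ : Fin (suc (suc k)) → Fin (suc k)
  τ a with j ≟ a
  ... | yes _  = i₀
  ... | no j≢a = π ⟨$⟩ʳ punchOut j≢a
  τj : τ j ≡ i₀
  τj with j ≟ j
  ... | yes _ = refl
  ... | no ¬e = contradiction refl ¬e
  τi : τ i ≡ i₀
  τi with j ≟ i
  ... | yes _  = refl
  ... | no j≢i = trans (cong (π ⟨$⟩ʳ_) (Fin.punchOut-cong j refl)) (transposeˡ i′ i₀)
  π-inj : ∀ {x y} → π ⟨$⟩ʳ x ≡ π ⟨$⟩ʳ y → x ≡ y
  π-inj {x} {y} e = trans (≡.sym (inverseˡ π)) (trans (cong (π ⟨$⟩ˡ_) e) (inverseˡ π))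
  τ-inj : ∀ a b → τ a ≡ τ b → a ≡ b ⊎ ((a ≡ i ⊎ a ≡ j) × (b ≡ i ⊎ b ≡ j))
  τ-inj a b e with j ≟ a | j ≟ b
  ... | yes j≡a | yes j≡b = inj₁ (trans (≡.sym j≡a) j≡b)
  ... | no j≢a  | no j≢b  = inj₁ (punchOut-injective j≢a j≢b (π-inj e))
  ... | yes j≡a | no j≢b  = inj₂ (inj₂ (≡.sym j≡a) , inj₁ (≡.sym
        (punchOut-injective (i≢j ∘ ≡.sym) j≢b (π-inj (trans (transposeˡ i′ i₀) e)))))
  ... | no j≢a  | yes j≡b = inj₂ (inj₁ (≡.sym
        (punchOut-injective (i≢j ∘ ≡.sym) j≢a (π-inj (trans (transposeˡ i′ i₀) (≡.sym e))))) ,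
        inj₂ (≡.sym j≡b))

inClasses? : ∀ (c : Fin m → Fin k) i j u → Dec (InClasses c i j u)
inClasses? c i j u = (c u ≟ i) ⊎-dec (c u ≟ j)

star : ∀ n → Graph (suc n)
star n .adj zero    zero    = false
star n .adj zero    (suc _) = true
star n .adj (suc _) zero    = true
star n .adj (suc _) (suc _) = false
star n .sym zero    zero    = refl
star n .sym zero    (suc _) = refl
star n .sym (suc _) zero    = refl
star n .sym (suc _) (suc _) = refl
star n .irrefl zero    = refl
star n .irrefl (suc _) = refl

edges-star : ∀ n → n ≤ edges (star n)
edges-star n = *-cancelˡ-≤ 2 (begin
  2 * n                          ≡⟨ cong (n +_) (+-identityʳ n) ⟩
  n + n                          ≤⟨ +-mono-≤ (≤-reflexive centre) (≤-trans (≤-reflexive (≡.sym count-true)) (∑-mono leaf)) ⟩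
  deg (star n) zero + ∑ (λ v → deg (star n) (suc v)) ≡⟨ ∑-suc (deg (star n)) ⟨
  ∑ (deg (star n))               ≡⟨ handshake (star n) ⟨
  edges (star n) + edges (star n) ≡⟨ cong (edges (star n) +_) (+-identityʳ _) ⟨
  2 * edges (star n)             ∎)
  where
  open ≤-Reasoning
  centre : n ≡ deg (star n) zero
  centre = ≡.sym (trans (count-suc (adj (star n) zero)) count-true)
  leaf : ∀ v → 1 ≤ deg (star n) (suc v)
  leaf v = term≤∑ (λ w → 𝟙 (adj (star n) (suc v) w)) zero

star-adj-leaf : ∀ n {u v} → Adj (star n) u v → u ≢ zero → v ≡ zero
star-adj-leaf n {zero}          _ u≢0 = contradiction refl u≢0
star-adj-leaf n {suc _} {zero}  _ _   = refl

-- If a star contained a member, its vertex at the centre could be put at `v₀`, which sees the whole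
-- blow-up. The two classes of the member then share one part, harmlessly because leaves are not
-- adjacent, and `G` would contain `F`.
star-free : ∀ {F : Graph m} (G : Graph n) (v₀ : Fin n) {W : Fin (suc k) → Fin n → Bool} →
  Free G F → Blowup G W (suc m) → (∀ l x → W l x ≡ true → Adj G v₀ x) →
  ∀ n′ → DFree (star n′) F (suc k)
star-free {m = m} {F = F} G v₀ {W} free bl@(g , _ , sat , _) link n′ c proper i j i≢j (f , f-inj , f-hom) =
  free (glue {F = F} G {W = W} bl B (λ _ → v₀) (τ ∘ c) B-inj B-hom
    (λ u v _ _ e → contradiction (irrefl G v₀) (true≢false (subst (Adj G v₀) (≡.sym e) (apex v))))
    (λ u v _ _ _ → apex v)
    avoid)
  where
  merged = merge i j i≢j zero
  τ = proj₁ merged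
  apex : ∀ v → Adj G v₀ (g (τ (c v)) (suc v))
  apex v = link (τ (c v)) (g (τ (c v)) (suc v)) (sat (τ (c v)) (suc v))
  B? : ∀ u → Dec (InClasses c i j u × f u ≡ zero)
  B? u = inClasses? c i j u ×-dec (f u ≟ zero)
  -- At most one vertex qualifies, by injectivity of `f` on the member.
  B : Fin m → Bool
  B u = does (B? u)
  B-inj : ∀ u v → B u ≡ true → B v ≡ true → v₀ ≡ v₀ → u ≡ v
  B-inj u v Bu Bv _ = let (du , fu) = does-true (B? u) Bu; (dv , fv) = does-true (B? v) Bv in
    f-inj u v du dv (trans fu (≡.sym fv))
  B-hom : ∀ u v → B u ≡ true → B v ≡ true → Adj F u v → Adj G v₀ v₀
  B-hom u v Bu Bv uv = contradiction (irrefl F u)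
    (true≢false (subst (Adj F u) (≡.sym (B-inj u v Bu Bv refl)) uv))
  avoid : ∀ u v → B u ≡ false → B v ≡ false → Adj F u v → τ (c u) ≢ τ (c v)
  avoid u v ¬Bu ¬Bv uv e with proj₂ (proj₂ (proj₂ merged)) (c u) (c v) e
  ... | inj₁ same      = proper u v uv same
  ... | inj₂ (du , dv) = does-false (B? v) ¬Bv (dv ,
          star-adj-leaf n′ (f-hom u v du dv uv) (λ fu → does-false (B? u) ¬Bu (du , fu)))

-- Graphs inside one class

count-all : ∀ (P : Fin n → Bool) (Q : Fin m → Fin n → Bool) →
  count P ≤ count (λ x → P x ∧ allᵇ (λ u → Q u x)) + ∑ (λ u → count (λ x → P x ∧ not (Q u x)))
count-all {n} {m} P Q = begin
  count P
    ≡⟨ count-split P (λ x → allᵇ (λ u → Q u x)) ⟩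
  count (λ x → P x ∧ allᵇ (λ u → Q u x)) + count (λ x → P x ∧ not (allᵇ (λ u → Q u x)))
    ≤⟨ +-monoʳ-≤ _ (≤-trans (∑-mono term) (≤-reflexive (∑-swap _))) ⟩
  count (λ x → P x ∧ allᵇ (λ u → Q u x)) + ∑ (λ u → count (λ x → P x ∧ not (Q u x))) ∎
  where
  open ≤-Reasoning
  term : ∀ x → 𝟙 (P x ∧ not (allᵇ (λ u → Q u x))) ≤ ∑ (λ u → 𝟙 (P x ∧ not (Q u x)))
  term x with P x
  ... | false = z≤n
  ... | true with any? (λ u → Q u x Bool.≟ false)
  ...   | yes (u , Qu) = ≤-trans (𝟙≤1 _) (≤-trans (≤-reflexive (cong (𝟙 ∘ not) (≡.sym Qu)))
                           (term≤∑ (λ u → 𝟙 (not (Q u x))) u))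
  ...   | no none = ≤-trans (≤-reflexive (cong (𝟙 ∘ not) (allᵇ-intro (λ u → Q u x)
                      λ u → trans (≡.sym (not-involutive _)) (true-not (¬true⇒false λ h → none (u , not-true h)))))) z≤n

-- In the class of `w` it is enough to avoid `w`: all edges of the member already run between
-- vertices that keep their place.
allowed-by : Graph n → Bool → Fin n → Fin n → Bool
allowed-by G same w x = if same then not (does (w ≟ x)) else adj G w x

few-excluded : ∀ (G : Graph n) (p : Fin n → Fin k) l γ w → γ ≤ n → γ * miss G p w ≤ n →
  γ * count (λ x → class p l x ∧ not (allowed-by G (does (l ≟ p w)) w x)) ≤ n
few-excluded {n} G p l γ w γ≤n γmiss≤n = go (l ≟ p w)
  where
  go : (d : Dec (l ≡ p w)) → γ * count (λ x → class p l x ∧ not (allowed-by G (does d) w x)) ≤ n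
  go (yes _) = ≤-trans (*-monoʳ-≤ γ (≤-trans (count-mono only-w) (≤-reflexive (count-single w))))
                 (≤-trans (≤-reflexive (*-identityʳ γ)) γ≤n)
    where
    only-w : ∀ x → class p l x ∧ not (not (does (w ≟ x))) ≡ true → does (w ≟ x) ≡ true
    only-w x h = trans (≡.sym (not-involutive _)) (∧-right (class p l x) h)
  go (no l≢) = ≤-trans (*-monoʳ-≤ γ (count-mono only-missing)) γmiss≤n
    where
    only-missing : ∀ x → class p l x ∧ not (adj G w x) ≡ true → missing G p w x ≡ true
    only-missing x h = true-∧ (∧-right (class p l x) h) (true-not (dec-false (p x ≟ p w) λ e →
      l≢ (trans (≡.sym (does-true (p x ≟ l) (proj₁ (∧-true h)))) e)))

ClassGraphFree : (m k c κ N : ℕ) → Set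
ClassGraphFree m k c κ N = ∀ {n} → N ≤ n → {F : Graph m} (G : Graph n)
  (p : Fin n → Fin k) → Free G F → (∀ l → n ≤ c * size p l) → κ * ∑ (miss G p) ≤ n * n →
  ∀ i₀ (H : Graph n) →
  (∀ u v → Adj H u v → Adj G u v × p u ≡ i₀ × 2 * c * suc m * miss G p u ≤ n) → DFree H F k

-- A member inside the class `i₀` would extend to a copy of `F`: its non-isolated vertices see
-- almost all of each other class, so the rest of `F` fits into a blow-up among the vertices they
-- allow.
class-graph-free : ∀ {m k c κ N} → ClassBlowup k (2 * c) m κ N → ClassGraphFree m k c κ (N + 2 * c * suc m)
class-graph-free {m} {k} {c} {κ} {N} blowup = dfree
  where
  -- At most `m` vertices are placed and each excludes at most `n / γ` vertices of a class, so half
  -- of the guaranteed `n / c` survives.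
  γ = 2 * c * suc m
  dfree : ∀ {n} → N + γ ≤ n → {F : Graph m} (G : Graph n)
    (p : Fin n → Fin k) → Free G F → (∀ l → n ≤ c * size p l) → κ * ∑ (miss G p) ≤ n * n →
    ∀ i₀ (H : Graph n) →
    (∀ u v → Adj H u v → Adj G u v × p u ≡ i₀ × γ * miss G p u ≤ n) → DFree H F k
  dfree {n} N≤n {F} G p free large sparse i₀ H H⊆ c′ proper i j i≢j (f , f-inj , f-hom) =
    place (does ∘ B?) (λ u → does-true (B? u)) (λ u → does-false (B? u))
    where
    D : Fin m → Set
    D = InClasses c′ i j
    -- Isolated vertices of the member may lie anywhere in H, so only the others keep their place.
    NonIsolated : Fin m → Set
    NonIsolated u = D u × ∃ λ v → D v × Adj F u v
    B? : ∀ u → Dec (NonIsolated u)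
    B? u = inClasses? c′ i j u ×-dec any? (λ v → inClasses? c′ i j v ×-dec (adj F u v Bool.≟ true))
    merged = merge i j i≢j i₀
    τ = proj₁ merged
    τ-inj : ∀ a b → τ a ≡ τ b → a ≡ b ⊎ ((a ≡ i ⊎ a ≡ j) × (b ≡ i ⊎ b ≡ j))
    τ-inj = proj₂ (proj₂ (proj₂ merged))
    τ-D : ∀ u → D u → τ (c′ u) ≡ i₀
    τ-D u (inj₁ e) = trans (cong τ e) (proj₁ (proj₂ merged))
    τ-D u (inj₂ e) = trans (cong τ e) (proj₁ (proj₂ (proj₂ merged)))

    module Place (B : Fin m → Bool) (sound : ∀ u → B u ≡ true → NonIsolated u)
                 (complete : ∀ u → B u ≡ false → ¬ NonIsolated u) where
      allowed : Fin k → Fin m → Fin n → Bool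
      allowed l u x = if B u then allowed-by G (does (l ≟ p (f u))) (f u) x else true
      W : Fin k → Fin n → Bool
      W l x = class p l x ∧ allᵇ (λ u → allowed l u x)
      B-good : ∀ u → B u ≡ true → p (f u) ≡ i₀ × γ * miss G p (f u) ≤ n
      B-good u Bu = let (du , v , dv , uv) = sound u Bu in
        proj₂ (H⊆ (f u) (f v) (f-hom u v du dv uv))
      excluded : ∀ l u → γ * count (λ x → class p l x ∧ not (allowed l u x)) ≤ n
      excluded l u with B u in Bu
      ... | true  = few-excluded G p l γ (f u) (≤-trans (m≤n+m γ N) N≤n) (proj₂ (B-good u Bu))
      ... | false = ≤-trans (≤-reflexive (trans (cong (γ *_) none) (*-zeroʳ γ))) z≤n
        where
        none : count (λ x → class p l x ∧ false) ≡ 0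
        none = trans (∑-cong λ x → cong 𝟙 (∧-zeroʳ (class p l x))) ∑-zero
      W-large : ∀ l → n ≤ 2 * c * count (W l)
      W-large l = lincomb (+-mono-≤ (*-monoʳ-≤ 2 (≤-trans (large l)
          (*-monoʳ-≤ c (count-all (class p l) (allowed l))))) ex≤) 0
        (aux n c (count (W l)) (∑ λ u → count (λ x → class p l x ∧ not (allowed l u x))))
        where
        ex≤ : 2 * c * ∑ (λ u → count (λ x → class p l x ∧ not (allowed l u x))) ≤ n
        ex≤ = *-cancelʳ-≤ _ n (suc m) (begin
          2 * c * ex * suc m          ≡⟨ swapped (2 * c) ex (suc m) ⟩
          γ * ex                      ≡⟨ ∑-*ˡ γ _ ⟨
          _                           ≤⟨ ∑-bound n (excluded l) ⟩
          m * n                       ≤⟨ *-monoˡ-≤ n (n≤1+n m) ⟩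
          suc m * n                   ≡⟨ *-comm (suc m) n ⟩
          n * suc m                   ∎)
          where
          open ≤-Reasoning
          ex = ∑ (λ u → count (λ x → class p l x ∧ not (allowed l u x)))
          swapped : ∀ a b c → a * b * c ≡ a * c * b
          swapped = solve-∀
        aux : ∀ n c x y → n + (2 * (c * (x + y)) + n) + 0 ≡ 2 * c * x + (2 * n + 2 * c * y)
        aux = solve-∀
      bl = blowup (≤-trans (m≤m+n N γ) N≤n) G p W
             (λ l x h → does-true (p x ≟ l) (proj₁ (∧-true h))) W-large sparse
      g = proj₁ bl
      respects : ∀ u v → allowed (τ (c′ v)) u (g (τ (c′ v)) (suc v)) ≡ true
      respects u v = allᵇ-elim (λ u → allowed (τ (c′ v)) u (g (τ (c′ v)) (suc v)))
        (∧-right (class p (τ (c′ v)) (g (τ (c′ v)) (suc v))) (proj₁ (proj₂ (proj₂ bl)) (τ (c′ v)) (suc v))) u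
      respects′ : ∀ u v → B u ≡ true → let x = g (τ (c′ v)) (suc v) in
        allowed-by G (does (τ (c′ v) ≟ p (f u))) (f u) x ≡ true
      respects′ u v Bu = trans (≡.sym (cong (if_then allowed-by G (does (τ (c′ v) ≟ p (f u))) (f u)
        (g (τ (c′ v)) (suc v)) else true) Bu)) (respects u v)
      B-inj : ∀ u v → B u ≡ true → B v ≡ true → f u ≡ f v → u ≡ v
      B-inj u v Bu Bv = f-inj u v (proj₁ (sound u Bu)) (proj₁ (sound v Bv))
      B-hom : ∀ u v → B u ≡ true → B v ≡ true → Adj F u v → Adj G (f u) (f v)
      B-hom u v Bu Bv uv = proj₁ (H⊆ (f u) (f v)
        (f-hom u v (proj₁ (sound u Bu)) (proj₁ (sound v Bv)) uv))
      avoid : ∀ u v → B u ≡ true → B v ≡ false → f u ≢ g (τ (c′ v)) (suc v)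
      avoid u v Bu _ e = go (τ (c′ v) ≟ p (f u)) (respects′ u v Bu)
        where
        x = g (τ (c′ v)) (suc v)
        go : (d : Dec (τ (c′ v) ≡ p (f u))) → allowed-by G (does d) (f u) x ≡ true → ⊥
        go (yes _) h = does-false (f u ≟ x) (not-true h) e
        go (no _)  h = true≢false h (trans (cong (adj G (f u)) (≡.sym e)) (irrefl G (f u)))
      attach : ∀ u v → B u ≡ true → B v ≡ false → Adj F u v → Adj G (f u) (g (τ (c′ v)) (suc v))
      attach u v Bu ¬Bv uv = go (τ (c′ v) ≟ p (f u)) (respects′ u v Bu)
        where
        x = g (τ (c′ v)) (suc v)
        du = proj₁ (sound u Bu)
        inside : D v → ⊥
        inside dv = complete v ¬Bv (dv , u , du , trans (sym F v u) uv)
        go : (d : Dec (τ (c′ v) ≡ p (f u))) → allowed-by G (does d) (f u) x ≡ true →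
             Adj G (f u) x
        go (no _)  h = h
        go (yes e) h = ⊥-elim ([ proper u v uv , inside ∘ proj₂ ]′
          (τ-inj (c′ u) (c′ v) (trans (τ-D u du) (trans (≡.sym (proj₁ (B-good u Bu))) (≡.sym e)))))
      separate : ∀ u v → B u ≡ false → B v ≡ false → Adj F u v → τ (c′ u) ≢ τ (c′ v)
      separate u v ¬Bu _ uv e = [ proper u v uv , (λ (du , dv) → complete u ¬Bu (du , v , dv , uv)) ]′
        (τ-inj (c′ u) (c′ v) e)

      contained : Contains G F
      contained = glue {F = F} G {W = W} bl B f (τ ∘ c′) B-inj B-hom avoid attach separate

    place : (B : Fin m → Bool) → (∀ u → B u ≡ true → NonIsolated u) →
            (∀ u → B u ≡ false → ¬ NonIsolated u) → ⊥
    place B sound complete = free (Place.contained B sound complete)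

-- The upper bound

class-graph : Graph n → (Fin n → Fin k) → (Fin n → Bool) → Fin k → Graph n
class-graph G p good l .adj u v = adj G u v ∧ ((class p l u ∧ good u) ∧ (class p l v ∧ good v))
class-graph G p good l .sym u v = cong₂ _∧_ (sym G u v) (∧-comm (class p l u ∧ good u) _)
class-graph G p good l .irrefl u = cong (_∧ _) (irrefl G u)

-- An inner edge joins two good vertices of one class or meets a bad vertex; ordered pairs see it
-- from both ends.
∑-inner≤ : ∀ (G : Graph n) (p : Fin n → Fin k) good {B} →
  (∀ l → edges (class-graph G p good l) ≤ B) →
  ∑ (inner G p) ≤ k * (2 * B) + 2 * ∑ (λ v → 𝟙 (not (good v)) * inner G p v)
∑-inner≤ {n} {k} G p good {B} small = begin
  (∑ λ u → ∑ λ v → e u v)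
    ≤⟨ ∑-mono (λ u → ≤-trans (∑-mono (term u)) (≤-reflexive (trans (∑-+ _ _) (cong₂ _+_ (∑-+ _ _) refl)))) ⟩
  (∑ λ u → (∑ λ v → ∑ λ l → h l u v) + (∑ λ v → bad u * e u v) + (∑ λ v → bad v * e u v))
    ≡⟨ trans (∑-+ _ _) (cong₂ _+_ (∑-+ _ _) refl) ⟩
  (∑ λ u → ∑ λ v → ∑ λ l → h l u v) + (∑ λ u → ∑ λ v → bad u * e u v) + (∑ λ u → ∑ λ v → bad v * e u v)
    ≤⟨ +-mono-≤ (+-mono-≤ good-part (≤-reflexive bad-part)) (≤-reflexive bad-part′) ⟩
  k * (2 * B) + X + X
    ≡⟨ aux (k * (2 * B)) X ⟩
  k * (2 * B) + 2 * X ∎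
  where
  open ≤-Reasoning
  aux : ∀ b x → b + x + x ≡ b + 2 * x
  aux = solve-∀
  e : Fin n → Fin n → ℕ
  e u v = 𝟙 (adj G u v ∧ does (p v ≟ p u))
  bad : Fin n → ℕ
  bad v = 𝟙 (not (good v))
  h : Fin k → Fin n → Fin n → ℕ
  h l u v = 𝟙 (adj (class-graph G p good l) u v)
  X = ∑ λ v → bad v * inner G p v
  term : ∀ u v → e u v ≤ (∑ λ l → h l u v) + bad u * e u v + bad v * e u v
  term u v = go (adj G u v) (p v ≟ p u) (good u) (good v) refl refl refl
    where
    go : ∀ a (d : Dec (p v ≡ p u)) gu gv → adj G u v ≡ a → good u ≡ gu → good v ≡ gv →
      𝟙 (a ∧ does d) ≤ (∑ λ l → h l u v) + 𝟙 (not gu) * 𝟙 (a ∧ does d) + 𝟙 (not gv) * 𝟙 (a ∧ does d)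
    go false _       _     _     _  _  _  = z≤n
    go true  (no _)  _     _     _  _  _  = z≤n
    go true  (yes _) false gv    _  _  _  = ≤-trans (m≤n+m 1 (∑ λ l → h l u v)) (m≤m+n _ (𝟙 (not gv) * 1))
    go true  (yes _) true  false _  _  _  = m≤n+m 1 ((∑ λ l → h l u v) + 0)
    go true  (yes q) true  true  uv gu gv = ≤-trans (≤-trans (≤-reflexive (cong 𝟙 (≡.sym
      (true-∧ uv (true-∧ (true-∧ (dec-true (p u ≟ p u) refl) gu) (true-∧ (dec-true (p v ≟ p u) q) gv))))))
      (term≤∑ (λ l → h l u v) (p u))) (≤-trans (m≤m+n _ 0) (m≤m+n _ 0))
  good-part : (∑ λ u → ∑ λ v → ∑ λ l → h l u v) ≤ k * (2 * B)
  good-part = begin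
    (∑ λ u → ∑ λ v → ∑ λ l → h l u v)  ≡⟨ ∑-cong (λ u → ∑-swap (λ v l → h l u v)) ⟩
    (∑ λ u → ∑ λ l → ∑ λ v → h l u v)  ≡⟨ ∑-swap _ ⟩
    (∑ λ l → ∑ (deg (class-graph G p good l))) ≤⟨ ∑-bound (2 * B) (λ l → begin
      ∑ (deg (class-graph G p good l))  ≡⟨ handshake (class-graph G p good l) ⟨
      _                                 ≤⟨ +-mono-≤ (small l) (≤-trans (small l) (m≤m+n B 0)) ⟩
      2 * B                             ∎) ⟩
    k * (2 * B) ∎
  bad-part : (∑ λ u → ∑ λ v → bad u * e u v) ≡ X
  bad-part = ∑-cong λ u → ∑-*ˡ (bad u) (e u)
  bad-part′ : (∑ λ u → ∑ λ v → bad v * e u v) ≡ X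
  bad-part′ = trans (∑-swap _) (∑-cong λ v → trans (∑-*ˡ (bad v) _) (cong (bad v *_) (∑-cong λ u →
    cong 𝟙 (cong₂ _∧_ (sym G u v) (does-sym (p v) (p u))))))

-- In the units of `balance` a missing pair pays 1 and an inner one costs at most `ρ`. An atypical
-- vertex misses more than `n / γ` pairs, so by the choice of `β` it pays for `2 * ρ` times its
-- inner degree unless it is big. The 2 answers the double count in `∑-inner≤`.
module Estimate {n k} (G : Graph n) (p : Fin n → Fin (suc (suc k))) (s c γ B L : ℕ)
  (1≤c : 1 ≤ c) (1≤γ : 1 ≤ γ) (1≤n : 1 ≤ n) (large : ∀ l → n ≤ c * size p l) where

  ρ β : ℕ
  ρ = c ^ s * suc s
  β = 2 * ρ * γ

  typical big : Fin n → Bool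
  typical v = does (γ * miss G p v ≤? n)
  big v = does (n ≤? β * inner G p v)

  private instance
    n^s≢0 : NonZero (n ^ s)
    n^s≢0 = >-nonZero (m^n>0 n {{>-nonZero 1≤n}} s)
    c^s≢0 : NonZero (c ^ s)
    c^s≢0 = >-nonZero (m^n>0 c {{>-nonZero 1≤c}} s)
    γ≢0 : NonZero γ
    γ≢0 = >-nonZero 1≤γ

  balance : c ^ s * power-sum (suc s) (deg G) + ∑ (miss G p) * n ^ s ≤
            c ^ s * power-sum (suc s) (crossing p) + ρ * ∑ (inner G p) * n ^ s
  balance = ≤-trans (power-sum-balance G p s c 1≤c large) (≤-reflexive
    (aux (c ^ s * power-sum (suc s) (crossing p)) (c ^ s) (suc s) (∑ (inner G p)) (n ^ s)))
    where
    aux : ∀ x w r I q → x + w * (r * I * q) ≡ x + w * r * I * q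
    aux = solve-∀

  -- Domination cancels the power sums in `balance`. Thus few inner edges imply few missing pairs,
  -- as the embeddings require.
  ∑-miss≤ : power-sum (suc s) (crossing p) ≤ power-sum (suc s) (deg G) →
            ∑ (miss G p) ≤ ρ * ∑ (inner G p)
  ∑-miss≤ dom = *-cancelʳ-≤ _ _ (n ^ s) (lincomb (+-mono-≤ balance (*-monoʳ-≤ (c ^ s) dom)) 0
    (aux (∑ (miss G p) * n ^ s) (ρ * ∑ (inner G p) * n ^ s) (c ^ s * power-sum (suc s) (deg G))
         (c ^ s * power-sum (suc s) (crossing p))))
    where
    aux : ∀ x y d c → x + (c + y + d) + 0 ≡ y + (d + x + c)
    aux = solve-∀

  atypical-term : ∀ v → 2 * ρ * (𝟙 (not (typical v)) * inner G p v) ≤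
                        miss G p v + 2 * ρ * n * 𝟙 (big v)
  atypical-term v = go (γ * miss G p v ≤? n) (n ≤? β * inner G p v)
    where
    I = inner G p v
    go : (t : Dec (γ * miss G p v ≤ n)) (b : Dec (n ≤ β * I)) →
      2 * ρ * (𝟙 (not (does t)) * I) ≤ miss G p v + 2 * ρ * n * 𝟙 (does b)
    go (yes _) _       = ≤-trans (≤-reflexive (*-zeroʳ (2 * ρ))) z≤n
    go (no _)  (yes _) = ≤-trans (*-monoʳ-≤ (2 * ρ) (≤-trans (≤-reflexive (+-identityʳ I))
                           (count≤n (λ w → adj G v w ∧ does (p w ≟ p v)))))
                         (≤-trans (≤-reflexive (≡.sym (*-identityʳ (2 * ρ * n)))) (m≤n+m _ _))
    go (no ¬t) (no ¬b) = ≤-trans (≤-trans (≤-reflexive (cong (2 * ρ *_) (+-identityʳ I)))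
      (*-cancelˡ-≤ γ (begin
        γ * (2 * ρ * I)   ≡⟨ aux γ (2 * ρ) I ⟩
        β * I             ≤⟨ <⇒≤ (≰⇒> ¬b) ⟩
        n                 ≤⟨ <⇒≤ (≰⇒> ¬t) ⟩
        γ * miss G p v    ∎))) (m≤m+n _ _)
      where
      open ≤-Reasoning
      aux : ∀ g r i → g * (r * i) ≡ r * g * i
      aux = solve-∀

  -- The missing pairs pay for the atypical vertices that are not big and cancel completely. What
  -- remains is `2 * B` for each class and `n` for each big vertex, the latter bounded by `few-big`.
  upper-estimate : (∀ l → edges (class-graph G p typical l) ≤ B) → n * count big ≤ 2 * L * B →
    power-sum (suc s) (deg G) ≤
    power-sum (suc s) (crossing p) + suc s * (2 * suc (suc k) + 4 * L) * (B * n ^ s)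
  upper-estimate small few-big = *-cancelˡ-≤ (c ^ s) (lincomb
    (+-mono-≤ balance (*-monoˡ-≤ (n ^ s) (+-mono-≤ (*-monoʳ-≤ ρ (∑-inner≤ G p typical small))
      (+-mono-≤ atypical (*-monoʳ-≤ (2 * ρ) few-big))))) 0
    (aux (c ^ s) (suc s) (power-sum (suc s) (deg G)) (power-sum (suc s) (crossing p)) (∑ (miss G p))
      (n ^ s) (∑ (inner G p)) (suc (suc k)) B (∑ λ v → 𝟙 (not (typical v)) * inner G p v) n (count big) L))
    where
    atypical : 2 * ρ * ∑ (λ v → 𝟙 (not (typical v)) * inner G p v) ≤ ∑ (miss G p) + 2 * ρ * (n * count big)
    atypical = begin
      _ ≡⟨ ∑-*ˡ (2 * ρ) _ ⟨
      _ ≤⟨ ∑-mono atypical-term ⟩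
      _ ≡⟨ ∑-+ _ _ ⟩
      _ ≡⟨ cong (∑ (miss G p) +_) (trans (∑-*ˡ (2 * ρ * n) _) (*-assoc (2 * ρ) n _)) ⟩
      ∑ (miss G p) + 2 * ρ * (n * count big) ∎
      where open ≤-Reasoning
    aux : ∀ w r PD PC M q I k B X n g L →
      w * PD + (w * PC + w * r * I * q + (w * r * (k * (2 * B) + 2 * X) + (M + 2 * (w * r) * (n * g) + 2 * (w * r) * (2 * L * B))) * q) + 0
      ≡ w * (PC + r * (2 * k + 4 * L) * (B * q)) + (w * PD + M * q + (w * r * I + (2 * (w * r) * X + 2 * (w * r) * (n * g))) * q)
    aux = solve-∀

FewBigVertices : (m k β κ L N : ℕ) → Set
FewBigVertices m k β κ L N = ∀ {n} → N ≤ n → {F : Graph m} →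
  Colourable F (suc k) → (G : Graph n) → Free G F → (p : Fin n → Fin k) → LocallyOptimal G p →
  κ * ∑ (miss G p) ≤ n * n → count (λ v → does (n ≤? β * inner G p v)) ≤ L

-- By local optimality a big vertex has linearly many neighbours in all classes, hence a rich link.
-- Among `L` such vertices some share a link and serve as an additional part of a blow-up, which has
-- enough parts to contain `F`.
few-big-vertices : ∀ {m k β κ C L N} → TransversalCliques k β κ C → RichLinksMeet k m C L N →
  FewBigVertices m k β κ L (suc N)
few-big-vertices {m} {k} {β} {κ} {C} {L} {N} cliques link {n} N<n {F} col G free p opt sparse = ≮⇒≥ λ many → many-big (enumerate big (<⇒≤ many))
  where
  big : Fin n → Bool
  big v = does (n ≤? β * inner G p v)
  many-big : ¬ Σ (Fin L → Fin n) λ v → Injective v × (∀ i → big (v i) ≡ true)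
  many-big (v , v-inj , v-big) = free (blowup-contains {F = F} G {W = W} col
      (extend-blowup G W v v-inj (λ _ → refl) (link (≤-trans (n≤1+n N) N<n) G (class p) v rich)))
      where
      W : Fin (suc k) → Fin n → Bool
      W zero    _ = true
      W (suc l) = class p l
      rich : ∀ i → n ^ k ≤ C * cnt k (isClique G (λ l y → class p l y ∧ adj G (v i) y))
      rich i = cliques (≤-trans (s≤s z≤n) N<n) G (missing G p) (λ l y → class p l y ∧ adj G (v i) y)
        (different-classes G p _ λ l x h → does-true (p x ≟ l) (proj₁ (∧-true h)))
        (λ l → ≤-trans (does-true (n ≤? β * inner G p (v i)) (v-big i)) (*-monoʳ-≤ β
          (≤-trans (opt (v i) l) (≤-reflexive (count-cong λ y → ∧-comm (adj G (v i) y) _)))))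
        sparse

BigVertexStar : (m k β κ N : ℕ) → Set
BigVertexStar m k β κ N = ∀ {n} → N ≤ n → {F : Graph m} (G : Graph n) →
  Free G F → (p : Fin n → Fin (suc k)) → LocallyOptimal G p → κ * ∑ (miss G p) ≤ n * n →
  ∀ v → n ≤ β * inner G p v → ∀ n′ → DFree (star n′) F (suc k)

-- The neighbours of a big vertex fill a linear part of every class and span the blow-up that
-- `star-free` asks for.
big-vertex-star : ∀ {m k β κ N} → ClassBlowup (suc k) β m κ N → BigVertexStar m k β κ N
big-vertex-star {β = β} blowup {n} N≤n {F} G free p opt sparse v big =
  star-free {F = F} G v {W = λ l x → class p l x ∧ adj G v x} free
  (blowup N≤n G p (λ l x → class p l x ∧ adj G v x) (λ l x h → does-true (p x ≟ l) (proj₁ (∧-true h)))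
    (λ l → ≤-trans big (*-monoʳ-≤ β (≤-trans (opt v l)
      (≤-reflexive (count-cong λ y → ∧-comm (adj G v y) _))))) sparse)
  (λ l x → ∧-right (class p l x))

UpperBound : (m k s c C N : ℕ) → Set
UpperBound m k s c C N = ∀ {n} → N ≤ n → {F : Graph m} → Colourable F (suc k) →
  (G : Graph n) → Free G F → Dominating k (suc s) G →
  ∀ {B} → (∀ (H : Graph n) → DFree H F k → edges H ≤ B) →
  Σ (Fin n → Fin k) λ p → (∀ l → n ≤ c * size p l) ×
    power-sum (suc s) (deg G) ≤ power-sum (suc s) (crossing p) + C * (B * n ^ s)

star-bound : ∀ {F : Graph m} {B} → 2 ≤ n → (∀ (H : Graph n) → DFree H F k → edges H ≤ B) →
  (∀ n′ → DFree (star n′) F k) → n ≤ 2 * B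
star-bound {n = suc (suc n)} {B = B} (s≤s (s≤s z≤n)) extremal free = begin
  2 + n                  ≤⟨ m≤m+n (2 + n) n ⟩
  2 + n + n              ≡⟨ aux n ⟩
  2 * suc n              ≤⟨ *-monoʳ-≤ 2 (≤-trans (edges-star (suc n)) (extremal (star (suc n)) (free (suc n)))) ⟩
  2 * B                  ∎
  where
  open ≤-Reasoning
  aux : ∀ n → 2 + n + n ≡ 2 * (1 + n)
  aux = solve-∀

upper-bound : ∀ {m k s c δ₁ N₁ κ₁ N₂ κ₂ N₃ κ₃ L N₄ a 1≤a N₅} → 1 ≤ c →
  let K = suc (suc k); ρ = c ^ s * suc s; β = 2 * ρ * (2 * c * suc m) in
  LargeParts (suc k) s c δ₁ N₁ → ClassGraphFree m K c κ₁ N₂ → BigVertexStar m (suc k) β κ₂ N₃ →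
  FewBigVertices m K β κ₃ L N₄ → NearPartite (suc k) s (δ₁ + (κ₁ + κ₂ + κ₃) * ρ) a 1≤a →
  CliquesForceBlowup (suc K) m (a ^ suc K) N₅ →
  UpperBound m K s c (suc s * (2 * K + 4 * L)) (2 + (N₁ + N₂ + N₃ + N₄ + N₅))
upper-bound {m} {k} {s} {c} {δ₁} {N₁} {κ₁} {N₂} {κ₂} {N₃} {κ₃} {L} {N₄} {a} {1≤a} {N₅} 1≤c
  large-parts class-free big-star few-big near blowup {n} N≤n {F} col G free dom {B} extremal =
  p , large , E.upper-estimate small few
  where
  K = suc (suc k)
  ρ = c ^ s * suc s
  -- The first summand yields linear classes; the second, through `∑-miss≤`, the density of missing
  -- pairs for all three embeddings.
  δ = δ₁ + (κ₁ + κ₂ + κ₃) * ρ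
  γ = 2 * c * suc m
  1≤γ : 1 ≤ γ
  1≤γ = *-mono-≤ (≤-trans 1≤c (m≤m+n c _)) (s≤s z≤n)
  N≤ : N₁ + N₂ + N₃ + N₄ + N₅ ≤ n
  N≤ = ≤-trans (m≤n+m _ 2) N≤n
  N₄≤ : N₁ + N₂ + N₃ + N₄ ≤ n
  N₄≤ = m+n≤o⇒m≤o (N₁ + N₂ + N₃ + N₄) N≤
  N₃≤ : N₁ + N₂ + N₃ ≤ n
  N₃≤ = m+n≤o⇒m≤o (N₁ + N₂ + N₃) N₄≤
  N₂≤ : N₁ + N₂ ≤ n
  N₂≤ = m+n≤o⇒m≤o (N₁ + N₂) N₃≤
  2≤n : 2 ≤ n
  2≤n = m+n≤o⇒m≤o 2 N≤n
  1≤n : 1 ≤ n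
  1≤n = ≤-trans (s≤s z≤n) 2≤n
  poor : ¬ Majorisation.Rich G a 1≤a (suc K) (λ _ → true)
  poor rich = free (blowup-contains {F = F} G {W = λ _ _ → true} col
    (blowup (m+n≤o⇒n≤o (N₁ + N₂ + N₃ + N₄) N≤) G (λ _ _ → true) rich))
  start = near 1≤n G dom poor
  improved = local-optimum G (proj₁ start)
  p = proj₁ improved
  opt : LocallyOptimal G p
  opt = proj₂ (proj₂ improved)
  I = ∑ (inner G p)
  sparse : suc δ * I ≤ n * n
  sparse = ≤-trans (*-monoʳ-≤ (suc δ) (proj₁ (proj₂ improved))) (proj₂ start)
  -- Domination holds for every partition and local improvement only lowers the inner sum, so the
  -- bound applies to the improved partition.
  large : ∀ l → n ≤ c * size p l
  large = large-parts (m+n≤o⇒m≤o N₁ N₂≤) G p dom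
    (≤-trans (*-monoˡ-≤ I (m≤n⇒m≤1+n (m≤m+n δ₁ ((κ₁ + κ₂ + κ₃) * ρ)))) sparse)
  module E = Estimate G p s c γ B L 1≤c 1≤γ 1≤n large
  miss-sparse : ∀ κ → κ ≤ κ₁ + κ₂ + κ₃ → κ * ∑ (miss G p) ≤ n * n
  miss-sparse κ κ≤ = begin
    κ * ∑ (miss G p)              ≤⟨ *-mono-≤ κ≤ (E.∑-miss≤ (dom p)) ⟩
    (κ₁ + κ₂ + κ₃) * (ρ * I)      ≡⟨ *-assoc (κ₁ + κ₂ + κ₃) ρ I ⟨
    (κ₁ + κ₂ + κ₃) * ρ * I        ≤⟨ *-monoˡ-≤ I (m≤n⇒m≤1+n (m≤n+m ((κ₁ + κ₂ + κ₃) * ρ) δ₁)) ⟩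
    suc δ * I                     ≤⟨ sparse ⟩
    n * n                         ∎
    where open ≤-Reasoning
  small : ∀ l → edges (class-graph G p E.typical l) ≤ B
  small l = extremal H (class-free (m+n≤o⇒n≤o N₁ N₂≤) {F} G p free large
    (miss-sparse κ₁ (≤-trans (m≤m+n κ₁ κ₂) (m≤m+n _ κ₃))) l H λ u v uv →
      let (Guv , uv∈) = ∧-true {adj G u v} uv
          (pu , tu)   = ∧-true {class p l u} (proj₁ (∧-true uv∈))
      in Guv , does-true (p u ≟ l) pu , does-true (γ * miss G p u ≤? n) tu)
    where H = class-graph G p E.typical l
  count-big : count E.big ≤ L
  count-big = few-big (m+n≤o⇒n≤o (N₁ + N₂ + N₃) N₄≤) {F} col G free p opt (miss-sparse κ₃ (m≤n+m κ₃ _))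
  -- `B` may vanish, as for complete `F`; it is the existence of a big vertex that makes `n ≤ 2 * B`
  -- available.
  few : n * count E.big ≤ 2 * L * B
  few = go (1 ≤? count E.big)
    where
    open ≤-Reasoning
    go : Dec (1 ≤ count E.big) → n * count E.big ≤ 2 * L * B
    go (no none) = ≤-trans (*-monoʳ-≤ n (≤-pred (≰⇒> none))) (≤-trans (≤-reflexive (*-zeroʳ n)) z≤n)
    go (yes some) = let (v , v-big) = witness E.big some in begin
      n * count E.big   ≤⟨ *-mono-≤ (star-bound {F = F} 2≤n extremal
                             (big-star (m+n≤o⇒n≤o (N₁ + N₂) N₃≤) {F} G free p opt
                               (miss-sparse κ₂ (≤-trans (m≤n+m κ₂ κ₁) (m≤m+n _ κ₃)))
                               v (does-true (n ≤? E.β * inner G p v) v-big))) count-big ⟩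
      2 * B * L         ≡⟨ aux B L ⟩
      2 * L * B         ∎
      where
      aux : ∀ B L → 2 * B * L ≡ 2 * L * B
      aux = solve-∀

upper-constants : ∀ m k s → Σ ℕ λ c → 1 ≤ c × Σ ℕ λ C → Σ ℕ λ N → UpperBound m (suc (suc k)) s c C N
upper-constants m k s = step₁ (large-parts (suc k) s)
  where
  K = suc (suc k)
  Result = Σ ℕ λ c → 1 ≤ c × Σ ℕ λ C → Σ ℕ λ N → UpperBound m K s c C N
  step₁ : (Σ ℕ λ c → 1 ≤ c × Σ ℕ λ δ → Σ ℕ λ N → LargeParts (suc k) s c δ N) → Result
  step₁ (c , 1≤c , δ₁ , N₁ , large) =
    step₂ (class-blowup K (2 * c) m) (class-blowup K β m) (transversal-cliques K β)
    where
    ρ = c ^ s * suc s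
    β = 2 * ρ * (2 * c * suc m)
    step₂ : (Σ ℕ λ κ → Σ ℕ λ N → ClassBlowup K (2 * c) m κ N) →
            (Σ ℕ λ κ → Σ ℕ λ N → ClassBlowup K β m κ N) →
            (Σ ℕ λ κ → Σ ℕ λ C → TransversalCliques K β κ C) → Result
    step₂ (κ₁ , N₂ , blowup₁) (κ₂ , N₃ , blowup₂) (κ₃ , C , cliques) =
      step₃ (common-link K (cliques-force-blowup K) m C)
            (near-partite (suc k) s (δ₁ + (κ₁ + κ₂ + κ₃) * ρ))
      where
      step₃ : (Σ ℕ λ L → Σ ℕ λ N → RichLinksMeet K m C L N) →
              (Σ ℕ λ a → Σ (1 ≤ a) (NearPartite (suc k) s (δ₁ + (κ₁ + κ₂ + κ₃) * ρ) a)) → Result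
      step₃ (L , N₄ , link) (a , 1≤a , near) = step₄ (cliques-force-blowup (suc K) m (a ^ suc K))
        where
        step₄ : ∃ (CliquesForceBlowup (suc K) m (a ^ suc K)) → Result
        step₄ (N₅ , blowup) = c , 1≤c , suc s * (2 * K + 4 * L) ,
          2 + (N₁ + (N₂ + 2 * c * suc m) + N₃ + suc N₄ + N₅) ,
          upper-bound {m} {k} {s} {c} {δ₁} {N₁} {κ₁} {N₂ + 2 * c * suc m} {κ₂} {N₃} {κ₃} {L} {suc N₄} {a} {1≤a} {N₅}
            1≤c large (class-graph-free {m} {K} {c} {κ₁} {N₂} blowup₁)
            (big-vertex-star {m} {suc k} {β} {κ₂} {N₃} blowup₂)
            (few-big-vertices {m} {K} {β} {κ₃} {C} {L} {N₄} cliques link) near blowup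

-- The lower bound

cut : Graph n → (Fin n → Fin k) → Graph n
cut G p .adj u v  = adj G u v ∧ not (does (p v ≟ p u))
cut G p .sym u v  = cong₂ _∧_ (sym G u v) (cong not (does-sym (p v) (p u)))
cut G p .irrefl u = cong (_∧ not (does (p u ≟ p u))) (irrefl G u)

-- At a local optimum each vertex has at least half of its neighbours across. The degree sum counts
-- each edge of the cut twice, which makes up for the half.
edges≤cut : ∀ (H : Graph n) → Σ (Fin n → Fin 2) λ b → edges H ≤ ∑ (deg (cut H b))
edges≤cut H with local-optimum H (λ _ → zero {1})
... | b , _ , opt = b , *-cancelˡ-≤ 2 (begin
    2 * edges H               ≡⟨ cong (edges H +_) (+-identityʳ (edges H)) ⟩
    edges H + edges H         ≡⟨ handshake H ⟩
    ∑ (deg H)                 ≤⟨ ∑-mono half ⟩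
    ∑ (λ v → 2 * deg (cut H b) v) ≡⟨ ∑-*ˡ 2 _ ⟩
    2 * ∑ (deg (cut H b))     ∎)
  where
  open ≤-Reasoning
  other : ∀ (x : Fin 2) → ∃ λ l → x ≢ l
  other zero    = suc zero , λ ()
  other (suc _) = zero , λ ()
  half : ∀ v → deg H v ≤ 2 * deg (cut H b) v
  half v = begin
    deg H v                             ≡⟨ count-split (adj H v) (λ w → does (b w ≟ b v)) ⟩
    inner H b v + deg (cut H b) v       ≤⟨ +-monoˡ-≤ _ inner≤ ⟩
    deg (cut H b) v + deg (cut H b) v   ≡⟨ cong (deg (cut H b) v +_) (+-identityʳ _) ⟨
    2 * deg (cut H b) v                 ∎
    where
    inner≤ : inner H b v ≤ deg (cut H b) v
    inner≤ = let (l , b≢l) = other (b v) in ≤-trans (opt v l) (count-mono λ w h →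
      true-∧ (proj₁ (∧-true h)) (true-not (dec-false (b w ≟ b v) λ e →
        b≢l (trans (≡.sym e) (does-true (b w ≟ l) (∧-right (adj H v w) h))))))

edgesWithin : Graph n → (Fin n → Bool) → ℕ
edgesWithin G S = ∑-on S (degreeWithin G S)

min-degree-vertex : ∀ (G : Graph n) S → 1 ≤ count S →
  ∃ λ v → S v ≡ true × count S * degreeWithin G S v ≤ edgesWithin G S
min-degree-vertex {n} G S nonempty
  with any? (λ v → (S v Bool.≟ true) ×-dec (count S * degreeWithin G S v ≤? edgesWithin G S))
... | yes found = found
... | no none = ⊥-elim (<-irrefl refl (begin-strict
    count S * edgesWithin G S
      <⟨ *-monoʳ-< (count S) {{>-nonZero nonempty}} (n<1+n _) ⟩
    count S * suc (edgesWithin G S)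
      ≡⟨ ∑-on-const S _ ⟨
    ∑-on S (λ _ → suc (edgesWithin G S))
      ≤⟨ ∑-on-mono S (λ v Sv → ≰⇒> λ le → none (v , Sv , le)) ⟩
    ∑-on S (λ v → count S * degreeWithin G S v)
      ≡⟨ trans (∑-cong λ v → aux (𝟙 (S v)) (count S) (degreeWithin G S v)) (∑-*ˡ (count S) _) ⟩
    count S * edgesWithin G S ∎))
  where
  open ≤-Reasoning
  aux : ∀ a b c → a * (b * c) ≡ b * (a * c)
  aux = solve-∀

module Delete {n} (G : Graph n) (S : Fin n → Bool) (v : Fin n) (Sv : S v ≡ true) where
  S′ : Fin n → Bool
  S′ u = S u ∧ not (does (v ≟ u))

  at-v : ∀ f → ∑-on (λ u → S u ∧ does (v ≟ u)) f ≡ f v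
  at-v f = trans (∑-cong λ u → cong (λ b → 𝟙 b * f u) (drop u (v ≟ u))) (∑-pick f v)
    where
    drop : ∀ u (d : Dec (v ≡ u)) → S u ∧ does d ≡ does d
    drop u (yes refl) = true-∧ Sv refl
    drop u (no _)     = Bool.∧-zeroʳ (S u)

  count-S′ : count S ≡ suc (count S′)
  count-S′ = begin
    count S                                            ≡⟨ ones S ⟩
    ∑-on S (λ _ → 1)                                   ≡⟨ ∑-on-split S (λ u → does (v ≟ u)) (λ _ → 1) ⟩
    ∑-on (λ u → S u ∧ does (v ≟ u)) (λ _ → 1) + ∑-on S′ (λ _ → 1)
                                                       ≡⟨ cong₂ _+_ (at-v (λ _ → 1)) (≡.sym (ones S′)) ⟩
    suc (count S′)                                     ∎
    where
    open ≡.≡-Reasoning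
    ones : ∀ A → count A ≡ ∑-on A (λ _ → 1)
    ones A = ∑-cong λ u → ≡.sym (*-identityʳ (𝟙 (A u)))

  degree-drop : ∀ u → degreeWithin G S u ≤ degreeWithin G S′ u + 𝟙 (adj G u v)
  degree-drop u = begin
    degreeWithin G S u
      ≤⟨ count-∪ {Q = λ w → S′ w ∧ adj G u w} {R = λ w → does (v ≟ w) ∧ adj G u w} split ⟩
    degreeWithin G S′ u + count (λ w → does (v ≟ w) ∧ adj G u w)
      ≡⟨ cong (degreeWithin G S′ u +_) (trans (∑-cong λ w → 𝟙-∧ (does (v ≟ w)) (adj G u w))
           (∑-pick (λ w → 𝟙 (adj G u w)) v)) ⟩
    degreeWithin G S′ u + 𝟙 (adj G u v) ∎
    where
    open ≤-Reasoning
    split : ∀ w → S w ∧ adj G u w ≡ true → S′ w ∧ adj G u w ≡ true ⊎ does (v ≟ w) ∧ adj G u w ≡ true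
    split w h = go (v ≟ w)
      where
      go : (d : Dec (v ≡ w)) →
        (S w ∧ not (does d)) ∧ adj G u w ≡ true ⊎ does d ∧ adj G u w ≡ true
      go (yes _) = inj₂ (∧-right (S w) h)
      go (no _)  = inj₁ (true-∧ (true-∧ (proj₁ (∧-true h)) refl) (∧-right (S w) h))

  edges-drop : edgesWithin G S ≤ edgesWithin G S′ + 2 * degreeWithin G S v
  edges-drop = begin
    edgesWithin G S
      ≡⟨ ∑-on-split S (λ u → does (v ≟ u)) (degreeWithin G S) ⟩
    ∑-on (λ u → S u ∧ does (v ≟ u)) (degreeWithin G S) + ∑-on S′ (degreeWithin G S)
      ≤⟨ +-mono-≤ (≤-reflexive (at-v (degreeWithin G S))) (∑-on-mono S′ λ u _ → degree-drop u) ⟩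
    degreeWithin G S v + ∑-on S′ (λ u → degreeWithin G S′ u + 𝟙 (adj G u v))
      ≡⟨ cong (degreeWithin G S v +_) (∑-on-+ S′ _ _) ⟩
    degreeWithin G S v + (edgesWithin G S′ + ∑-on S′ (λ u → 𝟙 (adj G u v)))
      ≤⟨ +-monoʳ-≤ (degreeWithin G S v) (+-monoʳ-≤ (edgesWithin G S′) (begin
        ∑-on S′ (λ u → 𝟙 (adj G u v))
          ≡⟨ ∑-cong (λ u → trans (≡.sym (𝟙-∧ (S′ u) (adj G u v))) (cong (λ b → 𝟙 (S′ u ∧ b)) (sym G u v))) ⟩
        degreeWithin G S′ v
          ≤⟨ count-mono (λ u h → true-∧ (proj₁ (∧-true {S u} (proj₁ (∧-true h)))) (∧-right (S′ u) h)) ⟩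
        degreeWithin G S v ∎)) ⟩
    degreeWithin G S v + (edgesWithin G S′ + degreeWithin G S v)
      ≡⟨ aux (degreeWithin G S v) (edgesWithin G S′) ⟩
    edgesWithin G S′ + 2 * degreeWithin G S v ∎
    where
    open ≤-Reasoning
    aux : ∀ d e → d + (e + d) ≡ e + 2 * d
    aux = solve-∀

-- Deleting vertices of minimum degree does not decrease the density.
dense-subset : ∀ (G : Graph n) d s → d + s ≡ n →
  Σ (Fin n → Bool) λ S → count S ≡ s × ∑ (deg G) * (s * (s ∸ 1)) ≤ edgesWithin G S * (n * n)
dense-subset {n} G zero s refl = (λ _ → true) , count-true , *-mono-≤
  (≤-reflexive (∑-cong λ v → ≡.sym (+-identityʳ (deg G v)))) (*-monoʳ-≤ n (m∸n≤m n 1))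
dense-subset {n} G (suc d) s eq with dense-subset G d (suc s) (trans (+-suc d s) eq)
... | S , count≡ , dense = remove (min-degree-vertex G S (≤-trans (s≤s z≤n) (≤-reflexive (≡.sym count≡))))
  where
  E₀ = ∑ (deg G)
  remove : (∃ λ v → S v ≡ true × count S * degreeWithin G S v ≤ edgesWithin G S) →
    Σ (Fin n → Bool) λ S → count S ≡ s × E₀ * (s * (s ∸ 1)) ≤ edgesWithin G S * (n * n)
  remove (v , Sv , small) = D.S′ , suc-injective (trans (≡.sym D.count-S′) count≡) , dense′ s refl
    where
    module D = Delete G S v Sv
    dense′ : ∀ t → t ≡ s → E₀ * (t * (t ∸ 1)) ≤ edgesWithin G D.S′ * (n * n)
    dense′ zero    _    = ≤-trans (≤-reflexive (*-zeroʳ E₀)) z≤n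
    -- Removing a vertex of minimum degree keeps at least the fraction t/(t + 2) of the degree sum,
    -- exactly the ratio by which s(s - 1) shrinks.
    dense′ (suc t) refl = *-cancelˡ-≤ (suc (suc t)) (lincomb
      (+-mono-≤ (*-monoʳ-≤ t dense)
        (*-monoˡ-≤ (n * n) (+-mono-≤ (*-monoʳ-≤ (2 + t) D.edges-drop)
          (*-monoʳ-≤ 2 (≤-trans (≤-reflexive (cong (_* degreeWithin G S v) (≡.sym count≡))) small))))) 0
      (aux t E₀ (edgesWithin G D.S′) (n * n) (edgesWithin G S) (degreeWithin G S v)))
      where
      aux : ∀ t E e q f g →
        (2 + t) * (E * ((1 + t) * t)) + (t * (f * q) + ((2 + t) * (e + 2 * g) + 2 * f) * q) + 0
        ≡ (2 + t) * (e * q) + (t * (E * ((2 + t) * (1 + t))) + ((2 + t) * f + 2 * ((2 + t) * g)) * q)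
      aux = solve-∀

crossing-permute : ∀ (p : Fin n → Fin k) (π : Permutation′ n) u →
  crossing (p ∘ (π ⟨$⟩ʳ_)) u ≡ crossing p (π ⟨$⟩ʳ u)
crossing-permute p π u = ≡.sym (∑-permute _ π)

size-permute : ∀ (p : Fin n → Fin k) (π : Permutation′ n) l → size (p ∘ (π ⟨$⟩ʳ_)) l ≡ size p l
size-permute p π l = ≡.sym (∑-permute _ π)

module Fill {n k} (q : Fin n → Fin k) (l₀ : Fin k) (H : Graph n) (b : Fin n → Fin 2) where

  S : Fin n → Bool
  S = class q l₀

  filled : Graph n
  filled .adj u v  = not (does (q v ≟ q u)) ∨ (S u ∧ (S v ∧ adj (cut H b) u v))
  filled .sym u v  = cong₂ _∨_ (cong not (does-sym (q v) (q u))) (trans (swap-∧ (S u) (S v) _)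
    (cong (λ e → S v ∧ (S u ∧ e)) (sym (cut H b) u v)))
    where
    swap-∧ : ∀ x y z → x ∧ (y ∧ z) ≡ y ∧ (x ∧ z)
    swap-∧ x y z = trans (≡.sym (∧-assoc x y z)) (trans (cong (_∧ z) (∧-comm x y)) (∧-assoc y x z))
  filled .irrefl u = cong₂ _∨_ (cong not (dec-true (q u ≟ q u) refl))
    (trans (cong (λ e → S u ∧ (S u ∧ e)) (irrefl (cut H b) u))
      (trans (cong (S u ∧_) (∧-zeroʳ (S u))) (∧-zeroʳ (S u))))

  extra : Fin n → ℕ
  extra u = 𝟙 (S u) * degreeWithin (cut H b) S u

  deg-filled : ∀ u → crossing q u + extra u ≤ deg filled u
  deg-filled u = begin
    crossing q u + extra u
      ≡⟨ cong (crossing q u +_) (∑-*ˡ (𝟙 (S u)) _) ⟨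
    _ ≡⟨ ∑-+ _ _ ⟨
    _ ≤⟨ ∑-mono (λ v → pointwise v (q v ≟ q u) (S u) (S v) refl refl) ⟩
    deg filled u ∎
    where
    open ≤-Reasoning
    pointwise : ∀ v (d : Dec (q v ≡ q u)) su sv → S u ≡ su → S v ≡ sv →
      𝟙 (not (does d)) + 𝟙 su * 𝟙 (sv ∧ adj (cut H b) u v) ≤
      𝟙 (not (does d) ∨ (su ∧ (sv ∧ adj (cut H b) u v)))
    pointwise v (yes _) false sv    _  _  = z≤n
    pointwise v (yes _) true  sv    _  _  = ≤-reflexive (+-identityʳ _)
    pointwise v (no _)  false sv    _  _  = ≤-refl
    pointwise v (no _)  true  false _  _  = ≤-refl
    pointwise v (no ¬e) true  true  Su Sv = contradiction
      (trans (does-true (q v ≟ l₀) Sv) (≡.sym (does-true (q u ≟ l₀) Su))) ¬e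

  filled-edge : ∀ u v → q v ≡ q u → Adj filled u v → S u ≡ true × S v ≡ true × Adj H u v × b v ≢ b u
  filled-edge u v e uv =
    let h = trans (≡.sym (cong (_∨ (S u ∧ (S v ∧ adj (cut H b) u v)))
              (cong not (dec-true (q v ≟ q u) e)))) uv
        h₂ = ∧-right (S u) h
        h₃ = ∧-right (S v) h₂
    in proj₁ (∧-true {S u} h) , proj₁ (∧-true {S v} h₂) , proj₁ (∧-true {adj H u v} h₃) ,
       does-false (b v ≟ b u) (not-true (∧-right (adj H u v) h₃))

  -- A copy of F would be coloured by the classes, with l₀ split in two along b.
  filled-free : ∀ {F : Graph m} → DFree H F k → Free filled F
  -- Colour `zero` is one side of the class `l₀`, and `suc l₀` the other.
  filled-free {m} {F} dfree (f , f-inj , f-hom) = dfree c proper zero (suc l₀) (λ ())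
    (f , (λ u v _ _ → f-inj u v) , λ u v u∈ v∈ uv →
      proj₁ (proj₂ (proj₂ (filled-edge (f u) (f v) (trans (q-in v v∈) (≡.sym (q-in u u∈))) (f-hom u v uv)))))
    where
    side : Fin n → Bool
    side x = S x ∧ does (b x ≟ zero)
    colour : Fin n → Fin (suc k)
    colour x = if side x then zero else suc (q x)
    c : Fin m → Fin (suc k)
    c = colour ∘ f
    colour-zero : ∀ x → colour x ≡ zero → side x ≡ true
    colour-zero x e with side x
    ... | true = refl
    colour-suc : ∀ x l → colour x ≡ suc l → side x ≡ false × q x ≡ l
    colour-suc x l e with side x
    ... | false = refl , Fin.suc-injective e
    q-in : ∀ u → InClasses c zero (suc l₀) u → q (f u) ≡ l₀
    q-in u (inj₁ e) = does-true (q (f u) ≟ l₀) (proj₁ (∧-true (colour-zero (f u) e)))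
    q-in u (inj₂ e) = proj₂ (colour-suc (f u) l₀ e)
    two : ∀ (x y : Fin 2) → x ≢ zero → y ≢ zero → x ≡ y
    two zero       _          x≢ _  = contradiction refl x≢
    two (suc zero) zero       _  y≢ = contradiction refl y≢
    two (suc zero) (suc zero) _  _  = refl
    separated : ∀ x y → Adj filled x y → ∀ z → colour x ≡ z → colour y ≡ z → ⊥
    separated x y xy zero ex ey =
      let (Sx , bx) = ∧-true {S x} (colour-zero x ex)
          (Sy , by) = ∧-true {S y} (colour-zero y ey)
      in proj₂ (proj₂ (proj₂ (filled-edge x y
           (trans (does-true (q y ≟ l₀) Sy) (≡.sym (does-true (q x ≟ l₀) Sx))) xy)))
         (trans (does-true (b y ≟ zero) by) (≡.sym (does-true (b x ≟ zero) bx)))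
    separated x y xy (suc l) ex ey =
      let (¬x , qx) = colour-suc x l ex
          (¬y , qy) = colour-suc y l ey
          (Sx , Sy , _ , b≢) = filled-edge x y (trans qy (≡.sym qx)) xy
      in b≢ (two (b y) (b x)
           (λ e → true≢false (true-∧ Sy (dec-true (b y ≟ zero) e)) ¬y)
           (λ e → true≢false (true-∧ Sx (dec-true (b x ≟ zero) e)) ¬x))
    proper : ProperColouring F (suc k) c
    proper u v uv e = separated (f u) (f v) (f-hom u v uv) (c v) e refl

  -- Each added neighbour raises the power by at least `crossing q u ^ s`, which `c ^ s` turns into
  -- `n ^ s`.
  power-sum-filled : ∀ s c → (∀ u → n ≤ c * crossing q u) →
    c ^ s * power-sum (suc s) (crossing q) + edgesWithin (cut H b) S * n ^ s ≤
    c ^ s * power-sum (suc s) (deg filled)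
  power-sum-filled s c n≤ = begin
    c ^ s * power-sum (suc s) (crossing q) + edgesWithin (cut H b) S * n ^ s
      ≡⟨ cong₂ _+_ (∑-*ˡ (c ^ s) _) (∑-*ʳ (n ^ s) _) ⟨
    _ ≡⟨ ∑-+ _ _ ⟨
    _ ≤⟨ ∑-mono term ⟩
    _ ≡⟨ ∑-*ˡ (c ^ s) _ ⟩
    c ^ s * power-sum (suc s) (deg filled) ∎
    where
    open ≤-Reasoning
    term : ∀ u → c ^ s * crossing q u ^ suc s + extra u * n ^ s ≤ c ^ s * deg filled u ^ suc s
    term u = begin
      c ^ s * D ^ suc s + extra u * n ^ s
        ≤⟨ +-monoʳ-≤ (c ^ s * D ^ suc s) (*-monoʳ-≤ (extra u) (≤-trans (^-monoˡ-≤ s (n≤ u))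
             (≤-reflexive (^-distrib-* c D s)))) ⟩
      c ^ s * D ^ suc s + extra u * (c ^ s * D ^ s)
        ≡⟨ aux (c ^ s) (D ^ suc s) (extra u) (D ^ s) ⟩
      c ^ s * (D ^ suc s + extra u * D ^ s)
        ≤⟨ *-monoʳ-≤ (c ^ s) (≤-trans (pow-increment s D (extra u)) (^-monoˡ-≤ (suc s) (deg-filled u))) ⟩
      c ^ s * deg filled u ^ suc s ∎
      where
      D = crossing q u
      aux : ∀ w p e d → w * p + e * (w * d) ≡ w * (p + e * d)
      aux = solve-∀

-- The permutation carries class `zero` onto the dense set and preserves class sizes and power sums.
-- In the constant, `c * c` is lost by restricting to a set of size at least `n / c`, 2 by replacing
-- x(x - 1) with its square, and `c ^ s` by the powers of the degrees.
lower-bound : ∀ {n k} s c → 1 ≤ c → 2 * c ≤ n → (p : Fin n → Fin (suc (suc k))) →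
  (∀ l → n ≤ c * size p l) → ∀ {F : Graph m} (H : Graph n) → DFree H F (suc (suc k)) →
  ∀ M → (∀ (G : Graph n) → Free G F → power-sum (suc s) (deg G) ≤ M) →
  Σ (Fin n → Fin (suc (suc k))) λ q → (∀ l → size q l ≡ size p l) ×
    power-sum (suc s) (crossing q) ≡ power-sum (suc s) (crossing p) ×
    edges H * n ^ s ≤ 2 * (c * c) * c ^ s * (M ∸ power-sum (suc s) (crossing q))
lower-bound {n = n} {k} s c 1≤c 2c≤n p large {F} H dfree M extremal
  with edges≤cut H
... | b , cut-large with dense-subset (cut H b) (n ∸ size p zero) (size p zero) (m∸n+n≡m (count≤n _))
...   | S , count≡ , dense with matching-permutation (class p zero) S (≡.sym count≡)
...     | π , matches = q , size-permute p π , ∑q , final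
  where
  q : Fin n → Fin (suc (suc k))
  q = p ∘ (π ⟨$⟩ʳ_)
  x = size p zero
  module X = Fill q zero H b
  1≤n : 1 ≤ n
  1≤n = ≤-trans 1≤c (≤-trans (m≤m+n c _) 2c≤n)
  instance
    n≢0 : NonZero n
    n≢0 = >-nonZero 1≤n
    c≢0 : NonZero c
    c≢0 = >-nonZero 1≤c
    n²≢0 : NonZero (n * n)
    n²≢0 = m*n≢0 n n
  ∑q : power-sum (suc s) (crossing q) ≡ power-sum (suc s) (crossing p)
  ∑q = trans (∑-cong λ u → cong (_^ suc s) (crossing-permute p π u))
             (≡.sym (∑-permute (λ u → crossing p u ^ suc s) π))
  other : ∀ (x : Fin (suc (suc k))) → ∃ λ l → l ≢ x
  other zero    = suc zero , λ ()
  other (suc x) = zero , λ ()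
  n≤crossing : ∀ u → n ≤ c * crossing q u
  n≤crossing u = let (l , l≢) = other (q u) in
    ≤-trans (large l) (*-monoʳ-≤ c (≤-trans (≤-reflexive (≡.sym (size-permute p π l))) (size≤crossing q u l l≢)))
  E = edgesWithin (cut H b) X.S
  within≡ : edgesWithin (cut H b) S ≡ E
  within≡ = ∑-cong λ u → cong₂ _*_ (cong 𝟙 (≡.sym (matches u)))
    (∑-cong λ v → cong (λ z → 𝟙 (z ∧ adj (cut H b) u v)) (≡.sym (matches v)))
  -- `2 * c ≤ n` gives the class two vertices, so `x ∸ 1` is at least half of `x`.
  x-large : x * x ≤ 2 * (x * (x ∸ 1))
  x-large = go x (*-cancelˡ-≤ c (≤-trans (≤-reflexive (*-comm c 2)) (≤-trans 2c≤n (large zero))))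
    where
    go : ∀ x → 2 ≤ x → x * x ≤ 2 * (x * (x ∸ 1))
    go (suc (suc x)) _ = ≤-trans (*-monoʳ-≤ (2 + x) (≤-trans (m≤m+n (2 + x) x) (≤-reflexive (aux₁ x))))
                           (≤-reflexive (aux₂ (2 + x) (1 + x)))
      where
      aux₁ : ∀ x → 2 + x + x ≡ 2 * (1 + x)
      aux₁ = solve-∀
      aux₂ : ∀ a b → a * (2 * b) ≡ 2 * (a * b)
      aux₂ = solve-∀
    go (suc zero) (s≤s ())
  edges≤E : edges H ≤ 2 * (c * c) * E
  edges≤E = *-cancelʳ-≤ _ _ (n * n) (begin
    edges H * (n * n)                             ≤⟨ *-mono-≤ cut-large (*-mono-≤ (large zero) (large zero)) ⟩
    E₀ * (c * x * (c * x))                        ≡⟨ aux₁ E₀ c x ⟩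
    E₀ * (c * c) * (x * x)                        ≤⟨ *-monoʳ-≤ (E₀ * (c * c)) x-large ⟩
    E₀ * (c * c) * (2 * (x * (x ∸ 1)))            ≡⟨ aux₂ E₀ (c * c) (x * (x ∸ 1)) ⟩
    2 * (c * c) * (E₀ * (x * (x ∸ 1)))            ≤⟨ *-monoʳ-≤ (2 * (c * c)) dense ⟩
    2 * (c * c) * (edgesWithin (cut H b) S * (n * n)) ≡⟨ cong (λ e → 2 * (c * c) * (e * (n * n))) within≡ ⟩
    2 * (c * c) * (E * (n * n))                   ≡⟨ *-assoc (2 * (c * c)) E (n * n) ⟨
    2 * (c * c) * E * (n * n)                     ∎)
    where
    open ≤-Reasoning
    E₀ = ∑ (deg (cut H b))
    aux₁ : ∀ e c x → e * (c * x * (c * x)) ≡ e * (c * c) * (x * x)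
    aux₁ = solve-∀
    aux₂ : ∀ e c y → e * c * (2 * y) ≡ 2 * c * (e * y)
    aux₂ = solve-∀
  gain : E * n ^ s ≤ c ^ s * (M ∸ power-sum (suc s) (crossing q))
  gain = begin
    E * n ^ s
      ≡⟨ m+n∸m≡n (c ^ s * P) _ ⟨
    (c ^ s * P + E * n ^ s) ∸ c ^ s * P
      ≤⟨ ∸-monoˡ-≤ (c ^ s * P) (≤-trans (X.power-sum-filled s c n≤crossing)
           (*-monoʳ-≤ (c ^ s) (extremal X.filled (X.filled-free {F = F} dfree)))) ⟩
    c ^ s * M ∸ c ^ s * P
      ≡⟨ *-distribˡ-∸ (c ^ s) M P ⟨
    c ^ s * (M ∸ P) ∎
    where
    open ≤-Reasoning
    P = power-sum (suc s) (crossing q)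
  final : edges H * n ^ s ≤ 2 * (c * c) * c ^ s * (M ∸ power-sum (suc s) (crossing q))
  final = begin
    edges H * n ^ s                       ≤⟨ *-monoˡ-≤ (n ^ s) edges≤E ⟩
    2 * (c * c) * E * n ^ s               ≡⟨ *-assoc (2 * (c * c)) E (n ^ s) ⟩
    2 * (c * c) * (E * n ^ s)             ≤⟨ *-monoʳ-≤ (2 * (c * c)) gain ⟩
    2 * (c * c) * (c ^ s * (M ∸ power-sum (suc s) (crossing q))) ≡⟨ *-assoc (2 * (c * c)) (c ^ s) _ ⟨
    2 * (c * c) * c ^ s * (M ∸ power-sum (suc s) (crossing q)) ∎
    where open ≤-Reasoning

-- Assembling both bounds

multipartite-complete : (q : Fin n → Fin k) → (∀ l → 1 ≤ size q l) → CompleteMultipartite k (multipartite q)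
multipartite-complete q nonempty = q ,
  (λ l → let (u , h) = witness (class q l) (nonempty l) in u , does-true (q u ≟ l) h) ,
  λ u v → (λ uv e → true≢false uv (cong not (dec-true (q v ≟ q u) (≡.sym e)))) ,
          (λ ne → true-not (dec-false (q v ≟ q u) (ne ∘ ≡.sym)))

more-colours : ∀ {F : Graph m} {j} → Colourable F j → j ≤ k → Colourable F k
more-colours (c , proper) j≤k = (λ u → F.inject≤ (c u) j≤k) ,
  λ u v uv e → proper u v uv (Fin.inject≤-injective j≤k j≤k (c u) (c v) e)

module Assembly {m} (F : Graph m) (k s c C N : ℕ) (1≤c : 1 ≤ c)
  (chromatic : ChromaticNumber F (suc (suc (suc k)))) (upper : UpperBound m (suc (suc k)) s c C N) where

  K C′ : ℕ
  K = suc (suc k)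
  C′ = 2 * (c * c) * c ^ s

  conclusion : ∀ n → N + 2 * c ≤ n → ∀ M → IsExR (suc s) n F M → ∀ B → IsBiex n F K B →
    Σ (Graph n) λ T → CompleteMultipartite K T × eR (suc s) T ≤ M ×
      B * n ^ s ≤ (C + C′) * (M ∸ eR (suc s) T) × M ∸ eR (suc s) T ≤ (C + C′) * (B * n ^ s)
  conclusion n N≤n M ((G , G-free , eG≡M) , maximal) B ((H , H-free , eH≡B) , H-maximal) =
    multipartite q , multipartite-complete q nonempty , maximal (multipartite q) T-free , lower , at-most
    where
    open ≤-Reasoning
    2c≤n : 2 * c ≤ n
    2c≤n = m+n≤o⇒n≤o N N≤n
    1≤n : 1 ≤ n
    1≤n = ≤-trans 1≤c (≤-trans (m≤m+n c _) 2c≤n)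
    power-sum≤M : ∀ (G : Graph n) → Free G F → power-sum (suc s) (deg G) ≤ M
    power-sum≤M G free = ≤-trans (≤-reflexive (≡.sym (eR≡ (suc s) G))) (maximal G free)
    M≡ : M ≡ power-sum (suc s) (deg G)
    M≡ = trans (≡.sym eG≡M) (eR≡ (suc s) G)
    partite-free : (p : Fin n → Fin K) → Free (multipartite p) F
    partite-free p = colourable-free {F = F} (multipartite p) (proj₂ chromatic K ≤-refl)
      (p , multipartite-colourable p)
    bounded = upper (m+n≤o⇒m≤o N N≤n) {F} (proj₁ chromatic) G G-free
      (λ p → ≤-trans (power-sum≤M (multipartite p) (partite-free p)) (≤-reflexive M≡)) {B} H-maximal
    p = proj₁ bounded
    large = proj₁ (proj₂ bounded)
    added = lower-bound s c 1≤c 2c≤n p large {F} H H-free M power-sum≤M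
    q = proj₁ added
    T-free : Free (multipartite q) F
    T-free = partite-free q
    nonempty : ∀ l → 1 ≤ size q l
    nonempty l = positive (size q l) (≤-trans 1≤n (≤-trans (large l)
      (≤-reflexive (cong (c *_) (≡.sym (proj₁ (proj₂ added) l))))))
      where
      positive : ∀ x → 1 ≤ c * x → 1 ≤ x
      positive zero    h = ⊥-elim (1+n≰n (≤-trans h (≤-reflexive (*-zeroʳ c))))
      positive (suc x) _ = s≤s z≤n
    P = power-sum (suc s) (crossing q)
    eT≡ : eR (suc s) (multipartite q) ≡ P
    eT≡ = eR≡ (suc s) (multipartite q)
    lower : B * n ^ s ≤ (C + C′) * (M ∸ eR (suc s) (multipartite q))
    lower = begin
      B * n ^ s                 ≡⟨ cong (_* n ^ s) eH≡B ⟨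
      edges H * n ^ s           ≤⟨ proj₂ (proj₂ (proj₂ added)) ⟩
      C′ * (M ∸ P)              ≤⟨ *-monoˡ-≤ (M ∸ P) (m≤n+m C′ C) ⟩
      (C + C′) * (M ∸ P)        ≡⟨ cong (λ e → (C + C′) * (M ∸ e)) eT≡ ⟨
      (C + C′) * (M ∸ eR (suc s) (multipartite q)) ∎
    at-most : M ∸ eR (suc s) (multipartite q) ≤ (C + C′) * (B * n ^ s)
    at-most = begin
      -- The permuted partition `q` has the power sum of `p`, for which the upper bound was proved.
      M ∸ eR (suc s) (multipartite q)  ≡⟨ cong₂ _∸_ M≡ (trans eT≡ (proj₁ (proj₂ (proj₂ added)))) ⟩
      power-sum (suc s) (deg G) ∸ power-sum (suc s) (crossing p)
                                       ≤⟨ m≤n+o⇒m∸n≤o _ _ (proj₂ (proj₂ bounded)) ⟩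
      C * (B * n ^ s)                  ≤⟨ *-monoˡ-≤ (B * n ^ s) (m≤m+n C C′) ⟩
      (C + C′) * (B * n ^ s)           ∎

  1≤constant : 1 ≤ C + C′
  1≤constant = ≤-trans (*-mono-≤ {1} {2 * (c * c)} {1} (≤-trans (*-mono-≤ 1≤c 1≤c) (m≤m+n (c * c) _))
    (m^n>0 c {{>-nonZero 1≤c}} s)) (m≤n+m C′ C)

theorem1p7 : ∀ {m} (F : Graph m) → ¬ Bipartite F →
    ∀ (k : ℕ) → ChromaticNumber F (suc k) →
    ∀ (r : ℕ) → 1 ≤ r →
    Σ ℕ λ C → 1 ≤ C × Σ ℕ λ N → ∀ (n : ℕ) → N ≤ n →
    ∀ (M : ℕ) → IsExR r n F M → ∀ (B : ℕ) → IsBiex n F k B →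
    Σ (Graph n) λ T → CompleteMultipartite k T ×
    eR r T ≤ M ×
    B * n ^ (r ∸ 1) ≤ C * (M ∸ eR r T) ×
    M ∸ eR r T ≤ C * (B * n ^ (r ∸ 1))
-- A chromatic number below three contradicts non-bipartiteness; hence there are at least two
-- classes in what follows.
theorem1p7 F ¬bipartite zero (colouring , _) =
  contradiction (more-colours {F = F} colouring (s≤s z≤n)) ¬bipartite
theorem1p7 F ¬bipartite (suc zero) (colouring , _) = contradiction colouring ¬bipartite
theorem1p7 {m} F _ (suc (suc k)) chromatic (suc s) _ = from (upper-constants m k s)
  where
  from : (Σ ℕ λ c → 1 ≤ c × Σ ℕ λ C → Σ ℕ λ N → UpperBound m (suc (suc k)) s c C N) → _
  from (c , 1≤c , C , N , upper) = C + 2 * (c * c) * c ^ s , A.1≤constant , N + 2 * c , A.conclusion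
    where module A = Assembly F k s c C N 1≤c chromatic upper
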